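{- Let $G$ be a finite connected simple graph. The connected subgraph arrangement $\mathcal{A}_G$ is factored if and only if $G$ is a path graph or is isomorphic to a path-with-triangle graph $\Delta_{n,1}$ for some $n\ge 2$.
   Context: For a finite simple graph $G=(N,E)$ with $N=\{1,\dots,n\}$ and $I\subseteq N$, $G[I]$ denotes the induced subgraph on $I$, and $H_I=\ker\big(\sum_{i\in I}x_i\big)$, where $x_1,\dots,x_n$ are the coordinate functions. The connected subgraph arrangement of $G$ is $\mathcal{A}_G=\{H_I:\emptyset\neq I\subseteq N,\ G[I]\text{ connected}\}$ over $\mathbb{Q}$. The path graph $P_m$ has vertices $1,\dots,m$ and edges $\{i,i+1\}$. $\Delta_{n,1}$ has vertices $1,\dots,n+1$ and edges $\{i,i+1\}$ ($1\le i<n$), $\{1,n+1\}$, $\{2,n+1\}$ (so $\Delta_{2,1}$ is a triangle). A partition $\pi=(\pi_1,\dots,\pi_s)$ of an arrangement $\mathcal{A}$ is nice if (i) for every choice $H_i\in\pi_i$ the $s$ defining forms are linearly independent, and (ii) for every $X\in L(\mathcal{A})\setminus\{V\}$ the induced partition of $\mathcal{A}_X=\{H\in\mathcal{A}:X\subseteq H\}$ into the nonempty sets $\pi_i\cap\mathcal{A}_X$ has a singleton block. $\mathcal{A}$ is factored if it admits a nice partition. -}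

module Defs where

open import Data.Bool.Base using (if_then_else_)
open import Data.Fin.Base using (Fin; toℕ)
import Data.Fin.Properties as Fin
open import Data.Fin.Subset using (Subset; _∈_; Nonempty)
open import Data.List.Base using (List)
open import Data.List.Relation.Unary.All using (All)
open import Data.Nat.Base using (ℕ; suc; _≤_; _<_)
import Data.Nat.Properties as ℕ
open import Data.Product.Base using (Σ; ∃; ∃-syntax; _×_; _,_; proj₁; proj₂)
open import Data.Rational using (ℚ; 0ℚ; 1ℚ; _*_)
open import Data.Rational.Properties using (+-0-commutativeMonoid)
open import Data.Sum.Base using (_⊎_; swap)
open import Data.Vec.Base using (lookup)
open import Data.Vec.Functional using (Vector)
open import Data.Vec.Properties using ([]=⇒lookup)
open import Function.Base using (_∘_)
open import Function.Bundles using (_↔_; _⇔_; Inverse; Surjection)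
open import Level using (0ℓ)
open import Relation.Binary.Bundles using (Setoid)
open import Relation.Binary.Core using (Rel)
open import Relation.Binary.Definitions using (Decidable; Symmetric; Irreflexive)
open import Relation.Binary.Construct.Closure.ReflexiveTransitive using (Star)
import Relation.Binary.Construct.On as On
open import Relation.Binary.PropositionalEquality
  using (_≡_; _≢_; refl; sym; trans; cong; setoid)
open import Relation.Nullary using (¬_; ¬?; _×-dec_; _⊎-dec_)
open import Relation.Unary using (Pred; U; _⊆_; _≐_)
open import Relation.Unary.Relation.Binary.Equality using (≐-setoid)
open import Algebra.Properties.CommutativeMonoid.Sum +-0-commutativeMonoid using (sum)

------------------------------------------------------------------------
-- Graphs

record SimpleGraph (V : Set) : Set₁ where
  field
    Adj    : Rel V 0ℓ
    adj?   : Decidable Adj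
    adjSym : Symmetric Adj
    irrefl : Irreflexive _≡_ Adj

-- The empty graph is not connected.
Connected : ∀ {V} → SimpleGraph V → Set
Connected {V} G = V × (∀ u v → Star Adj u v)
  where open SimpleGraph G

_[_] : ∀ {n} → SimpleGraph (Fin n) → (I : Subset n) → SimpleGraph (∃[ v ] v ∈ I)
G [ I ] = record
  { Adj    = λ u v → Adj (proj₁ u) (proj₁ v)
  ; adj?   = λ u v → adj? (proj₁ u) (proj₁ v)
  ; adjSym = adjSym
  ; irrefl = irrefl ∘ cong proj₁
  }
  where open SimpleGraph G

infix 4 _≅_

_≅_ : ∀ {V W} → SimpleGraph V → SimpleGraph W → Set
_≅_ {V} {W} G H =
  Σ (V ↔ W) λ f → ∀ u v → G.Adj u v ⇔ H.Adj (Inverse.to f u) (Inverse.to f v)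
  where
  module G = SimpleGraph G
  module H = SimpleGraph H

-- The graph on the labels 1, …, m (the vertex i : Fin m carries the label
-- suc (toℕ i)) with an edge {a , b} for every related pair a ≠ b.
label : ∀ {m} → Fin m → ℕ
label i = suc (toℕ i)

fromEdges : ∀ m {E : Rel ℕ 0ℓ} → Decidable E → SimpleGraph (Fin m)
fromEdges m {E} E? = record
  { Adj    = λ i j → i ≢ j × (E (label i) (label j) ⊎ E (label j) (label i))
  ; adj?   = λ i j → ¬? (i Fin.≟ j)
               ×-dec (E? (label i) (label j) ⊎-dec E? (label j) (label i))
  ; adjSym = λ (i≢j , e) → i≢j ∘ sym , swap e
  ; irrefl = λ i≡j (i≢j , _) → i≢j i≡j
  }

PathEdge : Rel ℕ 0ℓ
PathEdge a b = b ≡ suc a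

path : (m : ℕ) → SimpleGraph (Fin m)
path m = fromEdges m {PathEdge} λ a b → b ℕ.≟ suc a

TriangleEdge : ℕ → Rel ℕ 0ℓ
TriangleEdge n a b =
  (a < n × b ≡ suc a) ⊎ (a ≡ 1 × b ≡ suc n) ⊎ (a ≡ 2 × b ≡ suc n)

-- Δ_{n,1}, meaningful for n ≥ 2.
Δ₁ : (n : ℕ) → SimpleGraph (Fin (suc n))
Δ₁ n = fromEdges (suc n) {TriangleEdge n} λ a b →
  (a ℕ.<? n ×-dec b ℕ.≟ suc a)
  ⊎-dec (a ℕ.≟ 1 ×-dec b ℕ.≟ suc n)
  ⊎-dec (a ℕ.≟ 2 ×-dec b ℕ.≟ suc n)

------------------------------------------------------------------------
-- Hyperplane arrangements over ℚ

-- A linear form on ℚⁿ, as its coefficients in the basis x₁, …, xₙ.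
Form : ℕ → Set
Form n = Vector ℚ n

ker : ∀ {n} → Form n → Pred (Vector ℚ n) 0ℓ
ker α v = sum (λ k → α k * v k) ≡ 0ℚ

LinearlyIndependent : ∀ {n s} → Vector (Form n) s → Set
LinearlyIndependent {n} {s} α =
  (c : Vector ℚ s) → (∀ k → sum (λ j → c j * α j k) ≡ 0ℚ) → ∀ j → c j ≡ 0ℚ

-- A family of nonzero forms presenting the set of hyperplanes { H i }.
-- Indices with the same kernel present the same hyperplane: the arrangement
-- itself is the setoid `hyperplanes`.
record Arrangement (n : ℕ) : Set₁ where
  field
    Index   : Set
    form    : Index → Form n
    nonzero : ∀ i → ∃[ k ] form i k ≢ 0ℚ

  H : Index → Pred (Vector ℚ n) 0ℓ
  H i = ker (form i)

  hyperplanes : Setoid 0ℓ 0ℓ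
  hyperplanes = On.setoid (≐-setoid (Vector ℚ n) 0ℓ) H

  -- The intersection of finitely many hyperplanes; ⋂ [] is the whole space.
  ⋂ : List Index → Pred (Vector ℚ n) 0ℓ
  ⋂ B v = All (λ i → H i v) B

  -- The intersection lattice.
  L : Pred (Pred (Vector ℚ n) 0ℓ) 0ℓ
  L X = ∃[ B ] X ≐ ⋂ B

-- A partition into s nonempty blocks is a surjection sending each hyperplane
-- to the number of its block.
Partition : ∀ {n} → Arrangement n → ℕ → Set
Partition A s = Surjection (Arrangement.hyperplanes A) (setoid (Fin s))

module _ {n s} (A : Arrangement n) (π : Partition A s) where
  open Arrangement A
  open Surjection π using () renaming (to to block)

  Independent : Set
  Independent = (σ : Fin s → Index) → (∀ k → block (σ k) ≡ k) →
                LinearlyIndependent (form ∘ σ)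

  -- The index i presents a member of π_k ∩ A_X.
  InducedBlock : Pred (Vector ℚ n) 0ℓ → Fin s → Pred Index 0ℓ
  InducedBlock X k i = block i ≡ k × X ⊆ H i

  HasSingletonBlock : Pred (Vector ℚ n) 0ℓ → Set
  HasSingletonBlock X =
    ∃[ k ] ∃[ i ] InducedBlock X k i × (∀ j → InducedBlock X k j → H j ≐ H i)

  Nice : Set₁
  Nice = Independent × (∀ X → L X → ¬ (X ≐ U) → HasSingletonBlock X)

Factored : ∀ {n} → Arrangement n → Set₁
Factored A = ∃[ s ] Σ (Partition A s) (Nice A)

------------------------------------------------------------------------
-- Connected subgraph arrangements

-- The form Σ_{i ∈ I} xᵢ.
indicator : ∀ {n} → Subset n → Form n
indicator I k = if lookup I k then 1ℚ else 0ℚ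

indicator-nonzero : ∀ {n} {I : Subset n} → Nonempty I → ∃[ k ] indicator I k ≢ 0ℚ
indicator-nonzero {I = I} (k , k∈I) = k , λ eq → 1≢0 (trans (sym one) eq)
  where
  one : indicator I k ≡ 1ℚ
  one = cong (λ b → if b then 1ℚ else 0ℚ) ([]=⇒lookup k∈I)

  1≢0 : 1ℚ ≢ 0ℚ
  1≢0 ()

connectedSubgraphArrangement : ∀ {n} → SimpleGraph (Fin n) → Arrangement n
connectedSubgraphArrangement {n} G = record
  { Index   = Σ (Subset n) λ I → Nonempty I × Connected (G [ I ])
  ; form    = λ (I , _) → indicator I
  ; nonzero = λ (_ , I≢∅ , _) → indicator-nonzero I≢∅
  }

module Submission where

-- In a nice partition two hyperplanes share a block only if they lie in a pencil of three, and a pencil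
-- of three meets exactly two blocks: its flat has a singleton block, and three blocks would give a
-- dependent section.  For 0/1 forms the pencils are the triples A , B , A ⊔ B of connected sets.
-- Contracting disjoint connected sets keeps these conditions, and a finite search shows that they
-- fail for K_{1,3}, for every graph on four vertices containing a 4-cycle, and for two triangles
-- sharing a vertex.  A graph without these can be built one vertex at a time from an induced path or
-- Δ_{k,1}, so it is a path or Δ_{m,1}.
--
-- Conversely, number the vertices 0 , … , m such that the edges are {i , i + 1} and possibly {0 , 2}.
-- The connected sets are the intervals and the sets {0} ∪ {2 , … , j}.  Put the intervals [1 , j] into
-- one block, with {0}, and any other set into the block of its greatest element.

open import Data.Bool.Base using (Bool; true; false; _∧_; _∨_; not; T; if_then_else_)
import Data.Bool.Properties as Bool
open import Data.Bool.ListAction using (any; all)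
open import Data.Empty using (⊥; ⊥-elim)
open import Data.Fin.Base using (Fin; zero; suc; toℕ; fromℕ<)
open import Data.Fin.Patterns using (0F; 1F; 2F; 3F; 4F)
import Data.Fin.Properties as Fin
open import Data.Fin.Subset using (Subset; Nonempty; _∈_; _∉_; ⁅_⁆; _∪_) renaming (⊥ to ∅; _⊆_ to _⊆ˢ_)
open import Data.Fin.Subset.Properties
  using (_∈?_; ⊆-antisym; x∈⁅x⁆; x∈⁅y⁆⇒x≡y; p⊆p∪q; q⊆p∪q; x∈p∪q⁻)
import Data.List.Base as List
open List using (List; []; _∷_; length; allFin; upTo)
open import Data.List.Membership.Propositional using (find) renaming (_∈_ to _∈ᴸ_)
open import Data.List.Membership.Propositional.Properties using (∈-allFin; ∈-lookup; ∈-upTo⁺)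
import Data.List.Relation.Unary.All as All
open All using (All; []; _∷_)
import Data.List.Relation.Unary.All.Properties as All
open import Data.List.Relation.Unary.AllPairs using (AllPairs; []; _∷_)
import Data.List.Relation.Unary.Any as Any
import Data.List.Relation.Unary.Any.Properties as Any
open import Data.Nat.Base
  using (ℕ; zero; suc; pred; _+_; _∸_; _≤_; _<_; _≡ᵇ_; z≤n; s≤s; >-nonZero)
import Data.Nat.Properties as ℕ
open import Data.Product.Base using (Σ; ∃; ∃-syntax; ∃₂; _×_; _,_; proj₁; proj₂)
open import Data.Rational using (ℚ; 0ℚ; 1ℚ; -_; 1/_; ≢-nonZero) renaming (_+_ to _+ℚ_; _*_ to _*ℚ_)
import Data.Rational.Properties as ℚ
open import Data.Rational.Solver using (module +-*-Solver)
open import Data.Sum.Base using (_⊎_; inj₁; inj₂; [_,_]′)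
open import Data.Vec.Base using (lookup)
open import Data.Vec.Functional using (Vector)
open import Data.Vec.Properties
  using ([]=⇒lookup; lookup⇒[]=; lookup-zipWith; lookup-replicate; tabulate∘lookup; tabulate-cong)
open import Data.Vec.Properties.WithK using ([]=-irrelevant)
open import Function.Base using (_∘_; id)
open import Function.Bundles using (Surjection; _⇔_; mk⇔; Equivalence; Inverse; mk↔ₛ′)
open import Level using (0ℓ)
open import Relation.Binary.Construct.Closure.ReflexiveTransitive
  using (Star; ε; _◅_; _◅◅_; gmap; reverse)
import Relation.Binary.Construct.Closure.ReflexiveTransitive as Star
open import Relation.Binary.Core using (Rel)
open import Relation.Binary.Definitions using (DecidableEquality; tri<; tri≈; tri>)
open import Relation.Binary.PropositionalEquality hiding ([_])
open import Relation.Nullary using (¬_; ¬?; Dec; yes; no; contradiction; _×-dec_; _⊎-dec_)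
open import Relation.Nullary.Decidable
  using (T?; toWitness; fromWitness; decidable-stable; map′; ⌊_⌋)
open import Relation.Unary using (Pred; U; Decidable; _⊆_; _≐_)
open import Algebra.Bundles using (CommutativeRing)
open import Algebra.Properties.CommutativeMonoid.Sum ℚ.+-0-commutativeMonoid
  using (sum; ∑-distrib-+; sum-cong-≗; sum-replicate-zero)
open import Algebra.Properties.Group ℚ.+-0-group using (identityˡ-unique; ∙-cancelˡ)
open import Algebra.Properties.Semiring.Sum (CommutativeRing.semiring ℚ.+-*-commutativeRing)
  using (*-distribˡ-sum)
open +-*-Solver using (solve; _:=_; _:+_; _:*_; :-_; con)
open import Defs

-- Linear forms

-- The necessity argument uses the singleton condition only for the intersection of two hyperplanes,
-- and independence only for a relation between three forms. This makes contraction possible: if two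
-- hyperplanes come from unions of disjoint connected parts, so does every further hyperplane
-- through their intersection, its set being their union or a difference. Vertices outside the parts
-- cannot interfere, and a long cycle, or two triangles joined by a path, shrinks to a graph on four
-- or five vertices.
--
-- The sets [1 , j] are singled out in the converse because of the triangle. There, sorting by
-- greatest element alone gives blocks of sizes 1, 2, 4, whereas the characteristic polynomial is (t
-- - 1)(t - 3)^2 and the block sizes of a nice partition are its roots. Moving the sets [1 , j]
-- gives 3, 1, 3. The converse then has to treat flats of every rank. In partial sums of coordinates
-- the intervals become equalities σ a = σ b, so a flat enters only through a transitive relation on
-- the ends of intervals, a predicate for the notched sets, and a few rules connecting the two.

infix 8 _∙_

_∙_ : ∀ {n} → Vector ℚ n → Vector ℚ n → ℚ
α ∙ v = sum (λ k → α k *ℚ v k)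

∙-cong : ∀ {n} {α β : Vector ℚ n} → (∀ k → α k ≡ β k) → (v : Vector ℚ n) → α ∙ v ≡ β ∙ v
∙-cong α≗β v = sum-cong-≗ (λ k → cong (_*ℚ v k) (α≗β k))

∙-comm : ∀ {n} (α v : Vector ℚ n) → α ∙ v ≡ v ∙ α
∙-comm α v = sum-cong-≗ (λ k → ℚ.*-comm (α k) (v k))

∙-zeroˡ : ∀ {n} {α : Vector ℚ n} → (∀ k → α k ≡ 0ℚ) → ∀ v → α ∙ v ≡ 0ℚ
∙-zeroˡ {n} α≗0 v =
  trans (sum-cong-≗ (λ k → trans (cong (_*ℚ v k) (α≗0 k)) (ℚ.*-zeroˡ (v k))))
        (sum-replicate-zero n)

∙-linearʳ : ∀ {n} (α v w : Vector ℚ n) a b →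
            α ∙ (λ k → a *ℚ v k +ℚ b *ℚ w k) ≡ a *ℚ (α ∙ v) +ℚ b *ℚ (α ∙ w)
∙-linearʳ α v w a b = begin
  α ∙ (λ k → a *ℚ v k +ℚ b *ℚ w k)
    ≡⟨ sum-cong-≗ (λ k → solve 5 (λ α v w a b → α :* (a :* v :+ b :* w) := a :* (α :* v) :+ b :* (α :* w))
        refl (α k) (v k) (w k) a b) ⟩
  sum (λ k → a *ℚ (α k *ℚ v k) +ℚ b *ℚ (α k *ℚ w k))
    ≡⟨ ∑-distrib-+ (λ k → a *ℚ (α k *ℚ v k)) (λ k → b *ℚ (α k *ℚ w k)) ⟩
  sum (λ k → a *ℚ (α k *ℚ v k)) +ℚ sum (λ k → b *ℚ (α k *ℚ w k))
    ≡⟨ cong₂ _+ℚ_ (sym (*-distribˡ-sum a (λ k → α k *ℚ v k))) (sym (*-distribˡ-sum b (λ k → α k *ℚ w k))) ⟩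
  a *ℚ (α ∙ v) +ℚ b *ℚ (α ∙ w) ∎
  where open ≡-Reasoning

∙-linearˡ : ∀ {n} (α β v : Vector ℚ n) a b →
            (λ k → a *ℚ α k +ℚ b *ℚ β k) ∙ v ≡ a *ℚ (α ∙ v) +ℚ b *ℚ (β ∙ v)
∙-linearˡ α β v a b = trans (∙-comm _ v) (trans (∙-linearʳ v α β a b)
  (cong₂ (λ x y → a *ℚ x +ℚ b *ℚ y) (∙-comm v α) (∙-comm v β)))

δ : ∀ {n} → Fin n → Vector ℚ n
δ zero    zero    = 1ℚ
δ zero    (suc k) = 0ℚ
δ (suc u) zero    = 0ℚ
δ (suc u) (suc k) = δ u k

δ-same : ∀ {n} (u : Fin n) → δ u u ≡ 1ℚ
δ-same zero    = refl
δ-same (suc u) = δ-same u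

δ-diff : ∀ {n} {u v : Fin n} → u ≢ v → δ u v ≡ 0ℚ
δ-diff {u = zero}  {zero}  u≢v = contradiction refl u≢v
δ-diff {u = zero}  {suc v} u≢v = refl
δ-diff {u = suc u} {zero}  u≢v = refl
δ-diff {u = suc u} {suc v} u≢v = δ-diff (u≢v ∘ cong suc)

δ-∙ : ∀ {n} (u : Fin n) v → δ u ∙ v ≡ v u
δ-∙ zero    v = trans (cong₂ _+ℚ_ (ℚ.*-identityˡ (v zero)) (∙-zeroˡ (λ _ → refl) (v ∘ suc)))
    (ℚ.+-identityʳ (v zero))
δ-∙ (suc u) v = trans (cong₂ _+ℚ_ (ℚ.*-zeroˡ (v zero)) (δ-∙ u (v ∘ suc))) (ℚ.+-identityˡ (v (suc u)))

∙-δ : ∀ {n} (α : Vector ℚ n) u → α ∙ δ u ≡ α u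
∙-δ α u = trans (∙-comm α (δ u)) (δ-∙ u α)

*-zero-cancelˡ : ∀ {p q} → p ≢ 0ℚ → p *ℚ q ≡ 0ℚ → q ≡ 0ℚ
*-zero-cancelˡ {p} {q} p≢0 pq≡0 = begin
  q                ≡⟨ sym (ℚ.*-identityˡ q) ⟩
  1ℚ *ℚ q          ≡⟨ cong (_*ℚ q) (sym (ℚ.*-inverseˡ p)) ⟩
  1/ p *ℚ p *ℚ q   ≡⟨ ℚ.*-assoc (1/ p) p q ⟩
  1/ p *ℚ (p *ℚ q) ≡⟨ cong (1/ p *ℚ_) pq≡0 ⟩
  1/ p *ℚ 0ℚ       ≡⟨ ℚ.*-zeroʳ (1/ p) ⟩
  0ℚ ∎
  where
  open ≡-Reasoning
  instance _ = ≢-nonZero p≢0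

module _ {n} {Index : Set} (form : Index → Form n) where

  Common : List Index → Vector ℚ n → Set
  Common B v = All (λ i → ker (form i) v) B

  Vanishes : List Index → Form n → Set
  Vanishes B α = ∀ {v} → Common B v → ker α v

  -- Elimination without division: if β v ≠ 0 for some v killed by B, then α vanishes on the
  -- common kernel of β ∷ B as soon as (β v) α − (α v) β vanishes on that of B.
  vanishes⊎witness : ∀ B α → Vanishes B α ⊎ (∃[ v ] Common B v × ¬ ker α v)
  vanishes⊎witness [] α with Fin.any? (λ k → ¬? (α k ℚ.≟ 0ℚ))
  ... | yes (k , αk≢0) = inj₂ (δ k , [] , αk≢0 ∘ trans (sym (∙-δ α k)))
  ... | no ∄k          =
    inj₁ λ {v} _ → ∙-zeroˡ (λ k → decidable-stable (α k ℚ.≟ 0ℚ) (λ αk≢0 → ∄k (k , αk≢0))) v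
  vanishes⊎witness (i ∷ B) α with vanishes⊎witness B (form i)
  ... | inj₁ β∈⟨B⟩ with vanishes⊎witness B α
  ...   | inj₁ van            = inj₁ λ { (_ ∷ Bv) → van Bv }
  ...   | inj₂ (v , Bv , αv≢0) = inj₂ (v , β∈⟨B⟩ Bv ∷ Bv , αv≢0)
  vanishes⊎witness (i ∷ B) α | inj₂ (v , Bv , βv≢0)
    with vanishes⊎witness B (λ k → (form i ∙ v) *ℚ α k +ℚ (- (α ∙ v)) *ℚ form i k)
  ... | inj₁ van = inj₁ λ { {w} (βw≡0 ∷ Bw) → *-zero-cancelˡ βv≢0 (begin
      (form i ∙ v) *ℚ (α ∙ w)
        ≡⟨ solve 2 (λ x y → x := x :+ y :* con 0ℚ) refl _ (- (α ∙ v)) ⟩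
      (form i ∙ v) *ℚ (α ∙ w) +ℚ (- (α ∙ v)) *ℚ 0ℚ
        ≡⟨ cong (λ z → (form i ∙ v) *ℚ (α ∙ w) +ℚ (- (α ∙ v)) *ℚ z) (sym βw≡0) ⟩
      (form i ∙ v) *ℚ (α ∙ w) +ℚ (- (α ∙ v)) *ℚ (form i ∙ w)
        ≡⟨ sym (∙-linearˡ α (form i) w (form i ∙ v) (- (α ∙ v))) ⟩
      (λ k → (form i ∙ v) *ℚ α k +ℚ (- (α ∙ v)) *ℚ form i k) ∙ w
        ≡⟨ van Bw ⟩
      0ℚ ∎) }
    where open ≡-Reasoning
  ... | inj₂ (w , Bw , α′w≢0) = inj₂ (w′ , βw′≡0 ∷ All.zipWith killed (Bv , Bw) , α′w≢0 ∘ trans α′w≡αw′)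
    where
    open ≡-Reasoning
    β = form i
    w′ = λ k → (β ∙ v) *ℚ w k +ℚ (- (β ∙ w)) *ℚ v k
    βw′≡0 : β ∙ w′ ≡ 0ℚ
    βw′≡0 = trans (∙-linearʳ β w v (β ∙ v) (- (β ∙ w)))
      (solve 2 (λ x y → x :* y :+ (:- y) :* x := con 0ℚ) refl (β ∙ v) (β ∙ w))
    killed : ∀ {j} → ker (form j) v × ker (form j) w → ker (form j) w′
    killed {j} (jv≡0 , jw≡0) = trans (∙-linearʳ (form j) w v (β ∙ v) (- (β ∙ w)))
      (trans (cong₂ (λ x y → (β ∙ v) *ℚ x +ℚ (- (β ∙ w)) *ℚ y) jw≡0 jv≡0)
      (solve 2 (λ x y → x :* con 0ℚ :+ (:- y) :* con 0ℚ := con 0ℚ) refl (β ∙ v) (β ∙ w)))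
    α′w≡αw′ : (λ k → (β ∙ v) *ℚ α k +ℚ (- (α ∙ v)) *ℚ β k) ∙ w ≡ α ∙ w′
    α′w≡αw′ = begin
      (λ k → (β ∙ v) *ℚ α k +ℚ (- (α ∙ v)) *ℚ β k) ∙ w   ≡⟨ ∙-linearˡ α β w (β ∙ v) (- (α ∙ v)) ⟩
      (β ∙ v) *ℚ (α ∙ w) +ℚ (- (α ∙ v)) *ℚ (β ∙ w)       ≡⟨ solve 4
          (λ a b c d → a :* b :+ (:- c) :* d := a :* b :+ (:- d) :* c) refl (β ∙ v) (α ∙ w) (α ∙ v)
            (β ∙ w) ⟩
      (β ∙ v) *ℚ (α ∙ w) +ℚ (- (β ∙ w)) *ℚ (α ∙ v)       ≡⟨ sym (∙-linearʳ α w v (β ∙ v) (- (β ∙ w))) ⟩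
      α ∙ w′ ∎

  -- Decides whether a flat lies in a hyperplane. The search for a singleton block in a flat rests
  -- on this choice.
  vanishes? : ∀ B α → Dec (∀ {v} → Common B v → ker α v)
  vanishes? B α with vanishes⊎witness B α
  ... | inj₁ van             = yes van
  ... | inj₂ (v , Bv , αv≢0) = no λ van → αv≢0 (van Bv)

-- Rank two flats

-- As coefficients, c = a + b.
data Add : (c a b : Bool) → Set where
  neither : Add false false false
  left    : Add true true false
  right   : Add true false true

-- `C` is the disjoint union of `A` and `B`, as the identity of indicator forms that puts the three
-- hyperplanes into one pencil.
record Split {n} (C A B : Subset n) : Set where
  constructor pointwise
  field bit : ∀ v → Add (lookup C v) (lookup A v) (lookup B v)

open Split

lookup-ext : ∀ {n} {A B : Subset n} → (∀ v → lookup A v ≡ lookup B v) → A ≡ B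
lookup-ext {A = A} {B} eq =
  trans (sym (tabulate∘lookup A)) (trans (tabulate-cong eq) (tabulate∘lookup B))

χ : Bool → ℚ
χ b = if b then 1ℚ else 0ℚ

χ-zero : ∀ {b} → χ b ≡ 0ℚ → b ≡ false
χ-zero {false} _ = refl

χ-add : ∀ {c a b} → Add c a b → χ c ≡ χ a +ℚ χ b
χ-add neither = refl
χ-add left    = refl
χ-add right   = refl

δ₂ : ∀ {n} (u v : Fin n) → Vector ℚ n
δ₂ u v k = 1ℚ *ℚ δ u k +ℚ (- 1ℚ) *ℚ δ v k

δ₃ : ∀ {n} (u v w : Fin n) → Vector ℚ n
δ₃ u v w k = 1ℚ *ℚ δ₂ u v k +ℚ (- 1ℚ) *ℚ δ w k

diff₂ : ℚ → ℚ → ℚ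
diff₂ x y = 1ℚ *ℚ x +ℚ (- 1ℚ) *ℚ y

diff₃ : ℚ → ℚ → ℚ → ℚ
diff₃ x y z = 1ℚ *ℚ diff₂ x y +ℚ (- 1ℚ) *ℚ z

∙-δ₂ : ∀ {n} (α : Vector ℚ n) u v → α ∙ δ₂ u v ≡ diff₂ (α u) (α v)
∙-δ₂ α u v = trans (∙-linearʳ α (δ u) (δ v) 1ℚ (- 1ℚ)) (cong₂ diff₂ (∙-δ α u) (∙-δ α v))

∙-δ₃ : ∀ {n} (α : Vector ℚ n) u v w → α ∙ δ₃ u v w ≡ diff₃ (α u) (α v) (α w)
∙-δ₃ α u v w = trans (∙-linearʳ α (δ₂ u v) (δ w) 1ℚ (- 1ℚ))
  (cong₂ (λ x y → 1ℚ *ℚ x +ℚ (- 1ℚ) *ℚ y) (∙-δ₂ α u v) (∙-δ α w))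

nonempty⇒lookup : ∀ {n} {A : Subset n} → Nonempty A → ∃[ u ] lookup A u ≡ true
nonempty⇒lookup (u , u∈A) = u , []=⇒lookup u∈A

ker-⊆⇒⊇ : ∀ {n} {A B : Subset n} → (∀ {v} → ker (indicator A) v → ker (indicator B) v) →
           ∀ {u} → lookup A u ≡ false → lookup B u ≡ false
ker-⊆⇒⊇ {A = A} {B} A⊆B {u} Au≡f =
  χ-zero (trans (sym (∙-δ (indicator B) u)) (A⊆B (trans (∙-δ (indicator A) u) (cong χ Au≡f))))

-- Unit vectors in the kernel read off the complement of the set. Hence equality of hyperplanes,
-- which the definition of a partition speaks of, is equality of vertex sets.
ker-injective : ∀ {n} {A B : Subset n} → ker (indicator A) ≐ ker (indicator B) → A ≡ B
ker-injective {A = A} {B} (A⊆B , B⊆A) = lookup-ext same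
  where
  same : ∀ v → lookup A v ≡ lookup B v
  same v with lookup A v in a | lookup B v in b
  ... | false | false = refl
  ... | true  | true  = refl
  ... | false | true  = trans (sym (ker-⊆⇒⊇ {A = A} {B} A⊆B a)) b
  ... | true  | false = trans (sym a) (ker-⊆⇒⊇ {A = B} {A} B⊆A b)

module _ {n} {A B J : Subset n} (A≢∅ : Nonempty A) (B≢∅ : Nonempty B) (J≢∅ : Nonempty J)
         (A≢B : A ≢ B)
         (van : ∀ {v} → ker (indicator A) v → ker (indicator B) v → ker (indicator J) v) where

  private
    Cell : Bool → Bool → Fin n → Set
    Cell a b u = lookup A u ≡ a × lookup B u ≡ b

    cell? : ∀ a b → Dec (∃ (Cell a b))
    cell? a b = Fin.any? λ u → (lookup A u Bool.≟ a) ×-dec (lookup B u Bool.≟ b)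

    outside-both : ∀ {v} → Cell false false v → lookup J v ≡ false
    outside-both {v} (a , b) = χ-zero (trans (sym (∙-δ (indicator J) v))
      (van (trans (∙-δ (indicator A) v) (cong χ a)) (trans (∙-δ (indicator B) v) (cong χ b))))

    diff₂-zero : ∀ x → diff₂ (χ x) (χ x) ≡ 0ℚ
    diff₂-zero false = refl
    diff₂-zero true  = refl

    diff₂-χ-injective : ∀ x y → diff₂ (χ x) (χ y) ≡ 0ℚ → x ≡ y
    diff₂-χ-injective false false _  = refl
    diff₂-χ-injective true  true  _  = refl

    constant : ∀ {a b u v} → Cell a b u → Cell a b v → lookup J v ≡ lookup J u
    constant {a} {b} {u} {v} (Au , Bu) (Av , Bv) = diff₂-χ-injective _ _
      (trans (sym (∙-δ₂ (indicator J) v u))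
             (van (trans (∙-δ₂ (indicator A) v u)
                 (trans (cong₂ (λ x y → diff₂ (χ x) (χ y)) Av Au) (diff₂-zero a)))
                  (trans (∙-δ₂ (indicator B) v u)
                      (trans (cong₂ (λ x y → diff₂ (χ x) (χ y)) Bv Bu) (diff₂-zero b)))))

    diff₃-χ : ∀ x y z → diff₃ (χ x) (χ y) (χ z) ≡ 0ℚ → Add x y z
    diff₃-χ false false false _ = neither
    diff₃-χ true  true  false _ = left
    diff₃-χ true  false true  _ = right
    diff₃-χ false true  true  ()

    -- `δ₃ p q r` pairs with the two forms to 1 - 1 - 0 and 1 - 0 - 1, so it lies on both
    -- hyperplanes and therefore on that of `J`.
    relation : ∀ {p q r} → Cell true true p → Cell true false q → Cell false true r →
               Add (lookup J p) (lookup J q) (lookup J r)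
    relation {p} {q} {r} (Ap , Bp) (Aq , Bq) (Ar , Br) = diff₃-χ _ _ _
      (trans (sym (∙-δ₃ (indicator J) p q r))
            (van (trans (∙-δ₃ (indicator A) p q r) (diff₃-cong Ap Aq Ar))
                 (trans (∙-δ₃ (indicator B) p q r) (diff₃-cong Bp Bq Br))))
      where
      diff₃-cong : ∀ {x y z x′ y′ z′} → x ≡ x′ → y ≡ y′ → z ≡ z′ →
                   diff₃ (χ x) (χ y) (χ z) ≡ diff₃ (χ x′) (χ y′) (χ z′)
      diff₃-cong refl refl refl = refl

    Known : (Bool → Set) → Bool → Bool → Set
    Known P a b = (∀ {v} → ¬ Cell a b v) ⊎ (∃[ u ] Cell a b u × P (lookup J u))

    -- Since `J` is constant on the cells cut out by `A` and `B` and empty outside both, one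
    -- representative of each nonempty cell decides a pointwise property.
    everywhere : (P : Bool → Bool → Bool → Set) → P false false false →
                 Known (λ j → P j true true) true true →
                 Known (λ j → P j true false) true false →
                 Known (λ j → P j false true) false true →
                 ∀ v → P (lookup J v) (lookup A v) (lookup B v)
    everywhere P P₀ k₁ k₂ k₃ v with lookup A v in a | lookup B v in b
    ... | false | false = subst (λ j → P j false false) (sym (outside-both (a , b))) P₀
    ... | true  | true  = from k₁
      where
      from : Known (λ j → P j true true) true true → P (lookup J v) true true
      from (inj₁ empty)       = ⊥-elim (empty (a , b))
      from (inj₂ (u , c , x)) = subst (λ j → P j true true) (sym (constant c (a , b))) x
    ... | true  | false = from k₂
      where
      from : Known (λ j → P j true false) true false → P (lookup J v) true false
      from (inj₁ empty)       = ⊥-elim (empty (a , b))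
      from (inj₂ (u , c , x)) = subst (λ j → P j true false) (sym (constant c (a , b))) x
    ... | false | true  = from k₃
      where
      from : Known (λ j → P j false true) false true → P (lookup J v) false true
      from (inj₁ empty)       = ⊥-elim (empty (a , b))
      from (inj₂ (u , c , x)) = subst (λ j → P j false true) (sym (constant c (a , b))) x

    J-is-empty : {C : Set} → (∀ v → lookup J v ≡ false) → C
    J-is-empty all-out with nonempty⇒lookup J≢∅
    ... | u , Ju = contradiction (trans (sym Ju) (all-out u)) λ ()

    Outcome : Set
    Outcome = J ≡ A ⊎ J ≡ B ⊎ Split J A B ⊎ Split A J B ⊎ Split B J A

    is-A : (∀ v → lookup J v ≡ lookup A v) → Outcome
    is-A = inj₁ ∘ lookup-ext
    is-B : (∀ v → lookup J v ≡ lookup B v) → Outcome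
    is-B = inj₂ ∘ inj₁ ∘ lookup-ext

    disjoint : (∀ {v} → ¬ Cell true true v) → ∃ (Cell true false) → ∃ (Cell false true) → Outcome
    disjoint ∄p (q , cq) (r , cr) with lookup J q in jq | lookup J r in jr
    ... | false | false =
        J-is-empty (everywhere (λ j _ _ → j ≡ false) refl (inj₁ ∄p) (inj₂ (q , cq , jq))
          (inj₂ (r , cr , jr)))
    ... | true  | false =
        is-A (everywhere (λ j a _ → j ≡ a) refl (inj₁ ∄p) (inj₂ (q , cq , jq)) (inj₂ (r , cr , jr)))
    ... | false | true  =
        is-B (everywhere (λ j _ b → j ≡ b) refl (inj₁ ∄p) (inj₂ (q , cq , jq)) (inj₂ (r , cr , jr)))
    ... | true  | true  = inj₂ (inj₂ (inj₁ (pointwise (everywhere Add neither (inj₁ ∄p)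
      (inj₂ (q , cq , subst (λ j → Add j true false) (sym jq) left))
      (inj₂ (r , cr , subst (λ j → Add j false true) (sym jr) right))))))

    A-inside-B : ∃ (Cell true true) → (∀ {v} → ¬ Cell true false v) → ∃ (Cell false true) → Outcome
    A-inside-B (p , cp) ∄q (r , cr) with lookup J p in jp | lookup J r in jr
    ... | false | false =
        J-is-empty (everywhere (λ j _ _ → j ≡ false) refl (inj₂ (p , cp , jp)) (inj₁ ∄q)
          (inj₂ (r , cr , jr)))
    ... | true  | false =
        is-A (everywhere (λ j a _ → j ≡ a) refl (inj₂ (p , cp , jp)) (inj₁ ∄q) (inj₂ (r , cr , jr)))
    ... | true  | true  =
        is-B (everywhere (λ j _ b → j ≡ b) refl (inj₂ (p , cp , jp)) (inj₁ ∄q) (inj₂ (r , cr , jr)))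
    ... | false | true  = inj₂ (inj₂ (inj₂ (inj₂ (pointwise (everywhere (λ j a b → Add b j a) neither
      (inj₂ (p , cp , subst (λ j → Add true j true) (sym jp) right)) (inj₁ ∄q)
      (inj₂ (r , cr , subst (λ j → Add true j false) (sym jr) left)))))))

    B-inside-A : ∃ (Cell true true) → ∃ (Cell true false) → (∀ {v} → ¬ Cell false true v) → Outcome
    B-inside-A (p , cp) (q , cq) ∄r with lookup J p in jp | lookup J q in jq
    ... | false | false =
        J-is-empty (everywhere (λ j _ _ → j ≡ false) refl (inj₂ (p , cp , jp)) (inj₂ (q , cq , jq))
          (inj₁ ∄r))
    ... | true  | false =
        is-B (everywhere (λ j _ b → j ≡ b) refl (inj₂ (p , cp , jp)) (inj₂ (q , cq , jq)) (inj₁ ∄r))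
    ... | true  | true  =
        is-A (everywhere (λ j a _ → j ≡ a) refl (inj₂ (p , cp , jp)) (inj₂ (q , cq , jq)) (inj₁ ∄r))
    ... | false | true  = inj₂ (inj₂ (inj₂ (inj₁ (pointwise (everywhere (λ j a b → Add a j b) neither
      (inj₂ (p , cp , subst (λ j → Add true j true) (sym jp) right))
      (inj₂ (q , cq , subst (λ j → Add true j false) (sym jq) left)) (inj₁ ∄r))))))

    crossing : ∃ (Cell true true) → ∃ (Cell true false) → ∃ (Cell false true) → Outcome
    crossing (p , cp) (q , cq) (r , cr) = by-values refl refl refl (relation cp cq cr)
      where
      by-values : ∀ {x y z} → lookup J p ≡ x → lookup J q ≡ y → lookup J r ≡ z → Add x y z → Outcome
      by-values jp jq jr neither =
          J-is-empty (everywhere (λ j _ _ → j ≡ false) refl (inj₂ (p , cp , jp)) (inj₂ (q , cq , jq))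
            (inj₂ (r , cr , jr)))
      by-values jp jq jr left    =
          is-A (everywhere (λ j a _ → j ≡ a) refl (inj₂ (p , cp , jp)) (inj₂ (q , cq , jq))
            (inj₂ (r , cr , jr)))
      by-values jp jq jr right   =
          is-B (everywhere (λ j _ b → j ≡ b) refl (inj₂ (p , cp , jp)) (inj₂ (q , cq , jq))
            (inj₂ (r , cr , jr)))

  -- `J` is determined by its bits on the three cells of `A` and `B`. If all three are inhabited,
  -- `relation` leaves only `A`, `B` and the empty set. If one is missing, the two remaining bits
  -- are free, and the new possibility is the disjoint union or the difference. Two missing cells
  -- would make the sets equal or one of them empty.
  pencil : J ≡ A ⊎ J ≡ B ⊎ Split J A B ⊎ Split A J B ⊎ Split B J A
  pencil with cell? true true | cell? true false | cell? false true
  ... | yes p | yes q | yes r = crossing p q r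
  ... | yes p | yes q | no ∄r = B-inside-A p q (λ c → ∄r (_ , c))
  ... | yes p | no ∄q | yes r = A-inside-B p (λ c → ∄q (_ , c)) r
  ... | no ∄p | yes q | yes r = disjoint (λ c → ∄p (_ , c)) q r
  ... | yes p | no ∄q | no ∄r = contradiction (lookup-ext eq) A≢B
    where
    eq : ∀ v → lookup A v ≡ lookup B v
    eq v with lookup A v in a | lookup B v in b
    ... | false | false = refl
    ... | true  | true  = refl
    ... | false | true  = ⊥-elim (∄r (v , a , b))
    ... | true  | false = ⊥-elim (∄q (v , a , b))
  ... | no ∄p | no ∄q | _ with nonempty⇒lookup A≢∅
  ...   | u , Au with lookup B u in b
  ...     | true  = ⊥-elim (∄p (u , Au , b))
  ...     | false = ⊥-elim (∄q (u , Au , b))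
  pencil | no ∄p | _ | no ∄r with nonempty⇒lookup B≢∅
  ...   | u , Bu with lookup A u in a
  ...     | true  = ⊥-elim (∄p (u , a , Bu))
  ...     | false = ⊥-elim (∄r (u , a , Bu))

Add-functional : ∀ {c d a b} → Add c a b → Add d a b → c ≡ d
Add-functional neither neither = refl
Add-functional left    left    = refl
Add-functional right   right   = refl

Split-functional : ∀ {n} {C D A B : Subset n} → Split C A B → Split D A B → C ≡ D
Split-functional c d = lookup-ext λ v → Add-functional (bit c v) (bit d v)

Split-disjoint : ∀ {n} {C A B : Subset n} → Split C A B → ∀ {u} → lookup A u ≡ true → lookup B u ≡ true → ⊥
Split-disjoint split {u} a b = both (bit split u) a b
  where
  both : ∀ {c a b} → Add c a b → a ≡ true → b ≡ true → ⊥
  both neither () _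
  both left _ ()
  both right () _

Split-⊇ʳ : ∀ {n} {C A B : Subset n} → Split C A B → ∀ {u} → lookup B u ≡ true → lookup C u ≡ true
Split-⊇ʳ split {u} b = up (bit split u) b
  where
  up : ∀ {c a b} → Add c a b → b ≡ true → c ≡ true
  up right _ = refl

-- Pencils of hyperplanes in a nice partition

module _ {n} {G : SimpleGraph (Fin n)} {s} (π : Partition (connectedSubgraphArrangement G) s)
         (nice : Nice (connectedSubgraphArrangement G) π) where

  open Arrangement (connectedSubgraphArrangement G)
  open Surjection π renaming (to to block; cong to block-respects)

  private
    support : Index → Subset n
    support = proj₁

    inhabited : ∀ i → ∃[ u ] lookup (support i) u ≡ true
    inhabited (_ , I≢∅ , _) = nonempty⇒lookup I≢∅

  block-cong : ∀ {i j} → support i ≡ support j → block i ≡ block j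
  block-cong eq =
      block-respects (subst (λ J → ker (indicator J) _) eq , subst (λ J → ker (indicator J) _) (sym eq))

  private
    pencil-singleton : ∀ i j → HasSingletonBlock (connectedSubgraphArrangement G) π (⋂ (i ∷ j ∷ []))
    pencil-singleton i j = proj₂ nice _ (i ∷ j ∷ [] , id , id) not-everything
      where
      not-everything : ¬ (⋂ (i ∷ j ∷ []) ≐ U)
      not-everything (_ , all) with inhabited i
      ... | u , iu with all {δ u} _
      ...   | zero-at-u ∷ _ =
        contradiction (trans (sym (cong χ iu)) (trans (sym (∙-δ (indicator (support i)) u)) zero-at-u)) λ ()

    pencil-member : ∀ {i j l} → support i ≢ support j → ⋂ (i ∷ j ∷ []) ⊆ H l →
                    support l ≡ support i ⊎ support l ≡ support j ⊎
                    Split (support l) (support i) (support j) ⊎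
                    Split (support i) (support l) (support j) ⊎
                    Split (support j) (support l) (support i)
    pencil-member {i} {j} {l} i≢j X⊆H =
      pencil (proj₁ (proj₂ i)) (proj₁ (proj₂ j)) (proj₁ (proj₂ l)) i≢j λ iv jv → X⊆H (iv ∷ jv ∷ [])

  -- The flat of the two hyperplanes has a singleton block, which cannot be the block shared by `i`
  -- and `j`. Its member is a third hyperplane of the pencil.
  third-member : ∀ i j → support i ≢ support j → block i ≡ block j →
    ∃[ l ] (Split (support l) (support i) (support j) ⊎
            Split (support i) (support l) (support j) ⊎
            Split (support j) (support l) (support i))
  third-member i j i≢j bi≡bj with pencil-singleton i j
  ... | _ , l , (refl , X⊆H) , unique with pencil-member {i} {j} {l} i≢j X⊆H
  ...   | inj₁ l≡i =
      contradiction (trans (sym l≡i) (sym (ker-injective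
        (unique j (trans (sym bi≡bj) (block-cong (sym l≡i)) , λ { (_ ∷ jv ∷ []) → jv }))))) i≢j
  ...   | inj₂ (inj₁ l≡j) =
      contradiction (trans (ker-injective (unique i
        (trans bi≡bj (block-cong (sym l≡j)) , λ { (iv ∷ _) → iv }))) l≡j) i≢j
  ...   | inj₂ (inj₂ split) = l , split

  module _ {i j k} (split : Split (support k) (support i) (support j)) where

    private
      i≢j : support i ≢ support j
      i≢j eq with inhabited i
      ... | u , iu = Split-disjoint split iu (subst (λ J → lookup J u ≡ true) eq iu)

      i≢k : support i ≢ support k
      i≢k eq with inhabited j
      ... | u , ju = Split-disjoint split (subst (λ J → lookup J u ≡ true) (sym eq) (Split-⊇ʳ split ju)) ju

      through-k : ⋂ (i ∷ j ∷ []) ⊆ H k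
      through-k {v} (iv ∷ jv ∷ []) = begin
        indicator (support k) ∙ v
          ≡⟨ ∙-cong (λ u → trans (χ-add (bit split u))
              (sym (cong₂ _+ℚ_ (ℚ.*-identityˡ (indicator (support i) u))
                (ℚ.*-identityˡ (indicator (support j) u))))) v ⟩
        (λ u → 1ℚ *ℚ indicator (support i) u +ℚ 1ℚ *ℚ indicator (support j) u) ∙ v
          ≡⟨ ∙-linearˡ (indicator (support i)) (indicator (support j)) v 1ℚ 1ℚ ⟩
        1ℚ *ℚ (indicator (support i) ∙ v) +ℚ 1ℚ *ℚ (indicator (support j) ∙ v)
          ≡⟨ cong₂ (λ x y → 1ℚ *ℚ x +ℚ 1ℚ *ℚ y) iv jv ⟩
        0ℚ ∎
        where open ≡-Reasoning

    -- By `pencil` nothing but `i`, `j` and `k` passes through the flat. With a single colour, the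
    -- only induced block would have three members.
    not-monochromatic : block i ≡ block j → block i ≡ block k → ⊥
    not-monochromatic bi≡bj bi≡bk with pencil-singleton i j
    ... | _ , l , (refl , X⊆H) , unique = i≢j (trans i≡l (sym j≡l))
      where
      block-l : block l ≡ block i
      block-l with pencil-member {i} {j} {l} i≢j X⊆H
      ... | inj₁ l≡i                      = block-cong l≡i
      ... | inj₂ (inj₁ l≡j)               = trans (block-cong l≡j) (sym bi≡bj)
      ... | inj₂ (inj₂ (inj₁ split′))     = trans (block-cong (Split-functional split′ split)) (sym bi≡bk)
      ... | inj₂ (inj₂ (inj₂ (inj₁ sp))) with inhabited j
      ...   | u , ju = ⊥-elim (Split-disjoint split (Split-⊇ʳ sp ju) ju)
      block-l | inj₂ (inj₂ (inj₂ (inj₂ sp))) with inhabited i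
      ...   | u , iu = ⊥-elim (Split-disjoint split iu (Split-⊇ʳ sp iu))
      i≡l : support i ≡ support l
      i≡l = ker-injective (unique i (sym block-l , λ { (iv ∷ _) → iv }))
      j≡l : support j ≡ support l
      j≡l = ker-injective (unique j (trans (sym bi≡bj) (sym block-l) , λ { (_ ∷ jv ∷ []) → jv }))

    -- Some section of the partition would pass through all three, and the coefficients 1 at `k` and
    -- - 1 at `i` and `j` would be a nontrivial relation on it.
    not-rainbow : block i ≢ block j → block i ≢ block k → block j ≢ block k → ⊥
    not-rainbow bi≢bj bi≢bk bj≢bk =
        contradiction (trans (sym c-at-i) (proj₁ nice σ σ-section c relation (block i))) λ ()
      where
      open ≡-Reasoning
      σ : Fin s → Index
      σ x with x Fin.≟ block i | x Fin.≟ block j | x Fin.≟ block k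
      ... | yes _ | _     | _     = i
      ... | no _  | yes _ | _     = j
      ... | no _  | no _  | yes _ = k
      ... | no _  | no _  | no _  = proj₁ (strictlySurjective x)

      σ-section : ∀ x → block (σ x) ≡ x
      σ-section x with x Fin.≟ block i | x Fin.≟ block j | x Fin.≟ block k
      ... | yes x≡ | _      | _      = sym x≡
      ... | no _   | yes x≡ | _      = sym x≡
      ... | no _   | no _   | yes x≡ = sym x≡
      ... | no _   | no _   | no _   = proj₂ (strictlySurjective x)

      σ-i : σ (block i) ≡ i
      σ-i with block i Fin.≟ block i
      ... | yes _ = refl
      ... | no ≢  = contradiction refl ≢

      σ-j : σ (block j) ≡ j
      σ-j with block j Fin.≟ block i | block j Fin.≟ block j
      ... | yes ≡ | _     = contradiction (sym ≡) bi≢bj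
      ... | no _  | yes _ = refl
      ... | no _  | no ≢  = contradiction refl ≢

      σ-k : σ (block k) ≡ k
      σ-k with block k Fin.≟ block i | block k Fin.≟ block j | block k Fin.≟ block k
      ... | yes ≡ | _     | _     = contradiction (sym ≡) bi≢bk
      ... | no _  | yes ≡ | _     = contradiction (sym ≡) bj≢bk
      ... | no _  | no _  | yes _ = refl
      ... | no _  | no _  | no ≢  = contradiction refl ≢

      c : Vector ℚ s
      c = δ₃ (block k) (block i) (block j)

      c-at-i : c (block i) ≡ - 1ℚ
      c-at-i = begin
        c (block i)           ≡⟨ cong₂ (λ x y → diff₃ x y (δ (block j) (block i))) (δ-diff (bi≢bk ∘ sym))
            (δ-same (block i)) ⟩
        diff₃ 0ℚ 1ℚ (δ (block j) (block i)) ≡⟨ cong (diff₃ 0ℚ 1ℚ) (δ-diff (bi≢bj ∘ sym)) ⟩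
        - 1ℚ ∎

      relation : ∀ u → c ∙ (λ x → form (σ x) u) ≡ 0ℚ
      relation u = begin
        c ∙ (λ x → form (σ x) u)
          ≡⟨ ∙-comm c (λ x → form (σ x) u) ⟩
        (λ x → form (σ x) u) ∙ c
          ≡⟨ ∙-δ₃ (λ x → form (σ x) u) (block k) (block i) (block j) ⟩
        diff₃ (form (σ (block k)) u) (form (σ (block i)) u) (form (σ (block j)) u)
          ≡⟨ cong₂ (λ x y → diff₃ (form x u) (form y u) (form (σ (block j)) u)) σ-k σ-i ⟩
        diff₃ (form k u) (form i u) (form (σ (block j)) u)
          ≡⟨ cong (λ y → diff₃ (form k u) (form i u) (form y u)) σ-j ⟩
        diff₃ (form k u) (form i u) (form j u)
          ≡⟨ balanced (bit split u) ⟩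
        0ℚ ∎
        where
        balanced : ∀ {c a b} → Add c a b → diff₃ (χ c) (χ a) (χ b) ≡ 0ℚ
        balanced neither = refl
        balanced left    = refl
        balanced right   = refl

-- Connected subsets

exit : {A : Set} {R : Rel A 0ℓ} {P : Pred A 0ℓ} → Decidable P → ∀ {u v} → P u → ¬ P v →
       Star R u v → ∃₂ λ a b → P a × ¬ P b × R a b
exit P? Pu ¬Pv ε = contradiction Pu ¬Pv
exit P? {u} Pu ¬Pv (_◅_ {j = w} uRw w⟶v) with P? w
... | yes Pw = exit P? Pw ¬Pv w⟶v
... | no ¬Pw = u , w , Pu , ¬Pw , uRw

module _ {n} (G : SimpleGraph (Fin n)) where
  open SimpleGraph G

  -- Adjacency inside `I` on bare vertices. Walks in `G [ I ]` carry membership proofs in their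
  -- vertices; without them, walks can be carried over to a larger set. Irrelevance of membership
  -- proofs allows the way back.
  Step : Subset n → Rel (Fin n) 0ℓ
  Step I u v = Adj u v × u ∈ I × v ∈ I

  step-sym : ∀ {I u v} → Step I u v → Step I v u
  step-sym (uv , u∈I , v∈I) = adjSym uv , v∈I , u∈I

  private
    inside : ∀ {I u v} → Star (Step I) u v → (u∈I : u ∈ I) (v∈I : v ∈ I) →
             Star (SimpleGraph.Adj (G [ I ])) (u , u∈I) (v , v∈I)
    inside ε u∈I v∈I with []=-irrelevant u∈I v∈I
    ... | refl = ε
    inside ((uw , _ , w∈I) ◅ w⟶v) u∈I v∈I = uw ◅ inside w⟶v w∈I v∈I

    outside : ∀ {I} {x y : ∃[ v ] v ∈ I} → Star (SimpleGraph.Adj (G [ I ])) x y →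
              Star (Step I) (proj₁ x) (proj₁ y)
    outside = gmap proj₁ λ {x} {y} xy → xy , proj₂ x , proj₂ y

  rooted⇒connected : ∀ {I r} → r ∈ I → (∀ {v} → v ∈ I → Star (Step I) r v) → Connected (G [ I ])
  rooted⇒connected {r = r} r∈I reach = (r , r∈I) , λ (u , u∈I) (v , v∈I) →
    inside (reverse step-sym (reach u∈I) ◅◅ reach v∈I) u∈I v∈I

  connected⇒joined : ∀ {I} → Connected (G [ I ]) → ∀ {u v} → u ∈ I → v ∈ I → Star (Step I) u v
  connected⇒joined (_ , joined) u∈I v∈I = outside (joined (_ , u∈I) (_ , v∈I))

  step-mono : ∀ {I J u v} → I ⊆ˢ J → Star (Step I) u v → Star (Step J) u v
  step-mono I⊆J = Star.map λ (uv , u∈I , v∈I) → uv , I⊆J u∈I , I⊆J v∈I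

  connected-⁅⁆ : ∀ v → Connected (G [ ⁅ v ⁆ ])
  connected-⁅⁆ v = rooted⇒connected (x∈⁅x⁆ v) λ {w} w∈ → subst (Star (Step ⁅ v ⁆) v) (sym (x∈⁅y⁆⇒x≡y v w∈))
      ε

  connected-∪ : ∀ {A B a b} → Connected (G [ A ]) → Connected (G [ B ]) →
                a ∈ A → b ∈ B → Adj a b → Connected (G [ A ∪ B ])
  connected-∪ {A} {B} {a} {b} A-conn B-conn a∈A b∈B ab = rooted⇒connected (p⊆p∪q B a∈A) reach
    where
    reach : ∀ {v} → v ∈ A ∪ B → Star (Step (A ∪ B)) a v
    reach v∈ with x∈p∪q⁻ A B v∈
    ... | inj₁ v∈A = step-mono (p⊆p∪q B) (connected⇒joined A-conn a∈A v∈A)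
    ... | inj₂ v∈B = (ab , p⊆p∪q B a∈A , q⊆p∪q A B b∈B) ◅ step-mono (q⊆p∪q A B)
        (connected⇒joined B-conn b∈B v∈B)

-- Colourings of contractions

any⁻ : ∀ {A : Set} (p : A → Bool) xs → T (any p xs) → ∃[ x ] x ∈ᴸ xs × T (p x)
any⁻ p xs t = find (Any.any⁻ p xs t)

all⁻ : ∀ {A : Set} (p : A → Bool) {xs} → T (all p xs) → ∀ {x} → x ∈ᴸ xs → T (p x)
all⁻ p {xs} t = All.lookup (All.all⁺ p xs t)

module _ {a b : Bool} where
  ∧⁻ : T (a ∧ b) → T a × T b
  ∧⁻ = Equivalence.to Bool.T-∧
  ∨⁻ : T (a ∨ b) → T a ⊎ T b
  ∨⁻ = Equivalence.to Bool.T-∨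

T-not⁻ : ∀ {b} → T (not b) → ¬ T b
T-not⁻ {false} _ ()

module Refutation {W : Set} (apart : W → W → Bool) (triple : W → W → W → Bool) where

  forbidden : ℕ → ℕ → ℕ → Bool
  forbidden r r′ r″ = ((r ≡ᵇ r′) ∧ (r ≡ᵇ r″)) ∨ (not (r ≡ᵇ r′) ∧ (not (r ≡ᵇ r″) ∧ not (r′ ≡ᵇ r″)))

  -- Tests only the constraints involving the word just coloured; every other one was tested when
  -- its last word was coloured.
  clash : List (W × ℕ) → W → ℕ → Bool
  clash Γ w r = any (λ (w′ , r′) →
    ((r ≡ᵇ r′) ∧ apart w w′) ∨ any (λ (w″ , r″) → triple w w′ w″ ∧ forbidden r r′ r″) Γ) Γ

  -- Depth first search over the colourings of ws, up to renaming of colours: Γ records the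
  -- colours given so far, which are those below k.
  refute : List W → List (W × ℕ) → ℕ → Bool
  refute []       Γ k = false
  refute (w ∷ ws) Γ k =
    all (λ r → clash Γ w r ∨ refute ws ((w , r) ∷ Γ) k) (upTo k) ∧
    (clash Γ w k ∨ refute ws ((w , k) ∷ Γ) (suc k))

  module _ {C : Set} (_≟_ : DecidableEquality C) (colour : W → C)
    (apart-sound : ∀ {w w′} → T (apart w w′) → colour w ≢ colour w′)
    (triple-sound : ∀ {w w′ w″} → T (triple w w′ w″) →
      ¬ (colour w ≡ colour w′ × colour w ≡ colour w″) ×
      ¬ (colour w ≢ colour w′ × colour w ≢ colour w″ × colour w′ ≢ colour w″))
    where

    Injective : ℕ → (ℕ → C) → Set
    Injective k ρ = ∀ {i j} → i < k → j < k → ρ i ≡ ρ j → i ≡ j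

    Entry : ℕ → (ℕ → C) → W × ℕ → Set
    Entry k ρ (w , r) = r < k × colour w ≡ ρ r

    private
      module _ {k ρ} (inj : Injective k ρ) where

        same : ∀ {w r w′ r′} → Entry k ρ (w , r) → Entry k ρ (w′ , r′) → T (r ≡ᵇ r′) → colour w ≡ colour w′
        same {r = r} {r′ = r′} (_ , w≡) (_ , w′≡) t = trans w≡ (trans (cong ρ (ℕ.≡ᵇ⇒≡ r r′ t)) (sym w′≡))

        different : ∀ {w r w′ r′} → Entry k ρ (w , r) → Entry k ρ (w′ , r′) → T (not (r ≡ᵇ r′)) →
            colour w ≢ colour w′
        different {r = r} {r′ = r′} (r< , w≡) (r′< , w′≡) t eq =
          T-not⁻ t (ℕ.≡⇒≡ᵇ r r′ (inj r< r′< (trans (sym w≡) (trans eq w′≡))))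

        clash-sound : ∀ {Γ w r} → All (Entry k ρ) Γ → Entry k ρ (w , r) → ¬ T (clash Γ w r)
        clash-sound {Γ} {w} {r} Γ-ok e t with any⁻ _ Γ t
        ... | (w′ , r′) , ∈Γ , t′ with All.lookup Γ-ok ∈Γ | ∨⁻ {(r ≡ᵇ r′) ∧ apart w w′} t′
        ...   | e′ | inj₁ bad with ∧⁻ bad
        ...     | r≡r′ , ap = apart-sound ap (same e e′ r≡r′)
        clash-sound {Γ} {w} {r} Γ-ok e t | (w′ , r′) , ∈Γ , t′ | e′ | inj₂ some with any⁻ _ Γ some
        ... | (w″ , r″) , ∈Γ′ , t″ with All.lookup Γ-ok ∈Γ′ | ∧⁻ {triple w w′ w″} t″
        ...   | e″ | tr , forb with triple-sound tr | ∨⁻ {(r ≡ᵇ r′) ∧ (r ≡ᵇ r″)} forb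
        ...     | ¬mono , _ | inj₁ eqs with ∧⁻ {r ≡ᵇ r′} eqs
        ...       | r≡r′ , r≡r″ = ¬mono (same e e′ r≡r′ , same e e″ r≡r″)
        clash-sound {Γ} {w} {r} Γ-ok e t | (w′ , r′) , ∈Γ , t′ | e′ | inj₂ some | (w″ , r″) , ∈Γ′ ,
            t″ | e″ | tr , forb | _ , ¬rainbow | inj₂ nes
          with ∧⁻ {not (r ≡ᵇ r′)} nes
        ... | n₁ , n₂₃ with ∧⁻ {not (r ≡ᵇ r″)} n₂₃
        ...   | n₂ , n₃ = ¬rainbow (different e e′ n₁ , different e e″ n₂ , different e′ e″ n₃)

      extend : ℕ → C → (ℕ → C) → ℕ → C
      extend k c ρ i with i ℕ.≟ k
      ... | yes _ = c
      ... | no _  = ρ i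

      extend-new : ∀ k c ρ → extend k c ρ k ≡ c
      extend-new k c ρ with k ℕ.≟ k
      ... | yes _ = refl
      ... | no k≢k = contradiction refl k≢k

      extend-old : ∀ {k c ρ i} → i < k → extend k c ρ i ≡ ρ i
      extend-old {k} {i = i} i<k with i ℕ.≟ k
      ... | yes refl = contradiction i<k (ℕ.<-irrefl refl)
      ... | no _     = refl

      extend-injective : ∀ {k c ρ} → Injective k ρ → (∀ {i} → i < k → ρ i ≢ c) →
          Injective (suc k) (extend k c ρ)
      extend-injective {k} inj fresh {i} {j} i<1+k j<1+k eq with i ℕ.≟ k | j ℕ.≟ k
      ... | yes refl | yes refl = refl
      ... | yes refl | no j≢k   = contradiction (sym eq) (fresh (ℕ.≤∧≢⇒< (ℕ.≤-pred j<1+k) j≢k))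
      ... | no i≢k   | yes refl = contradiction eq (fresh (ℕ.≤∧≢⇒< (ℕ.≤-pred i<1+k) i≢k))
      ... | no i≢k   | no j≢k   = inj (ℕ.≤∧≢⇒< (ℕ.≤-pred i<1+k) i≢k) (ℕ.≤∧≢⇒< (ℕ.≤-pred j<1+k) j≢k) eq

      entry-extend : ∀ {k c ρ e} → Entry k ρ e → Entry (suc k) (extend k c ρ) e
      entry-extend {c = c} {ρ} (r<k , w≡) = ℕ.m≤n⇒m≤1+n r<k , trans w≡ (sym (extend-old {c = c} {ρ} r<k))

    -- The actual colouring guides the search. `ρ` translates the numbers in use into actual
    -- colours, injectively, so the colour of the next word is `ρ r` for an old `r` or is taken as
    -- the translation of `k`. This branch never clashes, so it survives until `ws` is exhausted,
    -- where `refute` is false.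
    refute-sound : ∀ ws Γ k ρ → Injective k ρ → All (Entry k ρ) Γ → ¬ T (refute ws Γ k)
    refute-sound (w ∷ ws) Γ k ρ inj Γ-ok t with ∧⁻ {all _ (upTo k)} t | ℕ.anyUpTo? (λ r → ρ r ≟ colour w) k
    ... | old , _ | yes (r , r<k , ρr≡) with ∨⁻ {clash Γ w r} (all⁻ _ {upTo k} old (∈-upTo⁺ r<k))
    ...   | inj₁ cl  = clash-sound inj Γ-ok (r<k , sym ρr≡) cl
    ...   | inj₂ rec = refute-sound ws _ k ρ inj ((r<k , sym ρr≡) ∷ Γ-ok) rec
    refute-sound (w ∷ ws) Γ k ρ inj Γ-ok t | _ , new | no ∄r with ∨⁻ {clash Γ w k} new
    ... | inj₁ cl  =
        clash-sound inj′ (All.map entry-extend Γ-ok) (ℕ.≤-refl , sym (extend-new k (colour w) ρ)) cl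
      where inj′ = extend-injective inj λ i<k eq → ∄r (_ , i<k , eq)
    ... | inj₂ rec = refute-sound ws _ (suc k) (extend k (colour w) ρ) inj′
                       ((ℕ.≤-refl , sym (extend-new k (colour w) ρ)) ∷ All.map entry-extend Γ-ok) rec
      where inj′ = extend-injective inj λ i<k eq → ∄r (_ , i<k , eq)

Word : ℕ → Set
Word K = List (Fin K)

-- `near` lists pairs of parts joined by an edge and `far` pairs without one. A pair in neither list
-- is left open, so one refutation covers several contracted graphs at once.
module Quotient {K} (near far : List (Fin K × Fin K)) where

  _==_ : Fin K → Fin K → Bool
  i == j = ⌊ i Fin.≟ j ⌋

  listed : List (Fin K × Fin K) → Fin K → Fin K → Bool
  listed ps i j = any (λ (a , b) → ((a == i) ∧ (b == j)) ∨ ((a == j) ∧ (b == i))) ps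

  some every : (Fin K → Bool) → Bool
  some  p = any p (allFin K)
  every p = all p (allFin K)

  mem : Fin K → Word K → Bool
  mem j w = any (j ==_) w

  -- Each letter of a word is near a later one, so that words spell connected sets.
  valid : Word K → Bool
  valid []              = false
  valid (j ∷ [])        = true
  valid (j ∷ w@(_ ∷ _)) = any (listed near j) w ∧ valid w

  -- A certificate that the parts in `r` do not form a connected set: one of them is far from all
  -- the others, of which there is at least one.
  isolating : (Fin K → Bool) → Bool
  isolating r = some λ j → r j ∧ (some (λ i → r i ∧ not (i == j)) ∧
                                  every (λ i → not (r i ∧ not (i == j)) ∨ listed far j i))

  -- For a union or difference that might be the third member of a pencil: `r` is the result, and
  -- `bad` marks the parts that spoil the operation, such as a common part for a disjoint union.
  blocked : (bad r : Fin K → Bool) → Bool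
  blocked bad r = some bad ∨ isolating r

  -- No connected set completes w and w′ to a pencil of three hyperplanes.
  apart : Word K → Word K → Bool
  apart w w′ =
    some (λ j → (mem j w ∧ not (mem j w′)) ∨ (mem j w′ ∧ not (mem j w))) ∧
    (blocked (λ j → mem j w ∧ mem j w′) (λ j → mem j w ∨ mem j w′) ∧
    (blocked (λ j → mem j w′ ∧ not (mem j w)) (λ j → mem j w ∧ not (mem j w′)) ∧
     blocked (λ j → mem j w ∧ not (mem j w′)) (λ j → mem j w′ ∧ not (mem j w))))

  adds : Bool → Bool → Bool → Bool
  adds false false false = true
  adds true  true  false = true
  adds true  false true  = true
  adds _     _     _     = false

  splits : Word K → Word K → Word K → Bool
  splits w w′ w″ = every λ j → adds (mem j w) (mem j w′) (mem j w″)

  triple : Word K → Word K → Word K → Bool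
  triple w w′ w″ = splits w w′ w″ ∨ (splits w′ w w″ ∨ splits w″ w w′)

  ValidWord : Set
  ValidWord = Σ (Word K) (T ∘ valid)

  open Refutation {ValidWord} (λ w w′ → apart (proj₁ w) (proj₁ w′))
                              (λ w w′ w″ → triple (proj₁ w) (proj₁ w′) (proj₁ w″)) public

-- The parts are the vertices of a contraction of a subgraph of `G`; they may leave vertices of `G`
-- uncovered.
record Model {n} (G : SimpleGraph (Fin n)) {K} (near far : List (Fin K × Fin K))
             (part : Fin K → Subset n) : Set where
  open SimpleGraph G
  field
    connected : ∀ j → Connected (G [ part j ])
    disjoint  : ∀ {i j v} → v ∈ part i → v ∈ part j → i ≡ j
    near-adj  : All (λ (i , j) → ∃₂ λ u v → u ∈ part i × v ∈ part j × Adj u v) near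
    far-nadj  : All (λ (i , j) → ∀ {u v} → u ∈ part i → v ∈ part j → ¬ Adj u v) far

true⇒T : ∀ {b} → b ≡ true → T b
true⇒T refl = _

T⇒true : ∀ {b} → T b → b ≡ true
T⇒true {true} _ = refl

¬T⇒false : ∀ {b} → ¬ T b → b ≡ false
¬T⇒false {true}  ¬t = ⊥-elim (¬t _)
¬T⇒false {false} _  = refl

module _ {n} {G : SimpleGraph (Fin n)} {K} {near far : List (Fin K × Fin K)} {part : Fin K → Subset n}
         (model : Model G near far part) where
  open Model model
  open SimpleGraph G
  open Quotient near far

  union : Word K → Subset n
  union []      = ∅
  union (j ∷ w) = part j ∪ union w

  private
    listed⁻ : ∀ {ps i j} → T (listed ps i j) → (i , j) ∈ᴸ ps ⊎ (j , i) ∈ᴸ ps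
    listed⁻ {ps} {i} {j} t with any⁻ _ ps t
    ... | (a , b) , ∈ps , eqs with ∨⁻ {(a == i) ∧ (b == j)} eqs
    ...   | inj₁ eq with ∧⁻ {a == i} eq
    ...     | a≡i , b≡j with toWitness {a? = a Fin.≟ i} a≡i | toWitness {a? = b Fin.≟ j} b≡j
    ...       | refl | refl = inj₁ ∈ps
    listed⁻ {ps} {i} {j} t | (a , b) , ∈ps , eqs | inj₂ eq with ∧⁻ {a == j} eq
    ...     | a≡j , b≡i with toWitness {a? = a Fin.≟ j} a≡j | toWitness {a? = b Fin.≟ i} b≡i
    ...       | refl | refl = inj₂ ∈ps

    near⁻ : ∀ {i j} → T (listed near i j) → ∃₂ λ u v → u ∈ part i × v ∈ part j × Adj u v
    near⁻ t with listed⁻ {near} t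
    ... | inj₁ ∈near = All.lookup near-adj ∈near
    ... | inj₂ ∈near with All.lookup near-adj ∈near
    ...   | u , v , u∈ , v∈ , uv = v , u , v∈ , u∈ , adjSym uv

    far⁻ : ∀ {i j} → T (listed far i j) → ∀ {u v} → u ∈ part i → v ∈ part j → ¬ Adj u v
    far⁻ t u∈ v∈ uv with listed⁻ {far} t
    ... | inj₁ ∈far = All.lookup far-nadj ∈far u∈ v∈ uv
    ... | inj₂ ∈far = All.lookup far-nadj ∈far v∈ u∈ (adjSym uv)

    some⁻ : ∀ p → T (some p) → ∃[ j ] T (p j)
    some⁻ p t with any⁻ p (allFin K) t
    ... | j , _ , pj = j , pj

    every⁻ : ∀ p → T (every p) → ∀ j → T (p j)
    every⁻ p t j = all⁻ p {allFin K} t (∈-allFin j)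

    part-inhabited : ∀ j → ∃[ v ] v ∈ part j
    part-inhabited j = proj₁ (connected j)

    lookup-part : ∀ {i j v} → v ∈ part j → lookup (part i) v ≡ (j == i)
    lookup-part {i} {j} {v} v∈ with j Fin.≟ i
    ... | yes refl = []=⇒lookup v∈
    ... | no j≢i with lookup (part i) v in eq
    ...   | false = refl
    ...   | true  = contradiction (disjoint v∈ (lookup⇒[]= v (part i) eq)) j≢i

    union-at : ∀ {j v} → v ∈ part j → ∀ w → lookup (union w) v ≡ mem j w
    union-at {v = v} v∈ []      = lookup-replicate v false
    union-at {v = v} v∈ (i ∷ w) =
      trans (lookup-zipWith _∨_ v (part i) (union w)) (cong₂ _∨_ (lookup-part v∈) (union-at v∈ w))

    union-outside : ∀ {v} → (∀ j → v ∉ part j) → ∀ w → lookup (union w) v ≡ false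
    union-outside {v} v∉ []      = lookup-replicate v false
    union-outside {v} v∉ (i ∷ w) =
      trans (lookup-zipWith _∨_ v (part i) (union w)) (cong₂ _∨_ i-out (union-outside v∉ w))
      where
      i-out : lookup (part i) v ≡ false
      i-out with lookup (part i) v in eq
      ... | false = refl
      ... | true  = contradiction (lookup⇒[]= v (part i) eq) (v∉ i)

    part⊆union : ∀ {j w v} → v ∈ part j → T (mem j w) → v ∈ union w
    part⊆union {j} {w} {v} v∈ j∈w = lookup⇒[]= v (union w) (trans (union-at v∈ w) (T⇒true j∈w))

  union-connected : ∀ w → T (valid w) → Connected (G [ union w ])
  union-connected (j ∷ []) _ with part-inhabited j
  ... | r , r∈ = rooted⇒connected G (p⊆p∪q ∅ r∈) λ v∈ →
        step-mono G (p⊆p∪q ∅) (connected⇒joined G (connected j) r∈ (back v∈))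
    where
    back : ∀ {v} → v ∈ part j ∪ ∅ → v ∈ part j
    back {v} v∈ = lookup⇒[]= v (part j) (begin
      lookup (part j) v                ≡⟨ sym (Bool.∨-identityʳ _) ⟩
      lookup (part j) v ∨ false        ≡⟨ cong (lookup (part j) v ∨_) (sym (lookup-replicate v false)) ⟩
      lookup (part j) v ∨ lookup ∅ v   ≡⟨ sym (lookup-zipWith _∨_ v (part j) ∅) ⟩
      lookup (part j ∪ ∅) v            ≡⟨ []=⇒lookup v∈ ⟩
      true ∎)
      where open ≡-Reasoning
  union-connected (j ∷ w@(_ ∷ _)) t =
    attach (proj₁ (∧⁻ {any (listed near j) w} t)) (union-connected w (proj₂ (∧⁻ {any (listed near j) w} t)))
    where
    attach : T (any (listed near j) w) → Connected (G [ union w ]) → Connected (G [ union (j ∷ w) ])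
    attach near-w w-conn with any⁻ _ w near-w
    ... | i , i∈w , near-ji with near⁻ near-ji
    ...   | a , b , a∈ , b∈ , ab = connected-∪ G (connected j) w-conn a∈
              (part⊆union {i} {w} b∈ (Any.any⁺ (i ==_) (Any.map (λ { refl → fromWitness refl }) i∈w))) ab

  private
    part? : ∀ v → (∃[ j ] v ∈ part j) ⊎ (∀ j → v ∉ part j)
    part? v with Fin.any? (λ j → v ∈? part j)
    ... | yes p = inj₁ p
    ... | no ∄j = inj₂ λ j v∈ → ∄j (j , v∈)

    adds⁻ : ∀ {c a b} → T (adds c a b) → Add c a b
    adds⁻ {false} {false} {false} _ = neither
    adds⁻ {true}  {true}  {false} _ = left
    adds⁻ {true}  {false} {true}  _ = right

    splits⁻ : ∀ {w w′ w″} → T (splits w w′ w″) → Split (union w) (union w′) (union w″)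
    splits⁻ {w} {w′} {w″} t = pointwise λ v → at v (part? v)
      where
      at : ∀ v → (∃[ j ] v ∈ part j) ⊎ (∀ j → v ∉ part j) →
           Add (lookup (union w) v) (lookup (union w′) v) (lookup (union w″) v)
      at v (inj₁ (j , v∈)) rewrite union-at v∈ w | union-at v∈ w′ | union-at v∈ w″ =
        adds⁻ (every⁻ (λ j → adds (mem j w) (mem j w′) (mem j w″)) t j)
      at v (inj₂ v∉) rewrite union-outside v∉ w | union-outside v∉ w′ | union-outside v∉ w″ = neither

    -- A walk inside `C` from the isolated part to another part of `C` has to leave the isolated
    -- part. The edge by which it does so ends in a part of `C` that is far from it.
    isolating-sound : ∀ {C r} → Connected (G [ C ]) →
      (∀ {v} → (∀ j → v ∉ part j) → lookup C v ≡ false) →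
      (∀ {j v} → v ∈ part j → lookup C v ≡ r j) → ¬ T (isolating r)
    isolating-sound {C} {r} C-conn outside on-part t with some⁻ _ t
    ... | j , tj with ∧⁻ {r j} tj
    ...   | rj , tj′ with ∧⁻ {some (λ i → r i ∧ not (i == j))} tj′
    ...     | others , all-far with some⁻ _ others
    ...       | i , ti with ∧⁻ {r i} ti | part-inhabited i | part-inhabited j
    ...         | ri , i≢j | b , b∈ | a , a∈
      with exit (λ v → v ∈? part j) a∈ (λ b∈j → T-not⁻ i≢j (fromWitness (disjoint b∈ b∈j)))
             (connected⇒joined G C-conn (lookup⇒[]= a C (trans (on-part a∈) (T⇒true rj)))
                                        (lookup⇒[]= b C (trans (on-part b∈) (T⇒true ri))))
    ... | x , y , x∈j , y∉j , xy , _ , y∈C with part? y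
    ...   | inj₂ y∉ = contradiction (trans (sym ([]=⇒lookup y∈C)) (outside y∉)) λ ()
    ...   | inj₁ (k , y∈k) with ∨⁻ {not (r k ∧ not (k == j))} (every⁻ _ all-far k)
    ...     | inj₂ far-jk = far⁻ far-jk x∈j y∈k xy
    ...     | inj₁ excl   = T-not⁻ excl (Equivalence.from Bool.T-∧
                (true⇒T (trans (sym (on-part y∈k)) ([]=⇒lookup y∈C)) ,
                 true⇒T (cong not (¬T⇒false λ k≡j → y∉j (subst (λ k → y ∈ part k) (toWitness {a? =
                     k Fin.≟ j} k≡j) y∈k)))))

    blocked-sound : ∀ {C bad r} → Connected (G [ C ]) →
      (∀ {v} → (∀ j → v ∉ part j) → lookup C v ≡ false) →
      (∀ {j v} → v ∈ part j → lookup C v ≡ r j × ¬ T (bad j)) → ¬ T (blocked bad r)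
    blocked-sound {bad = bad} C-conn outside on-part t with ∨⁻ {some bad} t
    ... | inj₂ iso = isolating-sound C-conn outside (proj₁ ∘ on-part) iso
    ... | inj₁ sb with some⁻ bad sb
    ...   | j , bj = proj₂ (on-part (proj₂ (part-inhabited j))) bj

    union-cases : ∀ {c a b} → Add c a b → c ≡ a ∨ b × ¬ T (a ∧ b)
    union-cases neither = refl , λ ()
    union-cases left    = refl , λ ()
    union-cases right   = refl , λ ()

    difference-cases : ∀ {c a b} → Add a c b → c ≡ a ∧ not b × ¬ T (b ∧ not a)
    difference-cases neither = refl , λ ()
    difference-cases left    = refl , λ ()
    difference-cases right   = refl , λ ()

    no-summand : ∀ {c} → Add false c false → c ≡ false
    no-summand neither = refl

    no-sum : ∀ {c} → Add c false false → c ≡ false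
    no-sum neither = refl

  module _ {s} {π : Partition (connectedSubgraphArrangement G) s}
           (nice : Nice (connectedSubgraphArrangement G) π) where
    open Arrangement (connectedSubgraphArrangement G)
    open Surjection π using () renaming (to to block)

    private
      index : ValidWord → Index
      index (w , v) = union w , proj₁ (union-connected w v) , union-connected w v

      -- A common block would produce a connected third member of the pencil, whose set is the union
      -- of the two or one of the differences. On each part its value is dictated by the two words,
      -- and the three conjuncts of `apart` exclude the three cases.
      apart-sound : ∀ {w w′} → T (apart (proj₁ w) (proj₁ w′)) → block (index w) ≢ block (index w′)
      apart-sound {w} {w′} t eq with ∧⁻ {some
          (λ j → (mem j (proj₁ w) ∧ not (mem j (proj₁ w′))) ∨ (mem j (proj₁ w′) ∧ not (mem j (proj₁ w))))} t
      ... | distinct , t′ with ∧⁻ {blocked (λ j → mem j (proj₁ w) ∧ mem j (proj₁ w′))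
          (λ j → mem j (proj₁ w) ∨ mem j (proj₁ w′))} t′
      ...   | no-union , t″ with ∧⁻ {blocked (λ j → mem j (proj₁ w′) ∧ not (mem j (proj₁ w)))
          (λ j → mem j (proj₁ w) ∧ not (mem j (proj₁ w′)))} t″
      ...     | no-left , no-right with third-member {G = G} π nice (index w) (index w′) ≢-union eq
        where
        ≢-union : union (proj₁ w) ≢ union (proj₁ w′)
        ≢-union eq with some⁻ _ distinct
        ... | j , d with part-inhabited j
        ...   | v , v∈ =
            separated (trans (sym (union-at v∈ (proj₁ w)))
              (trans (cong (λ I → lookup I v) eq) (union-at v∈ (proj₁ w′)))) d
          where
          separated : ∀ {a b} → a ≡ b → ¬ T ((a ∧ not b) ∨ (b ∧ not a))
          separated {false} refl ()
          separated {true}  refl ()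
      ...       | (C , _ , C-conn) , inj₁ (pointwise split) = blocked-sound C-conn
        (λ {v} v∉ → no-sum (subst₂ (Add (lookup C v)) (union-outside v∉ (proj₁ w))
            (union-outside v∉ (proj₁ w′)) (split v)))
        (λ {j} {v} v∈ →
            union-cases (subst₂ (Add (lookup C v)) (union-at v∈ (proj₁ w)) (union-at v∈ (proj₁ w′))
              (split v))) no-union
      ...       | (C , _ , C-conn) , inj₂ (inj₁ (pointwise split)) = blocked-sound C-conn
        (λ {v} v∉ → no-summand (subst₂ (λ a b → Add a (lookup C v) b) (union-outside v∉ (proj₁ w))
            (union-outside v∉ (proj₁ w′)) (split v)))
        (λ {j} {v} v∈ →
            difference-cases (subst₂ (λ a b → Add a (lookup C v) b) (union-at v∈ (proj₁ w))
              (union-at v∈ (proj₁ w′)) (split v))) no-left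
      ...       | (C , _ , C-conn) , inj₂ (inj₂ (pointwise split)) = blocked-sound C-conn
        (λ {v} v∉ → no-summand (subst₂ (λ a b → Add b (lookup C v) a) (union-outside v∉ (proj₁ w))
            (union-outside v∉ (proj₁ w′)) (split v)))
        (λ {j} {v} v∈ →
            difference-cases (subst₂ (λ a b → Add b (lookup C v) a) (union-at v∈ (proj₁ w))
              (union-at v∈ (proj₁ w′)) (split v))) no-right

      Admissible : (w w′ w″ : ValidWord) → Set
      Admissible w w′ w″ =
        ¬ (block (index w) ≡ block (index w′) × block (index w) ≡ block (index w″)) ×
        ¬ (block (index w) ≢ block (index w′) × block (index w) ≢ block (index w″) ×
            block (index w′) ≢ block (index w″))

      triple-sound : ∀ {w w′ w″} → T (triple (proj₁ w) (proj₁ w′) (proj₁ w″)) → Admissible w w′ w″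
      triple-sound {w} {w′} {w″} t with ∨⁻ {splits (proj₁ w) (proj₁ w′) (proj₁ w″)} t
      ... | inj₁ sp =
        (λ (e , e′) → not-monochromatic {G = G} π nice {index w′} {index w″} {index w} split
            (trans (sym e) e′) (sym e)) ,
        (λ (d , d′ , d″) → not-rainbow {G = G} π nice {index w′} {index w″} {index w} split d″ (d ∘ sym)
            (d′ ∘ sym))
        where split = splits⁻ {proj₁ w} {proj₁ w′} {proj₁ w″} sp
      ... | inj₂ t′ with ∨⁻ {splits (proj₁ w′) (proj₁ w) (proj₁ w″)} t′
      ...   | inj₁ sp =
        (λ (e , e′) → not-monochromatic {G = G} π nice {index w} {index w″} {index w′} split e′ e) ,
        (λ (d , d′ , d″) → not-rainbow {G = G} π nice {index w} {index w″} {index w′} split d′ d (d″ ∘ sym))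
        where split = splits⁻ {proj₁ w′} {proj₁ w} {proj₁ w″} sp
      ...   | inj₂ sp =
        (λ (e , e′) → not-monochromatic {G = G} π nice {index w} {index w′} {index w″} split e e′) ,
        (λ (d , d′ , d″) → not-rainbow {G = G} π nice {index w} {index w′} {index w″} split d d′ d″)
        where split = splits⁻ {proj₁ w″} {proj₁ w} {proj₁ w′} sp

    -- The search starts with no number in use, so any translation of numbers into blocks will do;
    -- `j` supplies a constant one.
    not-refuted : Fin K → ∀ ws → ¬ T (refute ws [] 0)
    not-refuted j ws = refute-sound Fin._≟_ (block ∘ index) (λ {w} {w′} → apart-sound {w} {w′})
      (λ {w} {w′} {w″} → triple-sound {w} {w′} {w″}) ws [] 0 (λ _ → block (index (j ∷ [] , _))) (λ ()) []

-- Three forbidden configurations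

distinct⇒lookup-injective : ∀ {A : Set} {xs : List A} → AllPairs _≢_ xs → ∀ {i j} →
    List.lookup xs i ≡ List.lookup xs j → i ≡ j
distinct⇒lookup-injective (x≢ ∷ d) {zero}  {zero}  eq = refl
distinct⇒lookup-injective (x≢ ∷ d) {zero}  {suc j} eq = contradiction eq (All.lookup x≢ (∈-lookup j))
distinct⇒lookup-injective (x≢ ∷ d) {suc i} {zero}  eq = contradiction (sym eq) (All.lookup x≢ (∈-lookup i))
distinct⇒lookup-injective (x≢ ∷ d) {suc i} {suc j} eq = cong suc (distinct⇒lookup-injective d eq)

module _ {n} {G : SimpleGraph (Fin n)} where
  open SimpleGraph G

  -- In all three configurations only one vertex, the hub, has to be a contracted set; the others
  -- stay single vertices.
  hub-and-rim : Subset n → (rim : List (Fin n)) → Fin (suc (length rim)) → Subset n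
  hub-and-rim S rim zero    = S
  hub-and-rim S rim (suc j) = ⁅ List.lookup rim j ⁆

  Touches : Fin n → Subset n → Set
  Touches v S = ∃[ s ] s ∈ S × Adj s v

  module _ {S : Subset n} {rim : List (Fin n)}
      {near far : List (Fin (suc (length rim)) × Fin (suc (length rim)))}
    (S-conn : Connected (G [ S ])) (rim∉S : All (_∉ S) rim) (distinct : AllPairs _≢_ rim) where

    hub-model :
      All (λ (i , j) → ∃₂ λ u v → u ∈ hub-and-rim S rim i × v ∈ hub-and-rim S rim j × Adj u v) near →
      All (λ (i , j) → ∀ {u v} → u ∈ hub-and-rim S rim i → v ∈ hub-and-rim S rim j → ¬ Adj u v) far →
      Model G near far (hub-and-rim S rim)
    hub-model near-adj far-nadj = record
      { connected = λ { zero → S-conn ; (suc j) → connected-⁅⁆ G (List.lookup rim j) }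
      ; disjoint  = disjoint
      ; near-adj  = near-adj
      ; far-nadj  = far-nadj
      }
      where
      disjoint : ∀ {i j v} → v ∈ hub-and-rim S rim i → v ∈ hub-and-rim S rim j → i ≡ j
      disjoint {zero}  {zero}  v∈ v∈′ = refl
      disjoint {zero}  {suc j} v∈ v∈′ with x∈⁅y⁆⇒x≡y _ v∈′
      ... | refl = contradiction v∈ (All.lookup rim∉S (∈-lookup j))
      disjoint {suc i} {zero}  v∈ v∈′ with x∈⁅y⁆⇒x≡y _ v∈
      ... | refl = contradiction v∈′ (All.lookup rim∉S (∈-lookup i))
      disjoint {suc i} {suc j} v∈ v∈′ =
        cong suc (distinct⇒lookup-injective distinct (trans (sym (x∈⁅y⁆⇒x≡y _ v∈)) (x∈⁅y⁆⇒x≡y _ v∈′)))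

  spoke : ∀ {v S} → Touches v S → ∃₂ λ a b → a ∈ S × b ∈ ⁅ v ⁆ × Adj a b
  spoke {v} (s , s∈S , sv) = s , v , s∈S , x∈⁅x⁆ v , sv

  edge : ∀ {u v} → Adj u v → ∃₂ λ a b → a ∈ ⁅ u ⁆ × b ∈ ⁅ v ⁆ × Adj a b
  edge {u} {v} uv = u , v , x∈⁅x⁆ u , x∈⁅x⁆ v , uv

  non-edge : ∀ {u v} → ¬ Adj u v → ∀ {a b} → a ∈ ⁅ u ⁆ → b ∈ ⁅ v ⁆ → ¬ Adj a b
  non-edge ¬uv a∈ b∈ ab with x∈⁅y⁆⇒x≡y _ a∈ | x∈⁅y⁆⇒x≡y _ b∈
  ... | refl | refl = ¬uv ab

  module _ (factored : Factored (connectedSubgraphArrangement G)) where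

    private
      refuted : ∀ {K near far part} → Model G near far part → ∀ ws →
                ¬ T (Quotient.refute {suc K} near far ws [] 0)
      refuted model ws = not-refuted model {π = proj₁ (proj₂ factored)} (proj₂ (proj₂ factored)) 0F ws

    -- In the following three proofs, the order of the words was chosen to keep the search small.

    -- Contracting S leaves the 4-cycle x a S b, possibly with chords.
    no-cycle : ∀ {S x a b} → Connected (G [ S ]) → x ∉ S → a ∉ S → b ∉ S → a ≢ b →
               Adj x a → Adj x b → Touches a S → ¬ Touches b S
    no-cycle {S} {x} {a} {b} S-conn x∉S a∉S b∉S a≢b xa xb aS bS = refuted model
      ((3F ∷ 2F ∷ 0F ∷ [] , _) ∷ (1F ∷ 3F ∷ 0F ∷ [] , _) ∷ (2F ∷ 1F ∷ [] , _) ∷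
       (3F ∷ 1F ∷ 2F ∷ 0F ∷ [] , _) ∷ (1F ∷ [] , _) ∷ (3F ∷ 0F ∷ [] , _) ∷ (2F ∷ [] , _) ∷
       (2F ∷ 0F ∷ [] , _) ∷ (1F ∷ 2F ∷ 0F ∷ [] , _) ∷ (3F ∷ 1F ∷ [] , _) ∷ (3F ∷ 2F ∷ 1F ∷ [] , _) ∷ []) _
      where
      x≢ : ∀ {y} → Adj x y → x ≢ y
      x≢ xy refl = irrefl refl xy
      -- `far` is empty, so `apart` holds only of words that overlap without inclusion. This is why
      -- chords of the cycle are harmless.
      model : Model G ((0F , 2F) ∷ (0F , 3F) ∷ (1F , 2F) ∷ (1F , 3F) ∷ []) []
          (hub-and-rim S (x ∷ a ∷ b ∷ []))
      model = hub-model S-conn (x∉S ∷ a∉S ∷ b∉S ∷ []) ((x≢ xa ∷ x≢ xb ∷ []) ∷ (a≢b ∷ []) ∷ [] ∷ [])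
        (spoke aS ∷ spoke bS ∷ edge xa ∷ edge xb ∷ []) []

    -- Contracting `S` leaves K_{1,3} with centre `S`, and the words are all eleven connected sets
    -- of that graph. The missing edges between leaves serve, through `far`, to exclude third
    -- members.
    no-star : ∀ {S a b c} → Connected (G [ S ]) → All (_∉ S) (a ∷ b ∷ c ∷ []) →
        AllPairs _≢_ (a ∷ b ∷ c ∷ []) →
              ¬ Adj a b → ¬ Adj a c → ¬ Adj b c → Touches a S → Touches b S → ¬ Touches c S
    no-star {S} {a} {b} {c} S-conn ∉S distinct ¬ab ¬ac ¬bc aS bS cS = refuted model
      ((3F ∷ 0F ∷ [] , _) ∷ (2F ∷ 1F ∷ 0F ∷ [] , _) ∷ (3F ∷ 2F ∷ 1F ∷ 0F ∷ [] , _) ∷ (2F ∷ 0F ∷ [] , _) ∷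
       (1F ∷ 0F ∷ [] , _) ∷ (2F ∷ [] , _) ∷ (3F ∷ 2F ∷ 0F ∷ [] , _) ∷ (1F ∷ [] , _) ∷ (3F ∷ [] , _) ∷
       (0F ∷ [] , _) ∷ (3F ∷ 1F ∷ 0F ∷ [] , _) ∷ []) _
      where
      model : Model G ((0F , 1F) ∷ (0F , 2F) ∷ (0F , 3F) ∷ []) ((1F , 2F) ∷ (1F , 3F) ∷ (2F , 3F) ∷ [])
                    (hub-and-rim S (a ∷ b ∷ c ∷ []))
      model = hub-model S-conn ∉S distinct (spoke aS ∷ spoke bS ∷ spoke cS ∷ [])
        (non-edge ¬ab ∷ non-edge ¬ac ∷ non-edge ¬bc ∷ [])

    -- Contracting `S` leaves the triangles S a b and S c d, with no edge from one to the other off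
    -- `S`. Eleven of the connected sets are enough for a contradiction.
    no-butterfly : ∀ {S a b c d} → Connected (G [ S ]) →
                   All (_∉ S) (a ∷ b ∷ c ∷ d ∷ []) → AllPairs _≢_ (a ∷ b ∷ c ∷ d ∷ []) →
                   Adj a b → Adj c d → ¬ Adj a c → ¬ Adj a d → ¬ Adj b c → ¬ Adj b d →
                   Touches a S → Touches b S → Touches c S → ¬ Touches d S
    no-butterfly {S} {a} {b} {c} {d} S-conn ∉S distinct ab cd ¬ac ¬ad ¬bc ¬bd aS bS cS dS = refuted model
      ((4F ∷ 0F ∷ [] , _) ∷ (3F ∷ 1F ∷ 0F ∷ [] , _) ∷ (3F ∷ 2F ∷ 0F ∷ [] , _) ∷ (2F ∷ 1F ∷ 0F ∷ [] , _) ∷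
       (4F ∷ 3F ∷ 0F ∷ [] , _) ∷ (4F ∷ 1F ∷ 0F ∷ [] , _) ∷ (3F ∷ [] , _) ∷ (2F ∷ 0F ∷ [] , _) ∷
       (1F ∷ [] , _) ∷ (3F ∷ 0F ∷ [] , _) ∷ (1F ∷ 0F ∷ [] , _) ∷ []) _
      where
      model : Model G ((0F , 1F) ∷ (0F , 2F) ∷ (0F , 3F) ∷ (0F , 4F) ∷ (1F , 2F) ∷ (3F , 4F) ∷ [])
                    ((1F , 3F) ∷ (1F , 4F) ∷ (2F , 3F) ∷ (2F , 4F) ∷ [])
                        (hub-and-rim S (a ∷ b ∷ c ∷ d ∷ []))
      model = hub-model S-conn ∉S distinct
        (spoke aS ∷ spoke bS ∷ spoke cS ∷ spoke dS ∷ edge ab ∷ edge cd ∷ [])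
        (non-edge ¬ac ∷ non-edge ¬ad ∷ non-edge ¬bc ∷ non-edge ¬bd ∷ [])

-- Growing a chain

-- With the chord, the labels 0 , … , m carry Δ_{m,1}, the label 0 being its vertex m + 1.
data Link (c : Bool) : ℕ → ℕ → Set where
  up     : ∀ {i} → Link c i (suc i)
  down   : ∀ {i} → Link c (suc i) i
  chord↑ : T c → Link c 0 2
  chord↓ : T c → Link c 2 0

link-sym : ∀ {c i j} → Link c i j → Link c j i
link-sym up         = down
link-sym down       = up
link-sym (chord↑ t) = chord↓ t
link-sym (chord↓ t) = chord↑ t

module _ {n} (G : SimpleGraph (Fin n)) where
  open SimpleGraph G

  -- An induced copy of a path or of Δ_{m,1}. Labels are plain numbers and only the values of `at`
  -- up to `m` are constrained, so chains can be shifted, reversed and prolonged without casts.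
  record Chain (c : Bool) (m : ℕ) : Set where
    field
      at        : ℕ → Fin n
      injective : ∀ {i j} → i ≤ m → j ≤ m → at i ≡ at j → i ≡ j
      adj⇒link  : ∀ {i j} → i ≤ m → j ≤ m → Adj (at i) (at j) → Link c i j
      link⇒adj  : ∀ {i j} → i ≤ m → j ≤ m → Link c i j → Adj (at i) (at j)
      chord-fits : T c → 2 ≤ m

module _ {n} {G : SimpleGraph (Fin n)} where
  open SimpleGraph G

  module _ {c m} (C : Chain G c m) where
    open Chain C

    Fresh : Fin n → Set
    Fresh x = ∀ {i} → i ≤ m → at i ≢ x

    N : Fin n → ℕ → Set
    N x i = i ≤ m × Adj x (at i)

    -- `f` is an involution of the label graph. Being its own inverse, it reflects links as soon as
    -- it preserves them.
    relabel : (f : ℕ → ℕ) → (∀ {i} → i ≤ m → f i ≤ m) → (∀ {i} → i ≤ m → f (f i) ≡ i) →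
              (∀ {i j} → i ≤ m → j ≤ m → Link c i j → Link c (f i) (f j)) → Chain G c m
    relabel f f≤ ff link = record
      { at         = at ∘ f
      ; injective  =
          λ i≤ j≤ eq → trans (sym (ff i≤)) (trans (cong f (injective (f≤ i≤) (f≤ j≤) eq)) (ff j≤))
      ; adj⇒link   =
          λ i≤ j≤ a → subst₂ (Link c) (ff i≤) (ff j≤) (link (f≤ i≤) (f≤ j≤) (adj⇒link (f≤ i≤) (f≤ j≤) a))
      ; link⇒adj   = λ i≤ j≤ l → link⇒adj (f≤ i≤) (f≤ j≤) (link i≤ j≤ l)
      ; chord-fits = chord-fits
      }

    module _ {x} (fresh : Fresh x) where

      private
        at′ : ℕ → Fin n
        at′ i with i ℕ.≤? m
        ... | yes _ = at i
        ... | no _  = x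

        at′-old : ∀ {i} → i ≤ m → at′ i ≡ at i
        at′-old {i} i≤m with i ℕ.≤? m
        ... | yes _   = refl
        ... | no i≰m = contradiction i≤m i≰m

        at′-new : at′ (suc m) ≡ x
        at′-new with suc m ℕ.≤? m
        ... | yes m<m = contradiction m<m (ℕ.<-irrefl refl)
        ... | no _    = refl

        last? : ∀ {i} → i ≤ suc m → i ≤ m ⊎ i ≡ suc m
        last? i≤ with ℕ.m≤n⇒m<n∨m≡n i≤
        ... | inj₁ (s≤s i≤m) = inj₁ i≤m
        ... | inj₂ eq        = inj₂ eq

      snoc : Adj x (at m) → (∀ {i} → i ≤ m → Adj x (at i) → i ≡ m) → Chain G c (suc m)
      snoc xm only-m = record
        { at         = at′
        ; injective  = inj
        ; adj⇒link   = a⇒l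
        ; link⇒adj   = l⇒a
        ; chord-fits = ℕ.m≤n⇒m≤1+n ∘ chord-fits
        }
        where
        inj : ∀ {i j} → i ≤ suc m → j ≤ suc m → at′ i ≡ at′ j → i ≡ j
        inj i≤ j≤ eq with last? i≤ | last? j≤
        ... | inj₁ i≤m  | inj₁ j≤m  = injective i≤m j≤m (trans (sym (at′-old i≤m)) (trans eq (at′-old j≤m)))
        ... | inj₁ i≤m  | inj₂ refl = contradiction (trans (sym (at′-old i≤m)) (trans eq at′-new))
            (fresh i≤m)
        ... | inj₂ refl | inj₁ j≤m  = contradiction (trans (sym (at′-old j≤m)) (trans (sym eq) at′-new))
            (fresh j≤m)
        ... | inj₂ refl | inj₂ refl = refl

        to-x : ∀ {i} → i ≤ m → Adj x (at i) → Link c (suc m) i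
        to-x i≤m xi with only-m i≤m xi
        ... | refl = down

        a⇒l : ∀ {i j} → i ≤ suc m → j ≤ suc m → Adj (at′ i) (at′ j) → Link c i j
        a⇒l i≤ j≤ a with last? i≤ | last? j≤
        ... | inj₁ i≤m  | inj₁ j≤m  = adj⇒link i≤m j≤m (subst₂ Adj (at′-old i≤m) (at′-old j≤m) a)
        ... | inj₁ i≤m  | inj₂ refl = link-sym (to-x i≤m (adjSym (subst₂ Adj (at′-old i≤m) at′-new a)))
        ... | inj₂ refl | inj₁ j≤m  = to-x j≤m (subst₂ Adj at′-new (at′-old j≤m) a)
        ... | inj₂ refl | inj₂ refl = contradiction a (irrefl refl)

        from-x : ∀ {i} → i ≤ m → Link c (suc m) i → Adj (at′ (suc m)) (at′ i)
        from-x i≤m up   = contradiction i≤m (ℕ.<⇒≱ (ℕ.m≤n⇒m≤1+n (ℕ.n<1+n m)))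
        from-x i≤m down = subst₂ Adj (sym at′-new) (sym (at′-old i≤m)) xm
        -- A chord at the new label would make that label 2, but a chain with a chord already
        -- contains 2.
        from-x i≤m (chord↓ t) = contradiction (chord-fits t) λ { (s≤s ()) }

        l⇒a : ∀ {i j} → i ≤ suc m → j ≤ suc m → Link c i j → Adj (at′ i) (at′ j)
        l⇒a i≤ j≤ l with last? i≤ | last? j≤
        ... | inj₁ i≤m  | inj₁ j≤m  =
            subst₂ Adj (sym (at′-old i≤m)) (sym (at′-old j≤m)) (link⇒adj i≤m j≤m l)
        ... | inj₁ i≤m  | inj₂ refl = adjSym (from-x i≤m (link-sym l))
        ... | inj₂ refl | inj₁ j≤m  = from-x j≤m l
        l⇒a i≤ j≤ () | inj₂ refl | inj₂ refl

  -- The new vertex sees exactly the first two labels. It takes the label 0 and shifts the others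
  -- up, so that its second edge becomes the chord.
  cons-chord : ∀ {m} (C : Chain G false m) {x} → Fresh C x → 1 ≤ m → let open Chain C in
               Adj x (at 0) → Adj x (at 1) → (∀ {i} → i ≤ m → Adj x (at i) → i ≤ 1) → Chain G true (suc m)
  cons-chord {m} C {x} fresh 1≤m x0 x1 only = record
    { at         = at′
    ; injective  = inj
    ; adj⇒link   = a⇒l
    ; link⇒adj   = l⇒a
    ; chord-fits = λ _ → s≤s 1≤m
    }
    where
    open Chain C
    at′ : ℕ → Fin n
    at′ zero    = x
    at′ (suc i) = at i
    inj : ∀ {i j} → i ≤ suc m → j ≤ suc m → at′ i ≡ at′ j → i ≡ j
    inj {zero}  {zero}  _        _        eq = refl
    inj {zero}  {suc j} _        (s≤s j≤) eq = contradiction (sym eq) (fresh j≤)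
    inj {suc i} {zero}  (s≤s i≤) _        eq = contradiction eq (fresh i≤)
    inj {suc i} {suc j} (s≤s i≤) (s≤s j≤) eq = cong suc (injective i≤ j≤ eq)
    from-x : ∀ {j} → j ≤ m → Adj x (at j) → Link true 0 (suc j)
    from-x {j} j≤ xj with only j≤ xj
    ... | z≤n     = up
    ... | s≤s z≤n = chord↑ _
    a⇒l : ∀ {i j} → i ≤ suc m → j ≤ suc m → Adj (at′ i) (at′ j) → Link true i j
    a⇒l {zero}  {zero}  _        _        a = contradiction a (irrefl refl)
    a⇒l {zero}  {suc j} _        (s≤s j≤) a = from-x j≤ a
    a⇒l {suc i} {zero}  (s≤s i≤) _        a = link-sym (from-x i≤ (adjSym a))
    a⇒l {suc i} {suc j} (s≤s i≤) (s≤s j≤) a with adj⇒link i≤ j≤ a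
    ... | up   = up
    ... | down = down
    l⇒a : ∀ {i j} → i ≤ suc m → j ≤ suc m → Link true i j → Adj (at′ i) (at′ j)
    l⇒a {zero}        _        _        up         = x0
    l⇒a {suc i}       (s≤s i≤) (s≤s j≤) up         = link⇒adj i≤ j≤ up
    l⇒a {_}   {zero}  _        _        down       = adjSym x0
    l⇒a {_}   {suc j} (s≤s i≤) (s≤s j≤) down       = link⇒adj i≤ j≤ down
    l⇒a               _        _        (chord↑ _) = x1
    l⇒a               _        _        (chord↓ _) = adjSym x1

  reverse-path : ∀ {m} → Chain G false m → Chain G false m
  reverse-path {m} C = relabel C (m ∸_) (λ {i} _ → ℕ.m∸n≤m m i) ℕ.m∸[m∸n]≡n link
    where
    flip : ∀ {i} → suc i ≤ m → Link false (m ∸ i) (m ∸ suc i)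
    flip {i} i<m = subst (λ k → Link false k (m ∸ suc i)) (sym (ℕ.+-∸-assoc 1 i<m)) down
    link : ∀ {i j} → i ≤ m → j ≤ m → Link false i j → Link false (m ∸ i) (m ∸ j)
    link i≤ j≤ up   = flip j≤
    link i≤ j≤ down = link-sym (flip i≤)

  -- The vertices of degree two of the triangle are interchangeable; without a tail, all three are.
  swap₀₁ : ∀ {m} → Chain G true m → Chain G true m
  swap₀₁ {m} C = relabel C f f≤ ff link
    where
    f : ℕ → ℕ
    f 0 = 1
    f 1 = 0
    f (suc (suc i)) = suc (suc i)
    f≤ : ∀ {i} → i ≤ m → f i ≤ m
    f≤ {0} _ = ℕ.<⇒≤ (Chain.chord-fits C _)
    f≤ {1} _ = z≤n
    f≤ {suc (suc i)} i≤ = i≤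
    ff : ∀ {i} → i ≤ m → f (f i) ≡ i
    ff {0} _ = refl
    ff {1} _ = refl
    ff {suc (suc i)} _ = refl
    link : ∀ {i j} → i ≤ m → j ≤ m → Link true i j → Link true (f i) (f j)
    link {0} _ _ up = down
    link {1} _ _ up = chord↑ _
    link {suc (suc i)} _ _ up = up
    link {_} {0} _ _ down = up
    link {_} {1} _ _ down = chord↓ _
    link {_} {suc (suc i)} _ _ down = down
    link _ _ (chord↑ t) = up
    link _ _ (chord↓ t) = down

  swap₀₂ : Chain G true 2 → Chain G true 2
  swap₀₂ C = relabel C f f≤ ff link
    where
    f : ℕ → ℕ
    f i = 2 ∸ i
    f≤ : ∀ {i} → i ≤ 2 → f i ≤ 2
    f≤ {i} _ = ℕ.m∸n≤m 2 i
    ff : ∀ {i} → i ≤ 2 → f (f i) ≡ i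
    ff = ℕ.m∸[m∸n]≡n
    link : ∀ {i j} → i ≤ 2 → j ≤ 2 → Link true i j → Link true (f i) (f j)
    link {0} _ _ up = down
    link {1} _ _ up = down
    link {suc (suc i)} _ (s≤s (s≤s ())) up
    link {_} {0} _ _ down = up
    link {_} {1} _ _ down = up
    link {_} {suc (suc i)} (s≤s (s≤s ())) _ down
    link _ _ (chord↑ t) = chord↓ t
    link _ _ (chord↓ t) = chord↑ t

  module _ {c m} (C : Chain G c m) where
    open Chain C

    -- The vertices labelled i , … , i + k.
    segment : ℕ → ℕ → Subset n
    segment i zero    = ⁅ at i ⁆
    segment i (suc k) = ⁅ at i ⁆ ∪ segment (suc i) k

    ∈-segment⁺ : ∀ i k {d} → d ≤ k → at (d + i) ∈ segment i k
    ∈-segment⁺ i zero    z≤n = x∈⁅x⁆ (at i)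
    ∈-segment⁺ i (suc k) z≤n = p⊆p∪q _ (x∈⁅x⁆ (at i))
    ∈-segment⁺ i (suc k) {suc d} (s≤s d≤k) =
      q⊆p∪q ⁅ at i ⁆ _ (subst (λ j → at j ∈ segment (suc i) k) (ℕ.+-suc d i) (∈-segment⁺ (suc i) k d≤k))

    ∈-segment⁻ : ∀ i k {v} → v ∈ segment i k → ∃[ d ] d ≤ k × v ≡ at (d + i)
    ∈-segment⁻ i zero    v∈ = 0 , z≤n , x∈⁅y⁆⇒x≡y _ v∈
    ∈-segment⁻ i (suc k) v∈ with x∈p∪q⁻ ⁅ at i ⁆ _ v∈
    ... | inj₁ v∈′ = 0 , z≤n , x∈⁅y⁆⇒x≡y _ v∈′
    ... | inj₂ v∈′ with ∈-segment⁻ (suc i) k v∈′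
    ...   | d , d≤k , eq = suc d , s≤s d≤k , trans eq (cong at (ℕ.+-suc d i))

    segment-connected : ∀ i k → k + i ≤ m → Connected (G [ segment i k ])
    segment-connected i zero    _  = connected-⁅⁆ G (at i)
    segment-connected i (suc k) le = connected-∪ G (connected-⁅⁆ G (at i)) (segment-connected (suc i) k le′)
      (x∈⁅x⁆ (at i)) (∈-segment⁺ (suc i) k z≤n) (link⇒adj (ℕ.m+n≤o⇒n≤o (suc k) le) (ℕ.m+n≤o⇒n≤o k le′) up)
      where
      le′ : k + suc i ≤ m
      le′ = subst (_≤ m) (sym (ℕ.+-suc k i)) le

    below∉segment : ∀ i k {j} → k + i ≤ m → j < i → at j ∉ segment i k
    below∉segment i k le j<i j∈ with ∈-segment⁻ i k j∈
    ... | d , d≤k , eq = ℕ.<⇒≢ (ℕ.<-≤-trans j<i (ℕ.m≤n+m i d))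
      (injective (ℕ.≤-trans (ℕ.<⇒≤ j<i) (ℕ.m+n≤o⇒n≤o k le)) (ℕ.≤-trans (ℕ.+-monoˡ-≤ i d≤k) le) eq)

    above∉segment : ∀ i k {j} → j ≤ m → k + i < j → at j ∉ segment i k
    above∉segment i k j≤m <j j∈ with ∈-segment⁻ i k j∈
    ... | d , d≤k , eq = ℕ.<⇒≢ (ℕ.≤-<-trans (ℕ.+-monoˡ-≤ i d≤k) <j)
      (sym (injective j≤m (ℕ.≤-trans (ℕ.+-monoˡ-≤ i d≤k) (ℕ.≤-trans (ℕ.<⇒≤ <j) j≤m)) eq))

    fresh∉segment : ∀ i k {x} → k + i ≤ m → Fresh C x → x ∉ segment i k
    fresh∉segment i k le fresh x∈ with ∈-segment⁻ i k x∈
    ... | d , d≤k , eq = fresh (ℕ.≤-trans (ℕ.+-monoˡ-≤ i d≤k) le) (sym eq)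

  -- Attaching a vertex to a chain

  module _ (factored : Factored (connectedSubgraphArrangement G)) where

    module _ {c m} (C : Chain G c m) {x} (fresh : Fresh C x) where
      open Chain C

      private
        N′ = N C x

      private
        beyond : ∀ i k → i < suc (suc (k + i))
        beyond i k = ℕ.m≤n⇒m≤1+n (s≤s (ℕ.m≤n+m i k))

        -- The labels strictly between the two neighbours contract to one vertex, which closes a
        -- 4-cycle through `x`.
        far-neighbours : ∀ i k → N′ i → N′ (suc (suc (k + i))) → ⊥
        far-neighbours i k (i≤m , xi) (j≤m , xj) = no-cycle {G = G} factored
          (segment-connected C (suc i) k k≤m)
          (fresh∉segment C (suc i) k k≤m fresh)
          (below∉segment C (suc i) k k≤m ℕ.≤-refl)
          (above∉segment C (suc i) k j≤m (s≤s (ℕ.≤-reflexive (ℕ.+-suc k i))))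
          (λ eq → ℕ.<⇒≢ (beyond i k) (injective i≤m j≤m eq))
          xi xj
          (at (suc i) , ∈-segment⁺ C (suc i) k z≤n , link⇒adj (ℕ.m+n≤o⇒n≤o k k≤m) i≤m down)
          (at (k + suc i) , ∈-segment⁺ C (suc i) k ℕ.≤-refl ,
           link⇒adj k≤m j≤m (subst (λ e → Link c e (suc (suc (k + i)))) (sym (ℕ.+-suc k i)) up))
          where
          k≤m : k + suc i ≤ m
          k≤m = subst (_≤ m) (sym (ℕ.+-suc k i)) (ℕ.<⇒≤ j≤m)

      consecutive : ∀ {i j} → N′ i → N′ j → i < j → j ≡ suc i
      consecutive {i} Ni Nj i<j with ℕ.m≤n⇒m<n∨m≡n i<j
      ... | inj₂ eq  = sym eq
      ... | inj₁ i+1<j with ℕ.m≤n⇒∃[o]m+o≡n i+1<j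
      ...   | k , refl = ⊥-elim (far-neighbours i k Ni (subst (λ e → N′ (suc (suc e))) (ℕ.+-comm i k) Nj))

      private
        pair : ∀ {i} → N′ i → N′ (suc i) → ∀ {l} → N′ l → l ≡ i ⊎ l ≡ suc i
        pair {i} Ni Ni′ {l} Nl with ℕ.<-cmp l i
        ... | tri≈ _ eq _  = inj₁ eq
        ... | tri> _ _ i<l = inj₂ (consecutive Ni Nl i<l)
        ... | tri< l<i _ _ = contradiction (sym (ℕ.suc-injective (consecutive Nl Ni′ (ℕ.m≤n⇒m≤1+n l<i))))
            (ℕ.<⇒≢ l<i)

      -- Any two neighbours have consecutive labels, which leaves no room for a third.
      neighbourhood : ∀ {i} → N′ i → (∃[ i ] N′ i × (∀ {j} → N′ j → j ≡ i)) ⊎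
                      (∃[ i ] N′ i × N′ (suc i) × (∀ {j} → N′ j → j ≡ i ⊎ j ≡ suc i))
      neighbourhood {i} Ni with ℕ.anyUpTo? (λ j → ¬? (j ℕ.≟ i) ×-dec (j ℕ.≤? m ×-dec adj? x (at j))) (suc m)
      ... | no only = inj₁ (i , Ni , λ {j} Nj →
              decidable-stable (j ℕ.≟ i) λ j≢i → only (j , s≤s (proj₁ Nj) , j≢i , Nj))
      ... | yes (j , _ , j≢i , Nj) with ℕ.<-cmp i j
      ...   | tri≈ _ i≡j _ = contradiction (sym i≡j) j≢i
      ...   | tri< i<j _ _ with consecutive Ni Nj i<j
      ...     | refl = inj₂ (i , Ni , Nj , pair Ni Nj)
      neighbourhood {i} Ni | yes (j , _ , j≢i , Nj) | tri> _ _ j<i with consecutive Nj Ni j<i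
      ... | refl = inj₂ (j , Nj , Ni , pair Nj Ni)

      -- Contract the labels i + 1 , … , i + k + 1 to the centre of a star.
      no-claw : ∀ i k → suc (suc (k + i)) ≤ m → ¬ Link c i (suc (suc (k + i))) →
                ¬ N′ i → ¬ N′ (suc (suc (k + i))) → ∀ {d} → d ≤ k → N′ (d + suc i) → ⊥
      no-claw i k j≤m ¬link ¬Ni ¬Nj {d} d≤k (_ , xd) = no-star {G = G} factored
        (segment-connected C (suc i) k k≤m)
        (below∉segment C (suc i) k k≤m ℕ.≤-refl ∷
         above∉segment C (suc i) k j≤m (s≤s (ℕ.≤-reflexive (ℕ.+-suc k i))) ∷
         fresh∉segment C (suc i) k k≤m fresh ∷ [])
        (((λ eq → ℕ.<⇒≢ (beyond i k) (injective i≤m j≤m eq)) ∷ fresh i≤m ∷ []) ∷ (fresh j≤m ∷ []) ∷ [] ∷ [])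
        (¬link ∘ adj⇒link i≤m j≤m) (λ a → ¬Ni (i≤m , adjSym a)) (λ a → ¬Nj (j≤m , adjSym a))
        (at (suc i) , ∈-segment⁺ C (suc i) k z≤n , link⇒adj (ℕ.m+n≤o⇒n≤o k k≤m) i≤m down)
        (at (k + suc i) , ∈-segment⁺ C (suc i) k ℕ.≤-refl ,
         link⇒adj k≤m j≤m (subst (λ e → Link c e (suc (suc (k + i)))) (sym (ℕ.+-suc k i)) up))
        (at (d + suc i) , ∈-segment⁺ C (suc i) k d≤k , adjSym xd)
        where
        k≤m : k + suc i ≤ m
        k≤m = subst (_≤ m) (sym (ℕ.+-suc k i)) (ℕ.<⇒≤ j≤m)
        i≤m : i ≤ m
        i≤m = ℕ.<⇒≤ (ℕ.<-≤-trans (beyond i k) j≤m)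

    Extension : ℕ → Set
    Extension m = ∃[ c ] Chain G c (suc m)

    -- A vertex attached at an end lengthens the path or caps it with a triangle, after a reversal
    -- if it sits at the wrong end. Attached to an inner label or an inner pair, it is the third
    -- leaf of a claw whose centre is that label or the contracted pair.
    extend-path : ∀ {m} (C : Chain G false m) {x} → Fresh C x → ∀ {i} → N C x i → Extension m
    extend-path {m} C {x} fresh Ni with neighbourhood C fresh Ni
    ... | inj₁ (i , (i≤m , xi) , only) with i ℕ.≟ m
    ...   | yes refl = false , snoc C fresh xi (λ j≤ xj → only (j≤ , xj))
    extend-path {m} C {x} fresh _ | inj₁ (zero , (_ , x0) , only) | no _ =
      false , snoc (reverse-path C) (λ {j} _ → fresh (ℕ.m∸n≤m m j))
        (subst (λ k → Adj x (Chain.at C k)) (sym (ℕ.n∸n≡0 m)) x0)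
        (λ {j} j≤ xj → ℕ.≤-antisym j≤ (ℕ.m∸n≡0⇒m≤n (only (ℕ.m∸n≤m m j , xj))))
    extend-path C fresh _ | inj₁ (suc i , Ni@(i≤m , _) , only) | no i≢m =
      ⊥-elim (no-claw C fresh i 0 (ℕ.≤∧≢⇒< i≤m i≢m) (λ { (chord↑ ()) })
        (λ Nj → ℕ.1+n≢n (sym (only Nj))) (λ Nj → ℕ.1+n≢n (only Nj)) z≤n Ni)
    extend-path C fresh _ | inj₂ (zero , (_ , x0) , (1≤m , x1) , only) =
      true , cons-chord C fresh 1≤m x0 x1 λ j≤ xj → [ (λ { refl → z≤n }) , (λ { refl → s≤s z≤n }) ]′
          (only (j≤ , xj))
    extend-path {m} C {x} fresh _ | inj₂ (suc i , Ni , Ni′@(i≤m , xi′) , only) with suc (suc i) ℕ.≟ m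
    ... | yes refl = true , cons-chord (reverse-path C) (λ {j} _ → fresh (ℕ.m∸n≤m m j)) (s≤s z≤n) xi′
        (proj₂ Ni)
            λ {j} _ xj → near-end j (only (ℕ.m∸n≤m m j , xj))
      where
      near-end : ∀ j → suc (suc i) ∸ j ≡ suc i ⊎ suc (suc i) ∸ j ≡ suc (suc i) → j ≤ 1
      near-end zero          _ = z≤n
      near-end (suc zero)    _ = s≤s z≤n
      near-end (suc (suc j)) (inj₁ eq) = contradiction eq (ℕ.<⇒≢ (s≤s (ℕ.m∸n≤m i j)))
      near-end (suc (suc j)) (inj₂ eq) = contradiction eq (ℕ.<⇒≢ (ℕ.m≤n⇒m≤1+n (s≤s (ℕ.m∸n≤m i j))))
    ... | no i≢m  = ⊥-elim (no-claw C fresh i 1 (ℕ.≤∧≢⇒< i≤m i≢m) (λ ())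
            (λ Nj → [ (λ eq → ℕ.1+n≢n (sym eq)) , (λ eq → ℕ.<⇒≢ (ℕ.m≤n⇒m≤1+n ℕ.≤-refl) eq) ]′ (only Nj))
            (λ Nj → [ (λ eq → ℕ.<⇒≢ (ℕ.m≤n⇒m≤1+n ℕ.≤-refl) (sym eq)) , (λ eq → ℕ.1+n≢n eq) ]′ (only Nj)) z≤n
                Ni)

    module _ {m} (C : Chain G true m) {x} (fresh : Fresh C x) where
      open Chain C

      private
        0≤m : 0 ≤ m
        0≤m = z≤n
        1≤m : 1 ≤ m
        1≤m = ℕ.<⇒≤ (chord-fits _)
        2≤m : 2 ≤ m
        2≤m = chord-fits _

        -- `x`, `i`, `l`, `j` form a 4-cycle, of which the third edge of the triangle is a permitted
        -- chord.
        beside-triangle : ∀ {i j l} → i ≤ m → j ≤ m → l ≤ m → i ≢ j → i ≢ l → j ≢ l →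
                          Link true l i → Link true l j → N C x i → N C x j → ⊥
        beside-triangle {i} {j} {l} i≤ j≤ l≤ i≢j i≢l j≢l li lj (_ , xi) (_ , xj) = no-cycle {G = G} factored
          (connected-⁅⁆ G (at l)) (λ x∈ → fresh l≤ (sym (x∈⁅y⁆⇒x≡y _ x∈)))
          (λ i∈ → i≢l (injective i≤ l≤ (x∈⁅y⁆⇒x≡y _ i∈))) (λ j∈ → j≢l (injective j≤ l≤ (x∈⁅y⁆⇒x≡y _ j∈)))
          (i≢j ∘ injective i≤ j≤) xi xj
          (at l , x∈⁅x⁆ _ , link⇒adj l≤ i≤ li) (at l , x∈⁅x⁆ _ , link⇒adj l≤ j≤ lj)

        -- The labels 0 , 1 , 2 and the vertices k + 2 , k + 3 , `x` form triangles; contracting 2 ,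
        -- ... , k + 2 makes them share a vertex.
        two-triangles : ∀ k → (∀ {j} → N C x j → j ≡ k + 2 ⊎ j ≡ suc (k + 2)) → N C x (k + 2) →
            N C x (suc (k + 2)) → ⊥
        two-triangles k only (k≤m , xk) (j≤m , xj) = no-butterfly {G = G} factored
          (segment-connected C 2 k k≤m)
          (below∉segment C 2 k k≤m (s≤s z≤n) ∷ below∉segment C 2 k k≤m (s≤s (s≤s z≤n)) ∷
           above∉segment C 2 k j≤m ℕ.≤-refl ∷ fresh∉segment C 2 k k≤m fresh ∷ [])
          (((λ eq → 0≢1 (injective 0≤m 1≤m eq)) ∷ (λ eq → 0≢j (injective 0≤m j≤m eq)) ∷ fresh 0≤m ∷ []) ∷
           ((λ eq → 1≢j (injective 1≤m j≤m eq)) ∷ fresh 1≤m ∷ []) ∷ (fresh j≤m ∷ []) ∷ [] ∷ [])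
          (link⇒adj 0≤m 1≤m up) (adjSym xj)
          (λ a → ¬link₀ (adj⇒link 0≤m j≤m a)) (λ a → not-near (s≤s z≤n) (0≤m , adjSym a))
          (λ a → ¬link₁ (adj⇒link 1≤m j≤m a)) (λ a → not-near (s≤s (s≤s z≤n)) (1≤m , adjSym a))
          (at 2 , ∈-segment⁺ C 2 k z≤n , link⇒adj 2≤m 0≤m (chord↓ _))
          (at 2 , ∈-segment⁺ C 2 k z≤n , link⇒adj 2≤m 1≤m down)
          (at (k + 2) , ∈-segment⁺ C 2 k ℕ.≤-refl , link⇒adj k≤m j≤m up)
          (at (k + 2) , ∈-segment⁺ C 2 k ℕ.≤-refl , adjSym xk)
          where
          0≢1 : 0 ≢ 1
          0≢1 ()
          0≢j : 0 ≢ suc (k + 2)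
          0≢j ()
          k+3 : suc (k + 2) ≡ suc (suc (suc k))
          k+3 = cong suc (ℕ.+-comm k 2)
          1≢j : 1 ≢ suc (k + 2)
          1≢j eq = contradiction (trans eq k+3) λ ()
          ¬link₀ : ¬ Link true 0 (suc (k + 2))
          ¬link₀ l = contradiction (subst (Link true 0) k+3 l) λ ()
          ¬link₁ : ¬ Link true 1 (suc (k + 2))
          ¬link₁ l = contradiction (subst (Link true 1) k+3 l) λ ()
          not-near : ∀ {j} → j < 2 → ¬ N C x j
          not-near j<2 Nj with only Nj
          ... | inj₁ refl = ℕ.<⇒≱ j<2 (ℕ.m≤n+m 2 k)
          ... | inj₂ refl = ℕ.<⇒≱ j<2 (ℕ.m≤n⇒m≤1+n (ℕ.m≤n+m 2 k))

      -- Two neighbours always create a forbidden configuration. A single neighbour at the end of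
      -- the tail prolongs it. If there is no tail, the symmetry of the triangle moves the neighbour
      -- to the end; if there is one, a neighbour anywhere else gives a claw.
      extend-triangle : ∀ {i} → N C x i → Extension m
      extend-triangle Ni with neighbourhood C fresh Ni
      ... | inj₂ (0 , N0 , N1 , only) =
        ⊥-elim (beside-triangle 0≤m 1≤m 2≤m (λ ()) (λ ()) (λ ()) (chord↓ _) down N0 N1)
      ... | inj₂ (1 , N1 , N2 , only) =
        ⊥-elim (beside-triangle 1≤m 2≤m 0≤m (λ ()) (λ ()) (λ ()) up (chord↑ _) N1 N2)
      ... | inj₂ (suc (suc k) , Nk , Nk′ , only) = ⊥-elim (two-triangles k
        (λ Nj → [ (λ eq → inj₁ (trans eq (ℕ.+-comm 2 k))) ,
            (λ eq → inj₂ (trans eq (cong suc (ℕ.+-comm 2 k)))) ]′ (only Nj))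
        (subst (N C x) (ℕ.+-comm 2 k) Nk) (subst (N C x) (cong suc (ℕ.+-comm 2 k)) Nk′))
      ... | inj₁ (i , N-i@(i≤m , xi) , only) with i ℕ.≟ m
      ...   | yes refl = true , snoc C fresh xi (λ j≤ xj → only (j≤ , xj))
      ...   | no i≢m   = true , inner i N-i only i≢m (2 ℕ.≟ m)
        where
        inner : ∀ i → N C x i → (∀ {j} → N C x j → j ≡ i) → i ≢ m → Dec (2 ≡ m) → Chain G true (suc m)
        inner 0 (_ , x0) only _ (yes refl) = snoc (swap₀₂ C) (λ {j} _ → fresh (ℕ.m∸n≤m 2 j)) x0
          λ {j} j≤ xj → ℕ.≤-antisym j≤ (ℕ.m∸n≡0⇒m≤n (only (ℕ.m∸n≤m 2 j , xj)))
        -- After the swap the neighbour has label 1, so that contracting 1 and 2 gives a star with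
        -- leaves 0 , 3 and `x`.
        inner 0 (_ , x0) only _ (no 2≢m) = ⊥-elim (no-claw (swap₀₁ C) fresh′ 0 1 (ℕ.≤∧≢⇒< 2≤m 2≢m) (λ ())
          (λ (_ , x1) → contradiction (only (1≤m , x1)) λ ())
              (λ (3≤m , x3) → contradiction (only (3≤m , x3)) λ ())
          z≤n (1≤m , x0))
          where
          fresh′ : Fresh (swap₀₁ C) x
          fresh′ {0} _ = fresh 1≤m
          fresh′ {1} _ = fresh 0≤m
          fresh′ {suc (suc j)} j≤ = fresh j≤
        inner 1 (_ , x1) only _ (yes refl) = snoc (swap₀₂ (swap₀₁ C)) fresh′ x1 last
          where
          fresh′ : Fresh (swap₀₂ (swap₀₁ C)) x
          fresh′ {0} _ = fresh 2≤m
          fresh′ {1} _ = fresh 0≤m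
          fresh′ {2} _ = fresh 1≤m
          fresh′ {suc (suc (suc j))} (s≤s (s≤s ()))
          last : ∀ {j} → j ≤ 2 → Adj x (Chain.at (swap₀₂ (swap₀₁ C)) j) → j ≡ 2
          last {0} _ x2 = contradiction (only (2≤m , x2)) λ ()
          last {1} _ x0 = contradiction (only (0≤m , x0)) λ ()
          last {2} _ _  = refl
          last {suc (suc (suc j))} (s≤s (s≤s ()))
        inner 1 N1 only _ (no 2≢m) = ⊥-elim (no-claw C fresh 0 1 (ℕ.≤∧≢⇒< 2≤m 2≢m) (λ ())
          (λ N0 → contradiction (only N0) λ ()) (λ N3 → contradiction (only N3) λ ()) z≤n N1)
        inner (suc (suc i)) Ni@(i≤m , _) only i≢m _ =
            ⊥-elim (no-claw C fresh (suc i) 0 (ℕ.≤∧≢⇒< i≤m i≢m) (λ ())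
          (λ Nj → ℕ.1+n≢n (sym (only Nj))) (λ Nj → ℕ.1+n≢n (only Nj)) z≤n Ni)

    extend : ∀ {c m} (C : Chain G c m) {x} → Fresh C x → ∀ {i} → N C x i → Extension m
    extend {false} C fresh = extend-path C fresh
    extend {true}  C fresh = extend-triangle C fresh

    Spanning : ∀ {c m} → Chain G c m → Set
    Spanning {m = m} C = ∀ v → ∃[ i ] i ≤ m × Chain.at C i ≡ v

    module _ (connected : Connected G) where

      spanning⊎extension : ∀ {c m} (C : Chain G c m) → Spanning C ⊎ Extension m
      spanning⊎extension {c} {m} C with Fin.all? covered?
        where
        covered? : ∀ v → Dec (∃[ i ] i < suc m × Chain.at C i ≡ v)
        covered? v = ℕ.anyUpTo? (λ i → Chain.at C i Fin.≟ v) (suc m)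
      ... | yes all  = inj₁ λ v → let (i , i< , eq) = all v in i , ℕ.≤-pred i< , eq
      ... | no ¬all with Fin.¬∀⟶∃¬ n _ (λ v → ℕ.anyUpTo? (λ i → Chain.at C i Fin.≟ v) (suc m)) ¬all
      ...   | v , v∉ with exit (λ v → ℕ.anyUpTo? (λ i → Chain.at C i Fin.≟ v) (suc m)) (0 , s≤s z≤n , refl)
          v∉ (proj₂ connected (Chain.at C 0) v)
      ...     | _ , x , (i , s≤s i≤m , refl) , x∉ , ix =
                inj₂ (extend C (λ i≤m eq → x∉ (_ , s≤s i≤m , eq)) (i≤m , adjSym ix))

      chain-bound : ∀ {c m} → Chain G c m → suc m ≤ n
      chain-bound {m = m} C = Fin.injective⇒≤ {f = at ∘ toℕ} λ {i} {j} eq → Fin.toℕ-injective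
        (injective (ℕ.≤-pred (Fin.toℕ<n i)) (ℕ.≤-pred (Fin.toℕ<n j)) eq)
        where open Chain C

      -- Each extension raises `m`, while injectivity keeps it below `n`. So `n ≤ fuel + m` cannot
      -- hold with the fuel spent.
      grow : ∀ fuel {c m} → Chain G c m → n ≤ fuel + m → ∃₂ λ c m → Σ (Chain G c m) Spanning
      grow zero       C n≤ = contradiction (ℕ.≤-trans (chain-bound C) n≤) (ℕ.<-irrefl refl)
      grow (suc fuel) {m = m} C n≤ with spanning⊎extension C
      ... | inj₁ spanning = _ , _ , C , spanning
      ... | inj₂ (c , C′) = grow fuel C′ (subst (n ≤_) (sym (ℕ.+-suc fuel m)) n≤)

      spanning-chain : ∃₂ λ c m → Σ (Chain G c m) Spanning
      spanning-chain = grow n start (ℕ.m≤m+n n 0)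
        where
        start : Chain G false 0
        start = record
          { at         = λ _ → proj₁ connected
          ; injective  = λ { z≤n z≤n _ → refl }
          ; adj⇒link   = λ { _ _ a → contradiction a (irrefl refl) }
          ; link⇒adj   = λ { z≤n () up }
          ; chord-fits = λ ()
          }

-- Nice partitions for chains

least : ∀ {P : ℕ → Set} → Decidable P → ∀ w →
        (∃[ i ] i ≤ w × P i × (∀ {j} → j < i → ¬ P j)) ⊎ (∀ {j} → j ≤ w → ¬ P j)
least {P} P? w with below (suc w)
  where
  below : ∀ k → (∃[ i ] i < k × P i × (∀ {j} → j < i → ¬ P j)) ⊎ (∀ {j} → j < k → ¬ P j)
  below zero = inj₂ λ ()
  below (suc k) with below k
  ... | inj₁ (i , i<k , first) = inj₁ (i , ℕ.m≤n⇒m≤1+n i<k , first)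
  ... | inj₂ none with P? k
  ...   | yes Pk = inj₁ (k , ℕ.≤-refl , Pk , none)
  ...   | no ¬Pk = inj₂ λ {j} j<1+k Pj →
          [ (λ j<k → none j<k Pj) , (λ { refl → ¬Pk Pj }) ]′ (ℕ.m≤n⇒m<n∨m≡n (ℕ.≤-pred j<1+k))
... | inj₁ (i , s≤s i≤w , first) = inj₁ (i , i≤w , first)
... | inj₂ none                  = inj₂ λ j≤w → none (s≤s j≤w)

-- The label interval {a , … , b − 1}, or the label set {0} ∪ {2 , … , b − 1}.
data Code : Set where
  interval : (a b : ℕ) → Code
  notched  : (b : ℕ) → Code

-- One more than the greatest label, except that all intervals starting at 1 are coloured alike.
colour : Code → ℕ
colour (interval 1 b) = 1
colour (interval a b) = b
colour (notched b)    = b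

colour-interval : ∀ {a b} → a ≢ 1 → colour (interval a b) ≡ b
colour-interval {0} _ = refl
colour-interval {1} a≢1 = contradiction refl a≢1
colour-interval {suc (suc a)} _ = refl

-- With σ a the sum of the coordinates labelled below a, the interval [a , b) gives the hyperplane
-- σ a = σ b, and the notched set gives σ b + σ 1 = σ 2 + σ 0; here a ∼ b and E b say that such
-- a hyperplane contains a given flat.
module _ (w : ℕ) (_∼_ : ℕ → ℕ → Set) (E : ℕ → Set) where

  Member : Code → Set
  Member (interval a b) = a < b × b ≤ w × a ∼ b
  Member (notched b)    = 3 ≤ b × b ≤ w × E b

  module _
    (∼-sym : ∀ {a b} → a ∼ b → b ∼ a) (∼-trans : ∀ {a b c} → a ∼ b → b ∼ c → a ∼ c)
    (E-cancel : ∀ {a b} → E a → E b → a ∼ b) (E-resp : ∀ {a b} → E a → a ∼ b → E b)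
    (E-02 : ∀ {b} → E b → 0 ∼ b → 1 ∼ 2) (E-20 : ∀ {b} → E b → 2 ∼ b → 0 ∼ 1)
    (_∼?_ : ∀ {a b} → a < b → b ≤ w → Dec (a ∼ b)) (E? : ∀ {b} → 3 ≤ b → b ≤ w → Dec (E b)) where

    private
      -- The block of colour `b`, for b ≥ 2, has a member containing the flat.
      High : ℕ → Set
      High b = 2 ≤ b × b ≤ w × ((∃[ a ] a < b × a ≢ 1 × a ∼ b) ⊎ (3 ≤ b × E b))

      ∼at? : ∀ {b} → b ≤ w → Dec (∃[ a ] a < b × a ≢ 1 × a ∼ b)
      ∼at? {b} b≤w with ℕ.anyUpTo? (λ a → dec a) b
        where
        dec : ∀ a → Dec (a < b × a ≢ 1 × a ∼ b)
        dec a with a ℕ.<? b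
        ... | no ¬<  = no λ p → ¬< (proj₁ p)
        ... | yes a<b with ¬? (a ℕ.≟ 1) ×-dec (a<b ∼? b≤w)
        ...   | yes (p , q) = yes (a<b , p , q)
        ...   | no ¬p       = no λ p → ¬p (proj₂ p)
      ... | yes (a , _ , p) = yes (a , p)
      ... | no ∄a           = no λ (a , p) → ∄a (a , proj₁ p , p)

      E-at? : ∀ {b} → b ≤ w → Dec (3 ≤ b × E b)
      E-at? {b} b≤w with 3 ℕ.≤? b
      ... | no ¬≤  = no λ p → ¬≤ (proj₁ p)
      ... | yes 3≤b with E? 3≤b b≤w
      ...   | yes Eb = yes (3≤b , Eb)
      ...   | no ¬Eb = no λ p → ¬Eb (proj₂ p)

      High? : Decidable High
      High? b with 2 ℕ.≤? b | b ℕ.≤? w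
      ... | no ¬p | _ = no λ p → ¬p (proj₁ p)
      ... | yes _ | no ¬p = no λ p → ¬p (proj₁ (proj₂ p))
      ... | yes p | yes q with ∼at? q ⊎-dec E-at? q
      ...   | yes r = yes (p , q , r)
      ...   | no ¬r = no λ p → ¬r (proj₂ (proj₂ p))

      Late : ℕ → Set
      Late e = 3 ≤ e × e ≤ w × 1 ∼ e

      Late? : Decidable Late
      Late? e with 3 ℕ.≤? e | e ℕ.≤? w
      ... | no ¬p | _ = no λ p → ¬p (proj₁ p)
      ... | yes _ | no ¬p = no λ p → ¬p (proj₁ (proj₂ p))
      ... | yes p | yes q with ℕ.<⇒≤ p ∼? q
      ...   | yes r = yes (p , q , r)
      ...   | no ¬r = no λ p → ¬r (proj₂ (proj₂ p))

      Unique : Code → Set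
      Unique z = ∀ {z′} → Member z′ → colour z′ ≡ colour z → z′ ≡ z

      Lone : Set
      Lone = ∃[ z ] Member z × Unique z

      joint : ∀ {i j b} → i ∼ b → j ∼ b → i ∼ j
      joint ib jb = ∼-trans ib (∼-sym jb)

      high-below : ∀ {a a′ b} → a < a′ → a ≢ 1 → a′ ≢ 1 → a′ ≤ w → a ∼ b → a′ ∼ b → High a′
      high-below {a} {zero}        () _ _ _ _ _
      high-below {a} {suc zero}    _ _ a′≢1 _ _ _ = contradiction refl a′≢1
      high-below {a} {suc (suc _)} a<a′ a≢1 _ a′≤w ab a′b =
          s≤s (s≤s z≤n) , a′≤w , inj₁ (a , a<a′ , a≢1 , joint ab a′b)

      -- Only the first block meets the flat here. Two of its members would combine by transitivity
      -- to an interval [0 , b) or [b , b′) with b ≥ 2, which lies in a higher block.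
      all-low : (∀ {b} → b ≤ w → ¬ High b) → ∀ {z} → Member z → Lone
      all-low low {z} z∈ = z , z∈ , λ z′∈ _ → unique (start-at-1 z∈) (start-at-1 z′∈)
        where
        Low : Code → Set
        Low z = (z ≡ interval 0 1 × 0 ∼ 1) ⊎ (∃[ b ] z ≡ interval 1 b × 2 ≤ b × b ≤ w × 1 ∼ b)
        start-at-1 : ∀ {z} → Member z → Low z
        start-at-1 {interval 0 1} (_ , _ , r) = inj₁ (refl , r)
        start-at-1 {interval 0 (suc (suc b))} (_ , b≤ , r) =
            ⊥-elim (low b≤ (s≤s (s≤s z≤n) , b≤ , inj₁ (0 , s≤s z≤n , (λ ()) , r)))
        start-at-1 {interval 1 b} (2≤b , b≤ , r) = inj₂ (b , refl , 2≤b , b≤ , r)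
        start-at-1 {interval (suc (suc a)) b} (a<b , b≤ , r) =
            ⊥-elim (low b≤ (ℕ.≤-trans (s≤s (s≤s z≤n)) (ℕ.<⇒≤ a<b) , b≤ , inj₁ (_ , a<b , (λ ()) , r)))
        start-at-1 {notched b} (3≤b , b≤ , e) = ⊥-elim (low b≤ (ℕ.<⇒≤ 3≤b , b≤ , inj₂ (3≤b , e)))
        chain : ∀ {b b′} → 2 ≤ b → b < b′ → b′ ≤ w → 1 ∼ b → 1 ∼ b′ → ⊥
        chain {b} 2≤b b<b′ b′≤ 1b 1b′ =
            low b′≤ (ℕ.≤-trans 2≤b (ℕ.<⇒≤ b<b′) , b′≤ ,
              inj₁ (b , b<b′ , (λ { refl → contradiction 2≤b λ { (s≤s ()) } }) , ∼-trans (∼-sym 1b) 1b′))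
        unique : ∀ {z z′} → Low z → Low z′ → z′ ≡ z
        unique (inj₁ (refl , _)) (inj₁ (refl , _)) = refl
        unique (inj₁ (refl , 0∼1)) (inj₂ (b , refl , 2≤b , b≤ , 1b)) =
            ⊥-elim (low b≤ (2≤b , b≤ , inj₁ (0 , ℕ.<⇒≤ 2≤b , (λ ()) , ∼-trans 0∼1 1b)))
        unique (inj₂ (b , refl , 2≤b , b≤ , 1b)) (inj₁ (refl , 0∼1)) =
            ⊥-elim (low b≤ (2≤b , b≤ , inj₁ (0 , ℕ.<⇒≤ 2≤b , (λ ()) , ∼-trans 0∼1 1b)))
        unique (inj₂ (b , refl , 2≤b , b≤ , 1b)) (inj₂ (b′ , refl , 2≤b′ , b′≤ , 1b′)) with ℕ.<-cmp b b′
        ... | tri≈ _ refl _ = refl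
        ... | tri< b<b′ _ _ = ⊥-elim (chain 2≤b b<b′ b′≤ 1b 1b′)
        ... | tri> _ _ b′<b = ⊥-elim (chain 2≤b′ b′<b b≤ 1b′ 1b)

      module _ {b} (2≤b : 2 ≤ b) (b≤w : b ≤ w) (low : ∀ {j} → j < b → ¬ High j) where

        1≢b : 1 ≢ b
        1≢b refl = contradiction 2≤b λ { (s≤s ()) }

        data Top : Code → Set where
          top-interval : ∀ {a} → a < b → a ≢ 1 → a ∼ b → Top (interval a b)
          top-notched  : 3 ≤ b → E b → Top (notched b)

        top : ∀ {b′ z} → b′ ≡ b → Member z → colour z ≡ b′ → Top z
        top {z = interval 0 _} refl (a< , _ , r) refl = top-interval a< (λ ()) r
        top {z = interval 1 _} b′≡b _ refl = contradiction b′≡b 1≢b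
        top {z = interval (suc (suc a)) _} refl (a< , _ , r) refl = top-interval a< (λ ()) r
        top {z = notched _} refl (3≤ , _ , e) refl = top-notched 3≤ e

        -- Two starts would be related to each other, and the larger one would be high below `b`. So
        -- the lowest high block contains, on the flat, at most one interval beside the notched set.
        unique-start : ∀ {a a′} → a < b → a ≢ 1 → a ∼ b → a′ < b → a′ ≢ 1 → a′ ∼ b → a′ ≡ a
        unique-start {a} {a′} a<b a≢1 ab a′<b a′≢1 a′b with ℕ.<-cmp a a′
        ... | tri≈ _ a≡a′ _ = sym a≡a′
        ... | tri< a<a′ _ _ =
            ⊥-elim (low a′<b (high-below a<a′ a≢1 a′≢1 (ℕ.≤-trans (ℕ.<⇒≤ a′<b) b≤w) ab a′b))
        ... | tri> _ _ a′<a = ⊥-elim (low a<b (high-below a′<a a′≢1 a≢1 (ℕ.≤-trans (ℕ.<⇒≤ a<b) b≤w) a′b ab))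

        lone-notched : 3 ≤ b → E b → ¬ (∃[ a ] a < b × a ≢ 1 × a ∼ b) → Lone
        lone-notched 3≤b Eb ∄a = notched b , (3≤b , b≤w , Eb) , λ z′∈ eq → only (top refl z′∈ eq)
          where
          only : ∀ {z} → Top z → z ≡ notched b
          only (top-interval a< a≢1 r) = ⊥-elim (∄a (_ , a< , a≢1 , r))
          only (top-notched _ _)       = refl

        lone-interval : ∀ {a} → a < b → a ≢ 1 → a ∼ b → ¬ (3 ≤ b × E b) → Lone
        lone-interval {a} a<b a≢1 ab ¬E = interval a b , (a<b , b≤w , ab) , λ z′∈ eq →
            only (top (colour-interval a≢1) z′∈ eq)
          where
          only : ∀ {z} → Top z → z ≡ interval a b
          only (top-interval a′< a′≢1 a′b) =
              cong (λ a → interval a b) (unique-start a<b a≢1 ab a′< a′≢1 a′b)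
          only (top-notched 3≤b Eb)        = ⊥-elim (¬E (3≤b , Eb))

        module _ (3≤b : 3 ≤ b) (Eb : E b) where

          not-012 : 0 ∼ 1 → 1 ∼ 2 → ⊥
          not-012 0∼1 1∼2 =
              low 3≤b (s≤s (s≤s z≤n) , ℕ.≤-trans 2≤b b≤w , inj₁ (0 , s≤s z≤n , (λ ()) , ∼-trans 0∼1 1∼2))

          -- Both a ∼ b and o ∼ 1, where {a , o} = {0 , 2}, and 1 ∼ e for a least e ≥ 3.
          late : ∀ {a o e} → (∀ {d} → d < 3 → d ≢ 1 → d ≡ a ⊎ d ≡ o) → (1 ∼ a → ⊥) →
                 o < 3 → o ≢ 1 → a ∼ b → o ∼ 1 →
                 Late e → (∀ {j} → j < e → ¬ Late j) → Lone
          late {a} {o} {e} cases ¬1a o<3 o≢1 ab o1 (3≤e , e≤w , 1e) earliest =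
            -- On the flat, block `b` has two members, and the first block contains [1 , e) beside
            -- [1 , 2) or {0}. The singleton is therefore block `e`.
            interval o e , (o<e , e≤w , ∼-trans o1 1e) , λ z′∈ eq →
                only z′∈ (trans eq (colour-interval o≢1))
            where
            o<e : o < e
            o<e = ℕ.<-≤-trans o<3 3≤e
            b<e : b < e
            b<e with ℕ.<-cmp b e
            ... | tri< b<e _ _  = b<e
            ... | tri≈ _ refl _ = ⊥-elim (¬1a (∼-trans 1e (∼-sym ab)))
            ... | tri> _ _ e<b  = ⊥-elim (low e<b (ℕ.<⇒≤ 3≤e , e≤w , inj₁ (o , o<e , o≢1 , ∼-trans o1 1e)))
            start : ∀ {d} → d < e → d ≢ 1 → d ∼ e → d ≡ o
            start {d} d<e d≢1 de with d ℕ.<? 3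
            ... | no d≮3  = ⊥-elim (earliest d<e (ℕ.≮⇒≥ d≮3 , ℕ.≤-trans (ℕ.<⇒≤ d<e) e≤w , joint 1e de))
            ... | yes d<3 with cases d<3 d≢1
            ...   | inj₁ refl = ⊥-elim (¬1a (joint 1e de))
            ...   | inj₂ d≡o  = d≡o
            only : ∀ {z} → Member z → colour z ≡ e → z ≡ interval o e
            only {interval 0 _} (d< , _ , r) refl = cong (λ d → interval d e) (start d< (λ ()) r)
            only {interval 1 _} _ refl = contradiction 3≤e λ { (s≤s ()) }
            only {interval (suc (suc d)) _} (d< , _ , r) refl =
                cong (λ d → interval d e) (start d< (λ ()) r)
            -- Two notched sets give b ∼ e, hence 1 ∼ b with 3 ≤ b < e, against the choice of `e`.
            only {notched _} (_ , _ , Ee) refl =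
              ⊥-elim (earliest b<e (3≤b , b≤w , ∼-trans 1e (E-cancel Ee Eb)))

          -- Block `b` has an interval and a notched set, so another block must serve. A start a ≥ 3
          -- would give a notched set lower down, so `a` is 0 or 2, and cancelling in the notched
          -- equation yields 1 ∼ 2 or 0 ∼ 1, a member of the first block. It is alone there unless
          -- some [1 , e) with e ≥ 3 occurs, and then the least such `e` works.
          both : ∀ {a} → a < b → a ≢ 1 → a ∼ b → Lone
          both {0} _ _ 0b with E-02 Eb 0b | least Late? w
          ... | 1∼2 | inj₁ (e , _ , le , earliest) =
                  late {0} {2} (λ { {0} _ _ → inj₁ refl ; {1} _ d≢1 → contradiction refl d≢1 ; {2} _ _ →
                      inj₂ refl ; {suc (suc (suc _))} (s≤s (s≤s (s≤s ()))) })
                    (λ 1∼0 → not-012 (∼-sym 1∼0) 1∼2) (s≤s (s≤s (s≤s z≤n))) (λ ()) 0b (∼-sym 1∼2) le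
                        earliest
          ... | 1∼2 | inj₂ never = interval 1 2 , (s≤s (s≤s z≤n) , ℕ.≤-trans 2≤b b≤w , 1∼2) , only
            where
            only : Unique (interval 1 2)
            only {interval 0 1} (_ , _ , 0∼1) _ = ⊥-elim (not-012 0∼1 1∼2)
            only {interval 1 2} _ _ = refl
            only {interval 1 (suc (suc (suc b)))} (_ , b≤ , 1b) _ =
                ⊥-elim (never b≤ (s≤s (s≤s (s≤s z≤n)) , b≤ , 1b))
            only {interval 1 1} (s≤s () , _) _
            only {interval (suc (suc a)) 1} (s≤s () , _) _
            only {notched 1} (s≤s () , _) _
          both {1} _ a≢1 _ = contradiction refl a≢1
          both {2} _ _ 2b with E-20 Eb 2b | least Late? w
          ... | 0∼1 | inj₁ (e , _ , le , earliest) =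
                  late {2} {0} (λ { {0} _ _ → inj₂ refl ; {1} _ d≢1 → contradiction refl d≢1 ; {2} _ _ →
                      inj₁ refl ; {suc (suc (suc _))} (s≤s (s≤s (s≤s ()))) })
                    (λ 1∼2 → not-012 0∼1 1∼2) (s≤s z≤n) (λ ()) 2b 0∼1 le earliest
          ... | 0∼1 | inj₂ never = interval 0 1 , (s≤s z≤n , ℕ.≤-trans (ℕ.<⇒≤ 2≤b) b≤w , 0∼1) , only
            where
            only : Unique (interval 0 1)
            only {interval 0 1} _ _ = refl
            only {interval 1 2} (_ , _ , 1∼2) _ = ⊥-elim (not-012 0∼1 1∼2)
            only {interval 1 (suc (suc (suc b)))} (_ , b≤ , 1b) _ =
                ⊥-elim (never b≤ (s≤s (s≤s (s≤s z≤n)) , b≤ , 1b))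
            only {interval 1 1} (s≤s () , _) _
            only {interval (suc (suc a)) 1} (s≤s () , _) _
            only {notched 1} (s≤s () , _) _
          both {suc (suc (suc a))} a<b _ ab =
            ⊥-elim (low a<b (s≤s (s≤s z≤n) , ℕ.≤-trans (ℕ.<⇒≤ a<b) b≤w ,
                inj₂ (s≤s (s≤s (s≤s z≤n)) , E-resp Eb (∼-sym ab))))

    -- The lowest block above the first that meets the flat is a singleton unless it holds both an
    -- interval and a notched set; that exception is the case `both`.
    lone-member : ∀ {z} → Member z → ∃[ z ] Member z × (∀ {z′} → Member z′ → colour z′ ≡ colour z → z′ ≡ z)
    lone-member z∈ with least High? w
    ... | inj₂ low = all-low low z∈
    ... | inj₁ (b , b≤w , (2≤b , _ , _) , low) with ∼at? b≤w | E-at? b≤w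
    ...   | no ∄a | yes (3≤b , Eb) = lone-notched 2≤b b≤w low 3≤b Eb ∄a
    ...   | yes (a , a<b , a≢1 , ab) | no ¬E = lone-interval 2≤b b≤w low a<b a≢1 ab ¬E
    ...   | yes (a , a<b , a≢1 , ab) | yes (3≤b , Eb) = both 2≤b b≤w low 3≤b Eb a<b a≢1 ab
    lone-member z∈ | inj₁ (b , b≤w , (_ , _ , inj₁ p) , low) | no ∄a | no _ = contradiction p ∄a
    lone-member z∈ | inj₁ (b , b≤w , (_ , _ , inj₂ p) , low) | no _ | no ¬E = contradiction p ¬E

greatest : ∀ {P : ℕ → Set} → (∀ i → Dec (P i)) → ∀ w {i} → i ≤ w → P i →
           ∃[ t ] t ≤ w × P t × (∀ {j} → j ≤ w → P j → j ≤ t)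
greatest P? zero z≤n P0 = 0 , z≤n , P0 , λ j≤ _ → j≤
greatest P? (suc w) i≤ Pi with P? (suc w)
... | yes Pw = suc w , ℕ.≤-refl , Pw , λ j≤ _ → j≤
... | no ¬Pw with ℕ.m≤n⇒m<n∨m≡n i≤
...   | inj₂ refl = contradiction Pi ¬Pw
...   | inj₁ (s≤s i≤w) with greatest P? w i≤w Pi
...     | t , t≤w , Pt , max = t , ℕ.m≤n⇒m≤1+n t≤w , Pt , λ j≤ Pj →
          [ (λ { (s≤s j≤w) → max j≤w Pj }) , (λ { refl → contradiction Pj ¬Pw }) ]′ (ℕ.m≤n⇒m<n∨m≡n j≤)

-- The connected sets of a spanning chain

module _ {n} {G : SimpleGraph (Fin n)} {c m} (C : Chain G c m)
         (spanning : ∀ v → ∃[ i ] i ≤ m × Chain.at C i ≡ v) where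
  open SimpleGraph G
  open Chain C
  open Arrangement (connectedSubgraphArrangement G)

  private
    lab : Fin n → ℕ
    lab v = proj₁ (spanning v)

    lab≤ : ∀ v → lab v ≤ m
    lab≤ v = proj₁ (proj₂ (spanning v))

    at-lab : ∀ v → at (lab v) ≡ v
    at-lab v = proj₂ (proj₂ (spanning v))

    lab-at : ∀ {i} → i ≤ m → lab (at i) ≡ i
    lab-at i≤m = injective (lab≤ _) i≤m (at-lab _)

  Valid : Code → Set
  Valid (interval a b) = a < b × b ≤ suc m
  Valid (notched b)    = T c × 3 ≤ b × b ≤ suc m

  _∋_ : Code → ℕ → Set
  interval a b ∋ l = a ≤ l × l < b
  notched b    ∋ l = l ≡ 0 ⊎ (2 ≤ l × l < b)

  -- `segment` counts the labels after the first one, so [a , b) takes b - a - 1 and [2 , b) takes b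
  -- - 3.
  support : Code → Subset n
  support (interval a b) = segment C a (b ∸ suc a)
  support (notched b)    = ⁅ at 0 ⁆ ∪ segment C 2 (b ∸ 3)

  private
    last-label : ∀ {a b} → a < b → suc (b ∸ suc a + a) ≡ b
    last-label {a} {b} a<b = trans (sym (ℕ.+-suc (b ∸ suc a) a)) (ℕ.m∸n+n≡m a<b)

    last≤ : ∀ {a b} → a < b → b ≤ suc m → b ∸ suc a + a ≤ m
    last≤ a<b b≤ = ℕ.≤-pred (subst (_≤ suc m) (sym (last-label a<b)) b≤)

    interval⁺ : ∀ {a b l} → a < b → a ≤ l → l < b → at l ∈ segment C a (b ∸ suc a)
    interval⁺ {a} {b} {l} a<b a≤l l<b = subst (λ e → at e ∈ segment C a (b ∸ suc a)) (ℕ.m∸n+n≡m a≤l)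
      (∈-segment⁺ C a (b ∸ suc a) (ℕ.m≤n+o⇒m∸n≤o l a
        (subst (l ≤_) (ℕ.+-comm (b ∸ suc a) a) (ℕ.≤-pred (subst (l <_) (sym (last-label a<b)) l<b)))))

    interval⁻ : ∀ {a b l} → a < b → b ≤ suc m → l ≤ m → at l ∈ segment C a (b ∸ suc a) → a ≤ l × l < b
    interval⁻ {a} {b} {l} a<b b≤ l≤m l∈ with ∈-segment⁻ C a (b ∸ suc a) l∈
    ... | d , d≤ , eq with injective l≤m (ℕ.≤-trans (ℕ.+-monoˡ-≤ a d≤) (last≤ a<b b≤)) eq
    ...   | refl = ℕ.m≤n+m a d , subst (suc (d + a) ≤_) (last-label a<b) (s≤s (ℕ.+-monoˡ-≤ a d≤))

  support⁺ : ∀ {z l} → Valid z → l ≤ m → z ∋ l → at l ∈ support z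
  support⁺ {interval a b} (a<b , _) _ (a≤l , l<b) = interval⁺ a<b a≤l l<b
  support⁺ {notched b} _ _ (inj₁ refl) = p⊆p∪q _ (x∈⁅x⁆ (at 0))
  support⁺ {notched b} (_ , 3≤b , _) _ (inj₂ (2≤l , l<b)) = q⊆p∪q ⁅ at 0 ⁆ _ (interval⁺ 3≤b 2≤l l<b)

  support⁻ : ∀ {z l} → Valid z → l ≤ m → at l ∈ support z → z ∋ l
  support⁻ {interval a b} (a<b , b≤) l≤m l∈ = interval⁻ a<b b≤ l≤m l∈
  support⁻ {notched b} (_ , 3≤b , b≤) l≤m l∈ with x∈p∪q⁻ ⁅ at 0 ⁆ _ l∈
  ... | inj₁ l∈′ = inj₁ (injective l≤m z≤n (x∈⁅y⁆⇒x≡y _ l∈′))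
  ... | inj₂ l∈′ = inj₂ (interval⁻ 3≤b b≤ l≤m l∈′)

  private
    by-labels : ∀ {A B} → (∀ {l} → l ≤ m → at l ∈ A → at l ∈ B) → (∀ {l} → l ≤ m → at l ∈ B → at l ∈ A) →
        A ≡ B
    by-labels {A} {B} A⊆B B⊆A = ⊆-antisym (λ {v} → transport A⊆B v) (λ {v} → transport B⊆A v)
      where
      transport : ∀ {A B} → (∀ {l} → l ≤ m → at l ∈ A → at l ∈ B) → ∀ v → v ∈ A → v ∈ B
      transport {A} {B} f v v∈ = subst (_∈ B) (at-lab v) (f (lab≤ v) (subst (_∈ A) (sym (at-lab v)) v∈))

    ∋-transfer : ∀ z z′ {l} → Valid z → Valid z′ → support z ≡ support z′ → l ≤ m → z ∋ l → z′ ∋ l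
    ∋-transfer z z′ {l} v v′ eq l≤ z∋l = support⁻ {z′} v′ l≤ (subst (at l ∈_) eq (support⁺ {z} v l≤ z∋l))

    notched≢interval : ∀ {a b b′} → Valid (interval a b) → Valid (notched b′) → support (interval a b) ≢
        support (notched b′)
    notched≢interval {a} {b} {b′} v v′@(_ , 3≤b′ , b′≤) eq =
      [ (λ ()) , (λ { (s≤s () , _) }) ]′ (∋-transfer (interval a b) (notched b′) v v′ eq 1≤m
          (ℕ.≤-trans 0∈ z≤n , ℕ.<⇒≤ 2∈))
      where
      2≤m : 2 ≤ m
      2≤m = ℕ.≤-pred (ℕ.≤-trans 3≤b′ b′≤)
      1≤m : 1 ≤ m
      1≤m = ℕ.<⇒≤ 2≤m
      0∈ : a ≤ 0
      0∈ = proj₁ (∋-transfer (notched b′) (interval a b) v′ v (sym eq) z≤n (inj₁ refl))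
      2∈ : 2 < b
      2∈ = proj₂ (∋-transfer (notched b′) (interval a b) v′ v (sym eq) 2≤m (inj₂ (ℕ.≤-refl , 3≤b′)))

    notched-bound : ∀ {b b′} → Valid (notched b) → Valid (notched b′) → support (notched b) ≡ support
        (notched b′) → b ≤ b′
    notched-bound {suc b} {b′} v@(_ , 3≤b , b≤) v′ eq with ∋-transfer (notched (suc b)) (notched b′) {b} v
        v′ eq (ℕ.≤-pred b≤) (inj₂ (ℕ.≤-pred 3≤b , ℕ.≤-refl))
    ... | inj₁ refl = contradiction 3≤b λ { (s≤s ()) }
    ... | inj₂ (_ , b<b′) = b<b′

    interval-bounds : ∀ {a b a′ b′} → Valid (interval a b) → Valid (interval a′ b′) →
                      support (interval a b) ≡ support (interval a′ b′) → a′ ≤ a × b ≤ b′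
    interval-bounds {a} {suc b} {a′} {b′} v@(a<b , b≤) v′ eq =
      proj₁ (∋-transfer (interval a (suc b)) (interval a′ b′) v v′ eq
          (ℕ.≤-trans (ℕ.≤-pred a<b) (ℕ.≤-pred b≤)) (ℕ.≤-refl , a<b)) ,
      proj₂ (∋-transfer (interval a (suc b)) (interval a′ b′) v v′ eq (ℕ.≤-pred b≤)
          (ℕ.≤-pred a<b , ℕ.≤-refl))

  support-injective : ∀ {z z′} → Valid z → Valid z′ → support z ≡ support z′ → z ≡ z′
  support-injective {interval a b} {interval a′ b′} v v′ eq with interval-bounds v v′ eq | interval-bounds
      v′ v (sym eq)
  ... | a′≤a , b≤b′ | a≤a′ , b′≤b = cong₂ interval (ℕ.≤-antisym a≤a′ a′≤a) (ℕ.≤-antisym b≤b′ b′≤b)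
  support-injective {interval a b} {notched b′} v v′ eq = ⊥-elim (notched≢interval v v′ eq)
  support-injective {notched b} {interval a′ b′} v v′ eq = ⊥-elim (notched≢interval v′ v (sym eq))
  support-injective {notched b} {notched b′} v v′ eq =
    cong notched (ℕ.≤-antisym (notched-bound v v′ eq) (notched-bound v′ v (sym eq)))

  support-connected : ∀ {z} → Valid z → Connected (G [ support z ])
  support-connected {interval a b} (a<b , b≤) = segment-connected C a (b ∸ suc a) (last≤ a<b b≤)
  support-connected {notched b} (t , 3≤b , b≤) =
    connected-∪ G (connected-⁅⁆ G (at 0)) (segment-connected C 2 (b ∸ 3) (last≤ 3≤b b≤))
      (x∈⁅x⁆ (at 0)) (∈-segment⁺ C 2 (b ∸ 3) z≤n) (link⇒adj z≤n (ℕ.≤-pred (ℕ.≤-trans 3≤b b≤)) (chord↑ t))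

  index : ∀ z → Valid z → Index
  index z v = support z , proj₁ (support-connected {z} v) , support-connected {z} v

  -- A walk inside `I` from below `l` to `l` or beyond crosses at some link. The only link that
  -- jumps over a label is the chord, and the label it skips is 1.
  crossed : ∀ {I} → Connected (G [ I ]) → ∀ {i t l} → i ≤ m → t ≤ m → at i ∈ I → at t ∈ I → i < l → l ≤ t →
            at l ∈ I ⊎ (T c × l ≡ 1 × at 0 ∈ I × at 2 ∈ I)
  crossed {I} conn {i} {t} {l} i≤m t≤m i∈ t∈ i<l l≤t
    with exit (λ v → lab v ℕ.<? l) (subst (_< l) (sym (lab-at i≤m)) i<l)
              (λ t<l → ℕ.<⇒≱ (subst (_< l) (lab-at t≤m) t<l) l≤t) (connected⇒joined G conn i∈ t∈)
  ... | u , v , u<l , v≮l , uv , u∈ , v∈ =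
    along (adj⇒link (lab≤ u) (lab≤ v) (subst₂ Adj (sym (at-lab u)) (sym (at-lab v)) uv)) u<l (ℕ.≮⇒≥ v≮l)
          (subst (_∈ I) (sym (at-lab u)) u∈) (subst (_∈ I) (sym (at-lab v)) v∈)
    where
    along : ∀ {x y} → Link c x y → x < l → l ≤ y → at x ∈ I → at y ∈ I → at l ∈ I ⊎
        (T c × l ≡ 1 × at 0 ∈ I × at 2 ∈ I)
    along up x<l l≤y x∈ y∈ = inj₁ (subst (λ e → at e ∈ I) (sym (ℕ.≤-antisym l≤y x<l)) y∈)
    along down x<l l≤y x∈ y∈ = contradiction l≤y (ℕ.<⇒≱ (ℕ.<-trans ℕ.≤-refl x<l))
    along (chord↑ t) x<l l≤y x∈ y∈ with ℕ.m≤n⇒m<n∨m≡n l≤y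
    ... | inj₁ l<2  = inj₂ (t , ℕ.≤-antisym (ℕ.≤-pred l<2) x<l , x∈ , y∈)
    ... | inj₂ refl = inj₁ y∈
    along (chord↓ t) x<l l≤y x∈ y∈ = contradiction (ℕ.<-≤-trans x<l l≤y) λ ()

  -- The least and the greatest label span an interval. By `crossed` a gap in it can only be the
  -- label 1, skipped by the chord, and then every label from 2 to the greatest is present.
  classify : ((I , _) : Index) → ∃[ z ] Valid z × I ≡ support z
  classify (I , (r , r∈) , conn)
    with least (λ i → at i ∈? I) m | greatest (λ i → at i ∈? I) m (lab≤ r)
        (subst (_∈ I) (sym (at-lab r)) r∈)
  ... | inj₂ none | _ = contradiction (subst (_∈ I) (sym (at-lab r)) r∈) (none (lab≤ r))
  ... | inj₁ (i , i≤m , i∈ , min) | t , t≤m , t∈ , max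
    with ℕ.anyUpTo? (λ l → (i ℕ.≤? l) ×-dec ¬? (at l ∈? I)) (suc t)
  ...   | no gapless = interval i (suc t) , (s≤s (max i≤m i∈) , s≤s t≤m) , by-labels
            (λ {l} l≤m l∈ → interval⁺ {i} {suc t} (s≤s (max i≤m i∈)) (ℕ.≮⇒≥ λ l<i → min l<i l∈)
                (s≤s (max l≤m l∈)))
            (λ {l} l≤m l∈ → let (i≤l , l<) = interval⁻ {i} {suc t} (s≤s (max i≤m i∈)) (s≤s t≤m) l≤m l∈ in
                            decidable-stable (at l ∈? I) λ l∉ → gapless (l , l< , i≤l , l∉))
  ...   | yes (l , s≤s l≤t , i≤l , l∉) with crossed conn i≤m t≤m i∈ t∈ (ℕ.≤∧≢⇒< i≤l λ { refl → l∉ i∈ }) l≤t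
  ...     | inj₁ l∈ = contradiction l∈ l∉
  ...     | inj₂ (chord , refl , 0∈ , 2∈) = notched (suc t) , valid , by-labels into from
    where
    valid : Valid (notched (suc t))
    valid = chord , s≤s (max (chord-fits chord) 2∈) , s≤s t≤m
    into : ∀ {l} → l ≤ m → at l ∈ I → at l ∈ support (notched (suc t))
    into {0} l≤m l∈ = support⁺ {notched (suc t)} valid l≤m (inj₁ refl)
    into {1} l≤m l∈ = contradiction l∈ l∉
    into {suc (suc l)} l≤m l∈ =
        support⁺ {notched (suc t)} valid l≤m (inj₂ (s≤s (s≤s z≤n) , s≤s (max l≤m l∈)))
    from : ∀ {l} → l ≤ m → at l ∈ support (notched (suc t)) → at l ∈ I
    from l≤m l∈ with support⁻ {notched (suc t)} valid l≤m l∈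
    ... | inj₁ refl = 0∈
    ... | inj₂ (2≤l , s≤s l≤t) with crossed conn i≤m t≤m i∈ t∈ (ℕ.≤-<-trans i≤l 2≤l) l≤t
    ...   | inj₁ l∈I = l∈I
    ...   | inj₂ (_ , refl , _) = contradiction 2≤l λ { (s≤s ()) }

  private
    code : Index → Code
    code i = proj₁ (classify i)

    code-valid : ∀ i → Valid (code i)
    code-valid i = proj₁ (proj₂ (classify i))

    code-support : ∀ i → proj₁ i ≡ support (code i)
    code-support i = proj₂ (proj₂ (classify i))

    code-unique : ∀ {i z} → Valid z → proj₁ i ≡ support z → code i ≡ z
    code-unique {i} {z} v eq =
        support-injective {code i} {z} (code-valid i) v (trans (sym (code-support i)) eq)

    colour-range : ∀ {z} → Valid z → 1 ≤ colour z × colour z ≤ suc m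
    colour-range {interval 0 b} (a<b , b≤) = a<b , b≤
    colour-range {interval 1 b} _ = ℕ.≤-refl , s≤s z≤n
    colour-range {interval (suc (suc a)) b} (a<b , b≤) = ℕ.≤-trans (s≤s z≤n) a<b , b≤
    colour-range {notched b} (_ , 3≤b , b≤) = ℕ.≤-trans (s≤s z≤n) 3≤b , b≤

    pred-range : ∀ {x} → 1 ≤ x × x ≤ suc m → pred x < suc m
    pred-range {suc x} (_ , le) = le

    suc-pred-range : ∀ {x} → 1 ≤ x × x ≤ suc m → suc (pred x) ≡ x
    suc-pred-range {suc x} _ = refl

    block : Index → Fin (suc m)
    block i = fromℕ< (pred-range (colour-range {code i} (code-valid i)))

    block-colour : ∀ i → suc (toℕ (block i)) ≡ colour (code i)
    block-colour i = trans (cong suc (Fin.toℕ-fromℕ< (pred-range range))) (suc-pred-range range)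
      where range = colour-range {code i} (code-valid i)

    block-of : ∀ {i z} → Valid z → proj₁ i ≡ support z → suc (toℕ (block i)) ≡ colour z
    block-of {i} v eq = trans (block-colour i) (cong colour (code-unique {i} v eq))

  colouring : Partition (connectedSubgraphArrangement G) (suc m)
  colouring = record
    { to         = block
    ; cong       = λ {i} {j} H≐H → Fin.toℕ-injective (ℕ.suc-injective
        (trans (block-of {i} {code j} (code-valid j) (trans (ker-injective H≐H) (code-support j)))
            (sym (block-colour j))))
    -- Intervals starting at 0 keep the colour of their greatest label, so they reach every block;
    -- the set {0} reaches the first.
    ; surjective = λ y → index (interval 0 (suc (toℕ y))) (valid y) , λ {i} H≐H →
        Fin.toℕ-injective (ℕ.suc-injective
        (block-of {i} {interval 0 (suc (toℕ y))} (valid y) (ker-injective H≐H)))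
    }
    where
    valid : ∀ y → Valid (interval 0 (suc (toℕ y)))
    valid y = s≤s z≤n , Fin.toℕ<n y

  -- Flats in terms of partial sums

  σ : Vector ℚ n → ℕ → ℚ
  σ v zero    = 0ℚ
  σ v (suc l) = σ v l +ℚ v (at l)

  private
    one-times : ∀ x y → 1ℚ *ℚ x +ℚ 1ℚ *ℚ y ≡ x +ℚ y
    one-times x y = cong₂ _+ℚ_ (ℚ.*-identityˡ x) (ℚ.*-identityˡ y)

    ⁅⁆-indicator : ∀ (u : Fin n) k → indicator ⁅ u ⁆ k ≡ δ u k
    ⁅⁆-indicator u k with k Fin.≟ u
    ... | yes refl = trans (cong χ ([]=⇒lookup (x∈⁅x⁆ u))) (sym (δ-same u))
    ... | no k≢u with lookup ⁅ u ⁆ k in eq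
    ...   | false = sym (δ-diff (k≢u ∘ sym))
    ...   | true  = contradiction (x∈⁅y⁆⇒x≡y u (lookup⇒[]= k ⁅ u ⁆ eq)) k≢u

    adjoin-∙ : ∀ {u A} → u ∉ A → ∀ v → indicator (⁅ u ⁆ ∪ A) ∙ v ≡ v u +ℚ indicator A ∙ v
    adjoin-∙ {u} {A} u∉A v = begin
      indicator (⁅ u ⁆ ∪ A) ∙ v                                    ≡⟨ ∙-cong pointwise-sum v ⟩
      (λ k → 1ℚ *ℚ δ u k +ℚ 1ℚ *ℚ indicator A k) ∙
          v               ≡⟨ ∙-linearˡ (δ u) (indicator A) v 1ℚ 1ℚ ⟩
      1ℚ *ℚ (δ u ∙ v) +ℚ 1ℚ *ℚ (indicator A ∙ v)                   ≡⟨ one-times (δ u ∙ v)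
          (indicator A ∙ v) ⟩
      δ u ∙ v +ℚ indicator A ∙ v                                   ≡⟨ cong (_+ℚ indicator A ∙ v) (δ-∙ u v) ⟩
      v u +ℚ indicator A ∙ v                                       ∎
      where
      open ≡-Reasoning
      disjoint-or : ∀ x y → ¬ (x ≡ true × y ≡ true) → χ (x ∨ y) ≡ χ x +ℚ χ y
      disjoint-or false y     _  = sym (ℚ.+-identityˡ (χ y))
      disjoint-or true  false _  = refl
      disjoint-or true  true  ¬b = contradiction (refl , refl) ¬b
      pointwise-sum : ∀ k → indicator (⁅ u ⁆ ∪ A) k ≡ 1ℚ *ℚ δ u k +ℚ 1ℚ *ℚ indicator A k
      pointwise-sum k = begin
        indicator (⁅ u ⁆ ∪ A) k                        ≡⟨ cong χ (lookup-zipWith _∨_ k ⁅ u ⁆ A) ⟩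
        χ (lookup ⁅ u ⁆ k ∨ lookup A k) ≡⟨ disjoint-or (lookup ⁅ u ⁆ k) (lookup A k) not-both ⟩
        indicator ⁅ u ⁆ k +ℚ indicator A k             ≡⟨ cong (_+ℚ indicator A k) (⁅⁆-indicator u k) ⟩
        δ u k +ℚ indicator A k                         ≡⟨ sym (one-times (δ u k) (indicator A k)) ⟩
        1ℚ *ℚ δ u k +ℚ 1ℚ *ℚ indicator A k             ∎
        where
        not-both : ¬ (lookup ⁅ u ⁆ k ≡ true × lookup A k ≡ true)
        not-both (ku , kA) with x∈⁅y⁆⇒x≡y u (lookup⇒[]= k ⁅ u ⁆ ku)
        ... | refl = u∉A (lookup⇒[]= k A kA)

    -- Stated without subtraction, so that each step of the induction moves the first vertex from
    -- the segment into the partial sum.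
    segment-∙ : ∀ i k → k + i ≤ m → ∀ v → indicator (segment C i k) ∙ v +ℚ σ v i ≡ σ v (suc (k + i))
    segment-∙ i zero    _  v = begin
      indicator ⁅ at i ⁆ ∙ v +ℚ σ v i ≡⟨ cong (_+ℚ σ v i)
          (trans (∙-cong (⁅⁆-indicator (at i)) v) (δ-∙ (at i) v)) ⟩
      v (at i) +ℚ σ v i               ≡⟨ ℚ.+-comm (v (at i)) (σ v i) ⟩
      σ v i +ℚ v (at i)               ∎
      where open ≡-Reasoning
    segment-∙ i (suc k) le v = begin
      indicator (⁅ at i ⁆ ∪ segment C (suc i) k) ∙ v +ℚ σ v
          i    ≡⟨ cong (_+ℚ σ v i) (adjoin-∙ (below∉segment C (suc i) k le′ ℕ.≤-refl) v) ⟩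
      (v (at i) +ℚ rest) +ℚ σ v i                                ≡⟨ solve 3
          (λ x y z → (x :+ y) :+ z := y :+ (z :+ x)) refl (v (at i)) rest (σ v i) ⟩
      rest +ℚ σ v (suc i)                                        ≡⟨ segment-∙ (suc i) k le′ v ⟩
      σ v (suc (k + suc i))                                      ≡⟨ cong (λ e → σ v (suc e)) (ℕ.+-suc k i) ⟩
      σ v (suc (suc (k + i)))                                    ∎
      where
      open ≡-Reasoning
      rest = indicator (segment C (suc i) k) ∙ v
      le′ : k + suc i ≤ m
      le′ = subst (_≤ m) (sym (ℕ.+-suc k i)) le

    interval-∙ : ∀ {a b} → a < b → b ≤ suc m → ∀ v → indicator (segment C a (b ∸ suc a)) ∙ v +ℚ σ v a ≡ σ v
        b
    interval-∙ {a} {b} a<b b≤ v =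
        trans (segment-∙ a (b ∸ suc a) (last≤ a<b b≤) v) (cong (σ v) (last-label a<b))

    zero-iff : ∀ {x y z : ℚ} → x +ℚ y ≡ z → (x ≡ 0ℚ ⇔ y ≡ z)
    zero-iff {x} {y} {z} eq =
        mk⇔ (λ x≡0 → trans (sym (ℚ.+-identityˡ y)) (trans (cong (_+ℚ y) (sym x≡0)) eq))
                                  (λ y≡z → identityˡ-unique x y (trans eq (sym y≡z)))

    -- In the notched equation `v (at 0)` stands for σ 1, and σ 0 is left out, being zero.
    On : Code → Vector ℚ n → Set
    On (interval a b) v = σ v a ≡ σ v b
    On (notched b)    v = σ v 2 ≡ v (at 0) +ℚ σ v b

    on : ∀ z → Valid z → ∀ v → ker (indicator (support z)) v ⇔ On z v
    on (interval a b) (a<b , b≤) v = zero-iff (interval-∙ a<b b≤ v)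
    on (notched b) (_ , 3≤b , b≤) v = zero-iff (begin
      indicator (⁅ at 0 ⁆ ∪ segment C 2 (b ∸ 3)) ∙ v +ℚ σ v
          2   ≡⟨ cong (_+ℚ σ v 2) (adjoin-∙ (below∉segment C 2 (b ∸ 3) (last≤ 3≤b b≤) (s≤s z≤n)) v) ⟩
      (v (at 0) +ℚ rest) +ℚ σ v 2                               ≡⟨ ℚ.+-assoc (v (at 0)) rest (σ v 2) ⟩
      v (at 0) +ℚ (rest +ℚ σ v 2)                               ≡⟨ cong (v (at 0) +ℚ_)
          (interval-∙ 3≤b b≤ v) ⟩
      v (at 0) +ℚ σ v b                                         ∎)
      where
      open ≡-Reasoning
      rest = indicator (segment C 2 (b ∸ 3)) ∙ v

  module _ {X : Pred (Vector ℚ n) 0ℓ} {B : List Index} (X≐⋂B : X ≐ ⋂ B) where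

    private
      on-flat? : ∀ z → Valid z → Dec (∀ {v} → X v → On z v)
      on-flat? z valid = map′ (λ van {v} Xv → Equivalence.to (on z valid v) (van (proj₁ X≐⋂B Xv)))
                              (λ all {v} Bv → Equivalence.from (on z valid v) (all (proj₂ X≐⋂B Bv)))
                              (vanishes? form B (indicator (support z)))

      _∼_ : ℕ → ℕ → Set
      a ∼ b = ∀ {v} → X v → σ v a ≡ σ v b

      -- The factor `T c` switches the notched sets off for a path, so that one argument covers both
      -- kinds of chain.
      E : ℕ → Set
      E b = T c × (∀ {v} → X v → σ v 2 ≡ v (at 0) +ℚ σ v b)

      E? : ∀ {b} → 3 ≤ b → b ≤ suc m → Dec (E b)
      E? {b} 3≤b b≤ with T? c
      ... | no ¬t = no λ e → ¬t (proj₁ e)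
      ... | yes t = map′ (λ f → t , λ {v} → f {v}) proj₂ (on-flat? (notched b) (t , 3≤b , b≤))

      member-valid : ∀ {z} → Member (suc m) _∼_ E z → Valid z
      member-valid {interval a b} (a<b , b≤ , _) = a<b , b≤
      member-valid {notched b} (3≤b , b≤ , t , _) = t , 3≤b , b≤

      member-on : ∀ {z} → Member (suc m) _∼_ E z → ∀ {v} → X v → On z v
      member-on {interval a b} (_ , _ , r) = r
      member-on {notched b} (_ , _ , _ , r) = r

      on-member : ∀ {z} → Valid z → (∀ {v} → X v → On z v) → Member (suc m) _∼_ E z
      on-member {interval a b} (a<b , b≤) r = a<b , b≤ , λ {v} → r {v}
      on-member {notched b} (t , 3≤b , b≤) r = 3≤b , b≤ , t , λ {v} → r {v}

      code-member : ∀ i → (∀ {v} → X v → H i v) → Member (suc m) _∼_ E (code i)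
      code-member i X⊆H = on-member {code i} (code-valid i) λ {v} Xv →
        Equivalence.to (on (code i) (code-valid i) v)
            (subst (λ I → ker (indicator I) v) (code-support i) (X⊆H Xv))

      find-lone : ∀ {z} → Member (suc m) _∼_ E z →
                  ∃[ z ] Member (suc m) _∼_ E z ×
                      (∀ {z′} → Member (suc m) _∼_ E z′ → colour z′ ≡ colour z → z′ ≡ z)
      find-lone = lone-member (suc m) _∼_ E
        (λ ab Xv → sym (ab Xv)) (λ ab bc Xv → trans (ab Xv) (bc Xv))
        (λ {a} {b} (_ , Ea) (_ , Eb) {v} Xv → ∙-cancelˡ (v (at 0)) (σ v a) (σ v b)
            (trans (sym (Ea Xv)) (Eb Xv)))
        (λ (t , Ea) ab → t , λ {v} Xv → trans (Ea Xv) (cong (v (at 0) +ℚ_) (ab Xv)))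
        -- Here σ b = σ 0 = 0, so the notched equation becomes σ 2 = σ 1. In the next argument σ b =
        -- σ 2, which leaves σ 1 = 0.
        (λ {b} (_ , Eb) 0b {v} Xv →
            sym (trans (Eb Xv) (trans (cong (v (at 0) +ℚ_) (sym (0b Xv))) (ℚ.+-comm (v (at 0)) 0ℚ))))
        (λ {b} (_ , Eb) 2b {v} Xv → sym (trans (ℚ.+-identityˡ (v (at 0)))
          (identityˡ-unique (v (at 0)) (σ v b) (trans (sym (Eb Xv)) (2b Xv)))))
        (λ {a} {b} a<b b≤ → on-flat? (interval a b) (a<b , b≤)) E?

    singleton-block : ∀ {i} → (∀ {v} → X v → H i v) → HasSingletonBlock (connectedSubgraphArrangement G)
        colouring X
    singleton-block {i} X⊆H with find-lone (code-member i X⊆H)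
    ... | z , z∈ , unique =
        block zᵢ , zᵢ , (refl , λ {v} Xv → Equivalence.from (on z z-valid v) (member-on {z} z∈ Xv)) ,
      λ j (same , X⊆Hj) → H-cong {j} (trans (code-support j) (cong support (unique (code-member j X⊆Hj)
        (trans (sym (block-colour j)) (trans (cong (suc ∘ toℕ) same) (block-of {zᵢ} {z} z-valid refl))))))
      where
      z-valid = member-valid {z} z∈
      zᵢ = index z z-valid
      H-cong : ∀ {j} → proj₁ j ≡ support z → H j ≐ H zᵢ
      H-cong refl = id , id

  singletons : ∀ X → L X → ¬ (X ≐ U) → HasSingletonBlock (connectedSubgraphArrangement G) colouring X
  singletons X ([]    , X≐⋂) X≢U = ⊥-elim (X≢U ((λ _ → _) , λ _ → proj₂ X≐⋂ []))
  singletons X (i ∷ B , X≐⋂) _   = singleton-block X≐⋂ {i} λ Xv → head (proj₁ X≐⋂ Xv)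
    where
    head : ∀ {v} → ⋂ (i ∷ B) v → H i v
    head (Hv ∷ _) = Hv

  -- Independence of sections

  module _ (s : Fin (suc m) → Index) (section : ∀ j → block (s j) ≡ j) where

    private
      z : Fin (suc m) → Code
      z j = code (s j)

      z-colour : ∀ j → colour (z j) ≡ suc (toℕ j)
      z-colour j = trans (sym (block-colour (s j))) (cong (suc ∘ toℕ) (section j))

      f : Fin (suc m) → ℕ → ℚ
      f j l = form (s j) (at l)

      Value : Set → ℚ → Set
      Value P x = (P → x ≡ 1ℚ) × (¬ P → x ≡ 0ℚ)

      f-value : ∀ j {l} → l ≤ m → Value (z j ∋ l) (f j l)
      f-value j {l} l≤ = (λ ∋l → cong χ ([]=⇒lookup (to ∋l))) , outside
        where
        to : z j ∋ l → at l ∈ proj₁ (s j)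
        to ∋l = subst (at l ∈_) (sym (code-support (s j))) (support⁺ {z j} (code-valid (s j)) l≤ ∋l)
        outside : ¬ (z j ∋ l) → f j l ≡ 0ℚ
        outside ∌l with lookup (proj₁ (s j)) (at l) in eq
        ... | false = refl
        ... | true  = contradiction (support⁻ {z j} (code-valid (s j)) l≤
                        (subst (at l ∈_) (code-support (s j)) (lookup⇒[]= (at l) _ eq))) ∌l

      colour-from-1 : ∀ {z k} → Valid z → colour z ≡ suc (suc k) →
        (∃[ a ] z ≡ interval a (suc (suc k)) × a ≢ 1 × a < suc (suc k)) ⊎
            (z ≡ notched (suc (suc k)) × 3 ≤ suc (suc k))
      colour-from-1 {interval 0 _} (a< , _) refl = inj₁ (0 , refl , (λ ()) , a<)
      colour-from-1 {interval (suc (suc a)) _} (a< , _) refl = inj₁ (_ , refl , (λ ()) , a<)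
      colour-from-1 {notched _} (_ , 3≤ , _) refl = inj₂ (refl , 3≤)

      -- Outside the first block, the forms of a section are triangular with respect to the labels 1
      -- , ... , m. Only the member of the first block, which may end anywhere, breaks the pattern.
      top-label : ∀ {z k} → Valid z → colour z ≡ suc (suc k) → z ∋ suc k × (∀ {l} → suc k < l → ¬ (z ∋ l))
      top-label {z} v eq with colour-from-1 {z} v eq
      ... | inj₁ (a , refl , _ , a<) = (ℕ.≤-pred a< , ℕ.≤-refl) , λ k<l (_ , l<) → ℕ.<⇒≱ k<l (ℕ.≤-pred l<)
      ... | inj₂ (refl , 3≤) = inj₂ (ℕ.≤-pred 3≤ , ℕ.≤-refl) ,
              λ { k<l (inj₁ refl) → contradiction k<l λ () ; k<l (inj₂ (_ , l<)) → ℕ.<⇒≱ k<l (ℕ.≤-pred l<) }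

      f-top : ∀ {j k} → toℕ j ≡ suc k → suc k ≤ m → f j (suc k) ≡ 1ℚ
      f-top {j} eq k<m =
          proj₁ (f-value j k<m) (proj₁ (top-label {z j} (code-valid (s j))
            (trans (z-colour j) (cong suc eq))))

      f-above : ∀ {j l} → 1 ≤ toℕ j → toℕ j < l → l ≤ m → f j l ≡ 0ℚ
      f-above {suc j} {l} _ j<l l≤ =
          proj₂ (f-value (suc j) l≤) (proj₂ (top-label {z (suc j)} (code-valid (s (suc j)))
            (z-colour (suc j))) j<l)

      F : ℕ → Vector ℚ (suc m)
      F l j = f j l

      ∙-single : ∀ (d w : Vector ℚ (suc m)) k → (∀ j → j ≢ k → d j *ℚ w j ≡ 0ℚ) → d ∙ w ≡ d k *ℚ w k
      ∙-single d w k zero-elsewhere = trans (sum-cong-≗ at-j) (δ-∙ k (λ j → d j *ℚ w j))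
        where
        at-j : ∀ j → d j *ℚ w j ≡ δ k j *ℚ (d j *ℚ w j)
        at-j j with j Fin.≟ k
        ... | yes refl = trans (sym (ℚ.*-identityˡ _)) (cong (_*ℚ (d j *ℚ w j)) (sym (δ-same j)))
        ... | no j≢k   =
            trans (zero-elsewhere j j≢k) (sym
              (trans (cong (_*ℚ (d j *ℚ w j)) (δ-diff (j≢k ∘ sym))) (ℚ.*-zeroˡ (d j *ℚ w j))))

      Initial : ℕ → (ℕ → ℚ) → Set
      Initial e g = ∀ {l} → l ≤ m → Value (1 ≤ l × l < e) (g l)

      Flat : (ℕ → ℚ) → Set
      Flat g = g 1 ≢ g 0 × (∀ {l} → 2 ≤ l → l ≤ m → g l ≡ 0ℚ)

      -- What the member of the first block can turn into during elimination. In either case the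
      -- coefficients at the labels 0 and 1 differ, the first because 2 ≤ e.
      Shape : ℕ → (ℕ → ℚ) → Set
      Shape k g = (∃[ e ] 2 ≤ e × e ≤ suc k × Initial e g) ⊎ Flat g

      -- `d` with its entry at `k` replaced by zero, in a form to which linearity of the pairing
      -- applies.
      dropped : Vector ℚ (suc m) → Fin (suc m) → Vector ℚ (suc m)
      dropped d k j = 1ℚ *ℚ d j +ℚ (- d k) *ℚ δ k j

      dropped-same : ∀ d k → dropped d k k ≡ 0ℚ
      dropped-same d k = trans (cong (λ x → 1ℚ *ℚ d k +ℚ (- d k) *ℚ x) (δ-same k))
        (solve 1 (λ x → con 1ℚ :* x :+ (:- x) :* con 1ℚ := con 0ℚ) refl (d k))

      dropped-other : ∀ d {k j} → k ≢ j → dropped d k j ≡ d j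
      dropped-other d {k} {j} k≢j = trans (cong (λ x → 1ℚ *ℚ d j +ℚ (- d k) *ℚ x) (δ-diff k≢j))
        (solve 2 (λ x y → con 1ℚ :* x :+ (:- y) :* con 0ℚ := x) refl (d j) (d k))

      dropped-∙ : ∀ d k w → dropped d k ∙ w ≡ 1ℚ *ℚ (d ∙ w) +ℚ (- d k) *ℚ w k
      dropped-∙ d k w =
          trans (∙-linearˡ d (δ k) w 1ℚ (- d k)) (cong (λ x → 1ℚ *ℚ (d ∙ w) +ℚ (- d k) *ℚ x) (δ-∙ k w))

      undrop : ∀ {d k} → d k ≡ 0ℚ → (∀ j → dropped d k j ≡ 0ℚ) → ∀ j → d j ≡ 0ℚ
      undrop {d} {k} dk≡0 rest j with k Fin.≟ j
      ... | yes refl = dk≡0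
      ... | no k≢j   = trans (sym (dropped-other d k≢j)) (rest j)

      -- Subtracting the form of colour k + 1 from [1 , k + 1] removes the label k + 1 and leaves a shorter
      -- initial interval, or a form supported on the labels 0 and 1 with different coefficients there.
      reduced : ∀ {k g} (j : Fin (suc m)) → toℕ j ≡ suc (suc k) → suc (suc k) ≤ m → Shape (suc (suc k)) g →
                Shape (suc k) (λ l → g l +ℚ (- (g (suc (suc k)) *ℚ f j l)))
      reduced {k} {g} j j≡ k≤m = λ
        { (inj₂ (g1≢g0 , flat)) →
            inj₂ ((λ eq →
              g1≢g0 (trans (sym (unchanged (flat (s≤s (s≤s z≤n)) k≤m) 1))
                (trans eq (unchanged (flat (s≤s (s≤s z≤n)) k≤m) 0)))) ,
            λ {l} 2≤l l≤ → trans (unchanged (flat (s≤s (s≤s z≤n)) k≤m) l) (flat 2≤l l≤))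
        ; (inj₁ (e , 2≤e , e≤ , init)) → initial e 2≤e (ℕ.m≤n⇒m<n∨m≡n e≤) init
        }
        where
        unchanged : g (suc (suc k)) ≡ 0ℚ → ∀ l → g l +ℚ (- (g (suc (suc k)) *ℚ f j l)) ≡ g l
        unchanged eq l = trans (cong (λ x → g l +ℚ (- (x *ℚ f j l))) eq)
          (solve 2 (λ x y → x :+ (:- (con 0ℚ :* y)) := x) refl (g l) (f j l))

        values : ∀ {x y w} → g (suc (suc k)) ≡ 1ℚ → ∀ {l} → g l ≡ x → f j l ≡ y → x +ℚ (- (1ℚ *ℚ y)) ≡ w →
                 g l +ℚ (- (g (suc (suc k)) *ℚ f j l)) ≡ w
        values one gl fl eq = trans (cong₂ _+ℚ_ gl (cong -_ (cong₂ _*ℚ_ one fl))) eq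

        initial : ∀ e → 2 ≤ e → e < suc (suc (suc k)) ⊎ e ≡ suc (suc (suc k)) → Initial e g →
                  Shape (suc k) (λ l → g l +ℚ (- (g (suc (suc k)) *ℚ f j l)))
        initial e 2≤e (inj₁ (s≤s e≤)) init = inj₁ (e , 2≤e , e≤ , λ {l} l≤ →
            (λ p → trans (unchanged gk≡0 l) (proj₁ (init l≤) p)) , λ ¬p → trans (unchanged gk≡0 l)
                (proj₂ (init l≤) ¬p))
          where
          gk≡0 : g (suc (suc k)) ≡ 0ℚ
          gk≡0 = proj₂ (init k≤m) λ (_ , k<e) → ℕ.<⇒≱ k<e e≤
        initial _ _ (inj₂ refl) init with colour-from-1 {z j} (code-valid (s j))
            (trans (z-colour j) (cong suc j≡))
        -- [1 , k + 2] minus {0} ∪ [2 , k + 2] is - 1 at the label 0 and 1 at the label 1.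
        ... | inj₂ (zj≡ , _) = inj₂ ((λ eq → contradiction (trans (sym at-1) (trans eq at-0)) λ ()) , at-l)
          where
          gk≡1 : g (suc (suc k)) ≡ 1ℚ
          gk≡1 = proj₁ (init k≤m) (s≤s z≤n , ℕ.≤-refl)
          fv : ∀ {l} → l ≤ m → Value (notched (suc (suc (suc k))) ∋ l) (f j l)
          fv {l} l≤ = subst (λ z → Value (z ∋ l) (f j l)) zj≡ (f-value j l≤)
          at-1 : g 1 +ℚ (- (g (suc (suc k)) *ℚ f j 1)) ≡ 1ℚ
          at-1 = values gk≡1 (proj₁ (init 1≤m) (s≤s z≤n , s≤s (s≤s z≤n)))
                   (proj₂ (fv 1≤m) (λ { (inj₁ ()) ; (inj₂ (s≤s () , _)) })) refl
            where
            1≤m : 1 ≤ m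
            1≤m = ℕ.≤-trans (s≤s z≤n) k≤m
          at-0 : g 0 +ℚ (- (g (suc (suc k)) *ℚ f j 0)) ≡ - 1ℚ
          at-0 = values gk≡1 (proj₂ (init z≤n) λ ()) (proj₁ (fv z≤n) (inj₁ refl)) refl
          at-l : ∀ {l} → 2 ≤ l → l ≤ m → g l +ℚ (- (g (suc (suc k)) *ℚ f j l)) ≡ 0ℚ
          at-l {l} 2≤l l≤ with l ℕ.<? suc (suc (suc k))
          ... | yes l< = values gk≡1 (proj₁ (init l≤) (ℕ.<⇒≤ 2≤l , l<)) (proj₁ (fv l≤) (inj₂ (2≤l , l<)))
              refl
          ... | no l≮  =
              values gk≡1 (proj₂ (init l≤) (l≮ ∘ proj₂))
                (proj₂ (fv l≤) (λ { (inj₁ refl) → contradiction 2≤l λ () ; (inj₂ (_ , l<)) → l≮ l< })) refl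
        ... | inj₁ (a , zj≡ , a≢1 , a<) = by-start a a≢1 a< fv
          where
          gk≡1 : g (suc (suc k)) ≡ 1ℚ
          gk≡1 = proj₁ (init k≤m) (s≤s z≤n , ℕ.≤-refl)
          fv : ∀ {l} → l ≤ m → Value (a ≤ l × l < suc (suc (suc k))) (f j l)
          fv {l} l≤ = subst (λ z → Value (z ∋ l) (f j l)) zj≡ (f-value j l≤)
          by-start : ∀ a → a ≢ 1 → a < suc (suc (suc k)) →
              (∀ {l} → l ≤ m → Value (a ≤ l × l < suc (suc (suc k))) (f j l)) →
                     Shape (suc k) (λ l → g l +ℚ (- (g (suc (suc k)) *ℚ f j l)))
          -- [1 , k + 2] minus [0 , k + 2] is - 1 at the label 0 and zero elsewhere.
          by-start 0 _ _ fv = inj₂ ((λ eq → contradiction (trans (sym at-1) (trans eq at-0)) λ ()) , at-l)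
            where
            at-1 : g 1 +ℚ (- (g (suc (suc k)) *ℚ f j 1)) ≡ 0ℚ
            at-1 = values gk≡1 (proj₁ (init 1≤m) (s≤s z≤n , s≤s (s≤s z≤n)))
                (proj₁ (fv 1≤m) (z≤n , s≤s (s≤s z≤n))) refl
              where
              1≤m : 1 ≤ m
              1≤m = ℕ.≤-trans (s≤s z≤n) k≤m
            at-0 : g 0 +ℚ (- (g (suc (suc k)) *ℚ f j 0)) ≡ - 1ℚ
            at-0 = values gk≡1 (proj₂ (init z≤n) λ ()) (proj₁ (fv z≤n) (z≤n , s≤s z≤n)) refl
            at-l : ∀ {l} → 2 ≤ l → l ≤ m → g l +ℚ (- (g (suc (suc k)) *ℚ f j l)) ≡ 0ℚ
            at-l {l} 2≤l l≤ with l ℕ.<? suc (suc (suc k))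
            ... | yes l< = values gk≡1 (proj₁ (init l≤) (ℕ.<⇒≤ 2≤l , l<)) (proj₁ (fv l≤) (z≤n , l<)) refl
            ... | no l≮  = values gk≡1 (proj₂ (init l≤) (l≮ ∘ proj₂)) (proj₂ (fv l≤) (l≮ ∘ proj₂)) refl
          by-start 1 a≢1 _ _ = contradiction refl a≢1
          -- [1 , k + 2] minus [a , k + 2] is [1 , a - 1], which still contains 1.
          by-start a@(suc (suc _)) _ (s≤s a≤) fv = inj₁ (a , s≤s (s≤s z≤n) , a≤ , at-l)
            where
            at-l : Initial a (λ l → g l +ℚ (- (g (suc (suc k)) *ℚ f j l)))
            at-l {l} l≤ = (λ (1≤l , l<a) → values gk≡1 (proj₁ (init l≤) (1≤l , ℕ.<-trans l<a (s≤s a≤)))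
                                             (proj₂ (fv l≤) λ (a≤l , _) → ℕ.<⇒≱ l<a a≤l) refl) , beyond
              where
              beyond : ¬ (1 ≤ l × l < a) → g l +ℚ (- (g (suc (suc k)) *ℚ f j l)) ≡ 0ℚ
              beyond ¬p with a ℕ.≤? l | l ℕ.<? suc (suc (suc k))
              ... | yes a≤l | yes l< = values gk≡1 (proj₁ (init l≤) (ℕ.≤-trans (s≤s z≤n) a≤l , l<))
                  (proj₁ (fv l≤) (a≤l , l<)) refl
              ... | yes a≤l | no l≮  =
                  values gk≡1 (proj₂ (init l≤) (l≮ ∘ proj₂)) (proj₂ (fv l≤) (l≮ ∘ proj₂)) refl
              ... | no a≰l  | _      = values gk≡1 (proj₂ (init l≤) λ (1≤l , _) → ¬p (1≤l , ℕ.≰⇒> a≰l))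
                  (proj₂ (fv l≤) (a≰l ∘ proj₁)) refl

      -- Elimination from the top label down, where `x` is the coefficient of the member of the
      -- first block and `g` is what is left of its form. At the label k + 1 only `g` and the form
      -- of colour k + 2 contribute, so that form's coefficient is a multiple of `x`; substituting
      -- it shortens `g`. In the end the form of colour 2 is constant on the labels 0 and 1 while
      -- `g` is not, hence `x` vanishes, and the other coefficients follow on the way back.
      peel : ∀ k {g x d} → suc k ≤ m → Shape (suc k) g → d zero ≡ 0ℚ → (∀ j → suc k < toℕ j → d j ≡ 0ℚ) →
             (∀ {l} → l ≤ m → x *ℚ g l +ℚ d ∙ F l ≡ 0ℚ) → x ≡ 0ℚ × (∀ j → d j ≡ 0ℚ)
      peel zero {g} {x} {d} 1≤m shape d0 d> eq = x≡0 , d≡0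
        where
        j : Fin (suc m)
        j = fromℕ< (s≤s 1≤m)
        toℕ-j : toℕ j ≡ 1
        toℕ-j = Fin.toℕ-fromℕ< (s≤s 1≤m)
        d-other : ∀ i → i ≢ j → d i ≡ 0ℚ
        d-other i i≢j with toℕ i in i≡
        ... | 0 = trans (cong d (Fin.toℕ-injective {j = zero} i≡)) d0
        ... | 1 = contradiction (Fin.toℕ-injective (trans i≡ (sym toℕ-j))) i≢j
        ... | suc (suc _) = d> i (subst (1 <_) (sym i≡) (s≤s (s≤s z≤n)))
        f-j : ∀ {l} → l < 2 → l ≤ m → f j l ≡ 1ℚ
        -- Only [0 , 2) has colour 2: [1 , 2) belongs to the first block, and a notched set has b ≥
        -- 3.
        f-j l<2 l≤ = proj₁ (f-value j l≤) (member
            (colour-from-1 {z j} (code-valid (s j)) (trans (z-colour j) (cong suc toℕ-j))))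
          where
          member : (∃[ a ] z j ≡ interval a 2 × a ≢ 1 × a < 2) ⊎ (z j ≡ notched 2 × 3 ≤ 2) → z j ∋ _
          member (inj₁ (0 , eq , _ , _)) rewrite eq = z≤n , l<2
          member (inj₁ (1 , _ , a≢1 , _)) = contradiction refl a≢1
          member (inj₁ (suc (suc _) , _ , _ , s≤s (s≤s ())))
          member (inj₂ (_ , s≤s (s≤s ())))
        eq′ : ∀ {l} → l < 2 → l ≤ m → x *ℚ g l +ℚ d j ≡ 0ℚ
        eq′ {l} l<2 l≤ = trans (cong (x *ℚ g l +ℚ_) (sym (begin
          d ∙ F l       ≡⟨ ∙-single d (F l) j
              (λ i i≢j → trans (cong (_*ℚ F l i) (d-other i i≢j)) (ℚ.*-zeroˡ (F l i))) ⟩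
          d j *ℚ f j l  ≡⟨ cong (d j *ℚ_) (f-j l<2 l≤) ⟩
          d j *ℚ 1ℚ     ≡⟨ ℚ.*-identityʳ (d j) ⟩
          d j           ∎))) (eq l≤)
          where open ≡-Reasoning
        g1≢g0 : Shape 1 g → g 1 ≢ g 0
        g1≢g0 (inj₂ (distinct , _)) = distinct
        g1≢g0 (inj₁ (e , 2≤e , _ , init)) = λ g1≡g0 → contradiction
                (trans (sym (proj₁ (init 1≤m) (s≤s z≤n , 2≤e))) (trans g1≡g0 (proj₂ (init z≤n) λ ()))) λ ()
        x≡0 : x ≡ 0ℚ
        -- The coefficient `d j` cancels in the difference of the equations at the labels 1 and 0.
        x≡0 = *-zero-cancelˡ {g 1 +ℚ (- g 0)} (λ eq → g1≢g0 shape (minus-zero eq)) (begin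
          (g 1 +ℚ (- g 0)) *ℚ x                       ≡⟨ solve 4
              (λ a b x y → (a :+ (:- b)) :* x := (x :* a :+ y) :+ (:- (x :* b :+ y))) refl (g 1) (g 0) x
                (d j) ⟩
          (x *ℚ g 1 +ℚ d j) +ℚ (- (x *ℚ g 0 +ℚ d j))
              ≡⟨ cong₂ (λ y z → y +ℚ (- z)) (eq′ (s≤s (s≤s z≤n)) 1≤m) (eq′ (s≤s z≤n) z≤n) ⟩
          0ℚ                                          ∎)
          where
          open ≡-Reasoning
          minus-zero : ∀ {a b} → a +ℚ (- b) ≡ 0ℚ → a ≡ b
          minus-zero {a} {b} eq = trans (solve 2 (λ a b → a := (a :+ (:- b)) :+ b) refl a b)
              (trans (cong (_+ℚ b) eq) (ℚ.+-identityˡ b))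
        dj≡0 : d j ≡ 0ℚ
        dj≡0 = trans (trans (sym (ℚ.+-identityˡ (d j)))
            (cong (_+ℚ d j) (sym (trans (cong (_*ℚ g 0) x≡0) (ℚ.*-zeroˡ (g 0)))))) (eq′ (s≤s z≤n) z≤n)
        d≡0 : ∀ i → d i ≡ 0ℚ
        d≡0 i with i Fin.≟ j
        ... | yes refl = dj≡0
        ... | no i≢j   = d-other i i≢j
      peel (suc k) {g} {x} {d} k≤m shape d0 d> eq = proj₁ rec , undrop {d} {j} dj≡0 (proj₂ rec)
        where
        open ≡-Reasoning
        l₀ : ℕ
        l₀ = suc (suc k)
        j : Fin (suc m)
        j = fromℕ< (s≤s k≤m)
        toℕ-j : toℕ j ≡ l₀
        toℕ-j = Fin.toℕ-fromℕ< (s≤s k≤m)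
        elsewhere : ∀ i → i ≢ j → d i *ℚ f i l₀ ≡ 0ℚ
        elsewhere zero _ = trans (cong (_*ℚ f zero l₀) d0) (ℚ.*-zeroˡ (f zero l₀))
        elsewhere i@(suc _) i≢j with ℕ.<-cmp (toℕ i) l₀
        ... | tri< i< _ _ = trans (cong (d i *ℚ_) (f-above {i} (s≤s z≤n) i< k≤m)) (ℚ.*-zeroʳ (d i))
        ... | tri≈ _ i≡ _ = contradiction (Fin.toℕ-injective (trans i≡ (sym toℕ-j))) i≢j
        ... | tri> _ _ i> = trans (cong (_*ℚ f i l₀) (d> i i>)) (ℚ.*-zeroˡ (f i l₀))
        at-top : x *ℚ g l₀ +ℚ d j ≡ 0ℚ
        at-top = begin
          x *ℚ g l₀ +ℚ d j              ≡⟨ cong (x *ℚ g l₀ +ℚ_) (sym (ℚ.*-identityʳ (d j))) ⟩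
          x *ℚ g l₀ +ℚ d j *ℚ 1ℚ        ≡⟨ cong (λ y → x *ℚ g l₀ +ℚ d j *ℚ y) (sym (f-top {j} toℕ-j k≤m)) ⟩
          x *ℚ g l₀ +ℚ d j *ℚ f j l₀    ≡⟨ cong (x *ℚ g l₀ +ℚ_) (sym (∙-single d (F l₀) j elsewhere)) ⟩
          x *ℚ g l₀ +ℚ d ∙ F l₀         ≡⟨ eq k≤m ⟩
          0ℚ                            ∎
        eq′ : ∀ {l} → l ≤ m → x *ℚ (g l +ℚ (- (g l₀ *ℚ f j l))) +ℚ dropped d j ∙ F l ≡ 0ℚ
        eq′ {l} l≤ = begin
          x *ℚ (g l +ℚ (- (g l₀ *ℚ f j l))) +ℚ dropped d j ∙ F l
            ≡⟨ cong (x *ℚ (g l +ℚ (- (g l₀ *ℚ f j l))) +ℚ_) (dropped-∙ d j (F l)) ⟩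
          x *ℚ (g l +ℚ (- (g l₀ *ℚ f j l))) +ℚ (1ℚ *ℚ (d ∙ F l) +ℚ (- d j) *ℚ f j l)
            ≡⟨ solve 6 (λ x g g₀ f s dj → x :* (g :+ (:- (g₀ :* f))) :+ (con 1ℚ :* s :+ (:- dj) :* f)
                                       := (x :* g :+ s) :+ (:- ((x :* g₀ :+ dj) :* f))) refl x (g l) (g l₀)
                                           (f j l) (d ∙ F l) (d j) ⟩
          (x *ℚ g l +ℚ d ∙ F l) +ℚ (- ((x *ℚ g l₀ +ℚ d j) *ℚ f j l))
            ≡⟨ cong₂ (λ y w → y +ℚ (- (w *ℚ f j l))) (eq l≤) at-top ⟩
          0ℚ +ℚ (- (0ℚ *ℚ f j l))
            ≡⟨ solve 1 (λ f → con 0ℚ :+ (:- (con 0ℚ :* f)) := con 0ℚ) refl (f j l) ⟩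
          0ℚ ∎
        d′> : ∀ i → suc k < toℕ i → dropped d j i ≡ 0ℚ
        d′> i k<i with j Fin.≟ i
        ... | yes refl = dropped-same d j
        ... | no j≢i   =
            trans (dropped-other d j≢i) (d> i (ℕ.≤∧≢⇒< k<i λ eq → j≢i (Fin.toℕ-injective (trans toℕ-j eq))))
        d′0 : dropped d j zero ≡ 0ℚ
        d′0 = trans (dropped-other d {j} {zero} λ j≡0 → contradiction (trans (sym toℕ-j) (cong toℕ j≡0))
            λ ()) d0
        rec : x ≡ 0ℚ × (∀ i → dropped d j i ≡ 0ℚ)
        rec = peel k (ℕ.<⇒≤ k≤m) (reduced j toℕ-j k≤m shape) d′0 d′> eq′
        dj≡0 : d j ≡ 0ℚ
        dj≡0 = trans (trans (sym (ℚ.+-identityˡ (d j)))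
            (cong (_+ℚ d j) (sym (trans (cong (_*ℚ g l₀) (proj₁ rec)) (ℚ.*-zeroˡ (g l₀)))))) at-top

      colour-1 : ∀ {z} → Valid z → colour z ≡ 1 → z ≡ interval 0 1 ⊎
          (∃[ b ] z ≡ interval 1 b × 2 ≤ b × b ≤ suc m)
      colour-1 {interval 0 1} _ _ = inj₁ refl
      colour-1 {interval 1 b} (2≤b , b≤) _ = inj₂ (b , refl , 2≤b , b≤)
      colour-1 {interval (suc (suc _)) 1} (s≤s () , _) _
      colour-1 {notched 1} (_ , s≤s () , _) _

      -- The first block consists of {0}, with coefficients 1 and 0 at the labels 0 and 1, and of
      -- the intervals [1 , b).
      first-shape : ∀ {k} → suc k ≡ m → Shape (suc k) (f zero)
      first-shape {k} refl with colour-1 {z zero} (code-valid (s zero)) (z-colour zero)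
      ... | inj₂ (b , eq , 2≤b , b≤) =
          inj₁ (b , 2≤b , b≤ , λ {l} l≤ → subst (λ z → Value (z ∋ l) (f zero l)) eq (f-value zero l≤))
      ... | inj₁ eq =
          inj₂ ((λ g1≡g0 →
            contradiction (trans (sym (proj₁ (fv z≤n) (z≤n , s≤s z≤n)))
              (trans (sym g1≡g0) (proj₂ (fv (s≤s z≤n)) λ { (_ , s≤s ()) }))) λ ()) ,
              λ {l} 2≤l l≤ → proj₂ (fv l≤) λ (_ , l<1) → ℕ.<⇒≱ l<1 (ℕ.<⇒≤ 2≤l))
        where
        fv : ∀ {l} → l ≤ suc k → Value (0 ≤ l × l < 1) (f zero l)
        fv {l} l≤ = subst (λ z → Value (z ∋ l) (f zero l)) eq (f-value zero l≤)

    section-independent : LinearlyIndependent (form ∘ s)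
    section-independent d eq with 0 ℕ.<? m
    ... | yes 0<m = undrop {d} {zero} (proj₁ rec) (proj₂ rec)
      where
      open ≡-Reasoning
      k : ℕ
      k = pred m
      k+1 : suc k ≡ m
      k+1 = ℕ.suc-pred m ⦃ >-nonZero 0<m ⦄
      eq′ : ∀ {l} → l ≤ m → d zero *ℚ f zero l +ℚ dropped d zero ∙ F l ≡ 0ℚ
      eq′ {l} l≤ = begin
        d zero *ℚ f zero l +ℚ dropped d zero ∙ F l
          ≡⟨ cong (d zero *ℚ f zero l +ℚ_) (dropped-∙ d zero (F l)) ⟩
        d zero *ℚ f zero l +ℚ (1ℚ *ℚ (d ∙ F l) +ℚ (- d zero) *ℚ f zero l)
          ≡⟨ solve 3 (λ d f s → d :* f :+ (con 1ℚ :* s :+ (:- d) :* f) := s) refl (d zero) (f zero l)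
              (d ∙ F l) ⟩
        d ∙ F l
          ≡⟨ eq (at l) ⟩
        0ℚ ∎
      rec : d zero ≡ 0ℚ × (∀ i → dropped d zero i ≡ 0ℚ)
      rec = peel k (ℕ.≤-reflexive k+1) (first-shape k+1) (dropped-same d zero)
        (λ i k<i → contradiction (ℕ.≤-pred (Fin.toℕ<n i)) (ℕ.<⇒≱ (subst (_< toℕ i) k+1 k<i))) eq′
    -- With one vertex there is no label 1 to compare with; the only form is that of {0}.
    ... | no 0≮m =
        λ i → trans (cong d (Fin.toℕ-injective {j = zero}
          (ℕ.n≤0⇒n≡0 (ℕ.≤-trans (ℕ.≤-pred (Fin.toℕ<n i)) (ℕ.≮⇒≥ 0≮m))))) d0
      where
      open ≡-Reasoning
      only : ∀ i → i ≢ zero → d i *ℚ F 0 i ≡ 0ℚ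
      only i i≢0 = contradiction (Fin.toℕ-injective {j = zero}
          (ℕ.n≤0⇒n≡0 (ℕ.≤-trans (ℕ.≤-pred (Fin.toℕ<n i)) (ℕ.≮⇒≥ 0≮m)))) i≢0
      f0 : f zero 0 ≡ 1ℚ
      f0 with colour-1 {z zero} (code-valid (s zero)) (z-colour zero)
      ... | inj₁ eq = proj₁ (f-value zero z≤n) (subst (_∋ 0) (sym eq) (z≤n , s≤s z≤n))
      ... | inj₂ (b , _ , 2≤b , b≤) = contradiction (ℕ.≤-pred (ℕ.≤-trans 2≤b b≤)) 0≮m
      d0 : d zero ≡ 0ℚ
      d0 = begin
        d zero              ≡⟨ sym (ℚ.*-identityʳ (d zero)) ⟩
        d zero *ℚ 1ℚ        ≡⟨ cong (d zero *ℚ_) (sym f0) ⟩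
        d zero *ℚ f zero 0  ≡⟨ sym (∙-single d (F 0) zero only) ⟩
        d ∙ F 0             ≡⟨ eq (at 0) ⟩
        0ℚ                  ∎

  chain-factored : Factored (connectedSubgraphArrangement G)
  chain-factored = suc m , colouring , section-independent , singletons

-- Chains and the graphs of the classification

-- A spanning chain with an explicit inverse numbering, so that it can be composed with an
-- isomorphism in either direction.
record Layout {W : Set} (H : SimpleGraph W) (c : Bool) (m : ℕ) : Set where
  open SimpleGraph H
  field
    vertex       : ℕ → W
    number       : W → ℕ
    number≤      : ∀ w → number w ≤ m
    vertex-number : ∀ w → vertex (number w) ≡ w
    number-vertex : ∀ {i} → i ≤ m → number (vertex i) ≡ i
    adj⇒link     : ∀ {i j} → i ≤ m → j ≤ m → Adj (vertex i) (vertex j) → Link c i j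
    link⇒adj     : ∀ {i j} → i ≤ m → j ≤ m → Link c i j → Adj (vertex i) (vertex j)

  vertex-injective : ∀ {i j} → i ≤ m → j ≤ m → vertex i ≡ vertex j → i ≡ j
  vertex-injective i≤ j≤ eq = trans (sym (number-vertex i≤)) (trans (cong number eq) (number-vertex j≤))

chain⇒≅ : ∀ {n} {G : SimpleGraph (Fin n)} {W} {H : SimpleGraph W} {c m} (C : Chain G c m) →
          (∀ v → ∃[ i ] i ≤ m × Chain.at C i ≡ v) → Layout H c m → G ≅ H
chain⇒≅ {G = G} {H = H} {m = m} C spanning lay =
  mk↔ₛ′ (L.vertex ∘ lab) (C.at ∘ L.number) to-from from-to , λ u v → mk⇔
    (λ uv → L.link⇒adj (lab≤ u) (lab≤ v) (C.adj⇒link (lab≤ u) (lab≤ v)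
        (subst₂ G.Adj (sym (at-lab u)) (sym (at-lab v)) uv)))
    (λ uv → subst₂ G.Adj (at-lab u) (at-lab v)
        (C.link⇒adj (lab≤ u) (lab≤ v) (L.adj⇒link (lab≤ u) (lab≤ v) uv)))
  where
  module G = SimpleGraph G
  module C = Chain C
  module L = Layout lay
  lab = λ v → proj₁ (spanning v)
  lab≤ : ∀ v → lab v ≤ m
  lab≤ v = proj₁ (proj₂ (spanning v))
  at-lab : ∀ v → C.at (lab v) ≡ v
  at-lab v = proj₂ (proj₂ (spanning v))
  to-from : ∀ w → L.vertex (lab (C.at (L.number w))) ≡ w
  to-from w = trans (cong L.vertex (C.injective (lab≤ _) (L.number≤ w) (at-lab _))) (L.vertex-number w)
  from-to : ∀ v → C.at (L.number (L.vertex (lab v))) ≡ v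
  from-to v = trans (cong C.at (L.number-vertex (lab≤ v))) (at-lab v)

≅⇒chain : ∀ {n} {G : SimpleGraph (Fin n)} {W} {H : SimpleGraph W} {c m} → (T c → 2 ≤ m) → G ≅ H →
    Layout H c m →
          Σ (Chain G c m) λ C → ∀ v → ∃[ i ] i ≤ m × Chain.at C i ≡ v
≅⇒chain {G = G} {H = H} {m = m} fits (f , adj) lay = record
  { at         = from ∘ L.vertex
  ; injective  =
      λ i≤ j≤ eq → L.vertex-injective i≤ j≤ (trans (sym (strictlyInverseˡ _))
        (trans (cong to eq) (strictlyInverseˡ _)))
  ; adj⇒link   = λ i≤ j≤ a → L.adj⇒link i≤ j≤
      (subst₂ H.Adj (strictlyInverseˡ _) (strictlyInverseˡ _) (Equivalence.to (adj _ _) a))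
  ; link⇒adj   = λ i≤ j≤ l → Equivalence.from (adj _ _)
      (subst₂ H.Adj (sym (strictlyInverseˡ _)) (sym (strictlyInverseˡ _)) (L.link⇒adj i≤ j≤ l))
  ; chord-fits = fits
  } , λ v → L.number (to v) , L.number≤ (to v) , trans (cong from (L.vertex-number (to v)))
      (strictlyInverseʳ v)
  where
  open Inverse f
  module H = SimpleGraph H
  module L = Layout lay

-- Total because `Chain.at` is; the values beyond `m` are defaults.
clamp : ∀ {m} → ℕ → Fin (suc m)
clamp         zero    = zero
clamp {zero}  (suc i) = zero
clamp {suc m} (suc i) = suc (clamp i)

toℕ-clamp : ∀ {m i} → i ≤ m → toℕ (clamp {m} i) ≡ i
toℕ-clamp z≤n      = refl
toℕ-clamp (s≤s i≤) = cong suc (toℕ-clamp i≤)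

clamp-toℕ : ∀ {m} (y : Fin (suc m)) → clamp (toℕ y) ≡ y
clamp-toℕ y = Fin.toℕ-injective (toℕ-clamp (ℕ.≤-pred (Fin.toℕ<n y)))

path-layout : ∀ m → Layout (path (suc m)) false m
path-layout m = record
  { vertex        = clamp
  ; number        = toℕ
  ; number≤       = λ y → ℕ.≤-pred (Fin.toℕ<n y)
  ; vertex-number = clamp-toℕ
  ; number-vertex = toℕ-clamp
  ; adj⇒link      = a⇒l
  ; link⇒adj      = l⇒a
  }
  where
  open SimpleGraph (path (suc m)) using (Adj)
  clamp-injective : ∀ {i j} → i ≤ m → j ≤ m → clamp {m} i ≡ clamp j → i ≡ j
  clamp-injective i≤ j≤ eq = trans (sym (toℕ-clamp i≤)) (trans (cong toℕ eq) (toℕ-clamp j≤))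
  a⇒l : ∀ {i j} → i ≤ m → j ≤ m → Adj (clamp i) (clamp j) → Link false i j
  a⇒l i≤ j≤ (_ , inj₁ e) rewrite toℕ-clamp i≤ | toℕ-clamp j≤ | ℕ.suc-injective e = up
  a⇒l i≤ j≤ (_ , inj₂ e) rewrite toℕ-clamp i≤ | toℕ-clamp j≤ | ℕ.suc-injective e = down
  l⇒a : ∀ {i j} → i ≤ m → j ≤ m → Link false i j → Adj (clamp i) (clamp j)
  l⇒a i≤ j≤ up   = (λ eq → ℕ.1+n≢n (sym (clamp-injective i≤ j≤ eq))) ,
    inj₁ (cong suc (trans (toℕ-clamp j≤) (cong suc (sym (toℕ-clamp i≤)))))
  l⇒a i≤ j≤ down = (λ eq → ℕ.1+n≢n (clamp-injective i≤ j≤ eq)) ,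
    inj₂ (cong suc (trans (toℕ-clamp i≤) (cong suc (sym (toℕ-clamp j≤)))))

triangle-layout : ∀ {m} → 2 ≤ m → Layout (Δ₁ m) true m
triangle-layout {m} 2≤m = record
  { vertex        = vertex
  ; number        = number
  ; number≤       = number≤
  ; vertex-number = vertex-number
  ; number-vertex = number-vertex
  ; adj⇒link      = a⇒l
  ; link⇒adj      = l⇒a
  }
  where
  open SimpleGraph (Δ₁ m) using (Adj; adjSym)
  vertex : ℕ → Fin (suc m)
  vertex zero    = clamp m
  vertex (suc i) = clamp i
  number : Fin (suc m) → ℕ
  number y with toℕ y ℕ.≟ m
  ... | yes _ = 0
  ... | no _  = suc (toℕ y)
  number≤ : ∀ y → number y ≤ m
  number≤ y with toℕ y ℕ.≟ m
  ... | yes _   = z≤n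
  ... | no y≢m = ℕ.≤∧≢⇒< (ℕ.≤-pred (Fin.toℕ<n y)) y≢m
  vertex-number : ∀ y → vertex (number y) ≡ y
  vertex-number y with toℕ y ℕ.≟ m
  ... | yes y≡m = trans (cong clamp (sym y≡m)) (clamp-toℕ y)
  ... | no _    = clamp-toℕ y
  number-vertex : ∀ {i} → i ≤ m → number (vertex i) ≡ i
  number-vertex {zero} _ with toℕ (clamp {m} m) ℕ.≟ m
  ... | yes _  = refl
  ... | no ≢m  = contradiction (toℕ-clamp ℕ.≤-refl) ≢m
  number-vertex {suc i} i<m with toℕ (clamp {m} i) ℕ.≟ m
  ... | yes ≡m = contradiction (trans (sym (toℕ-clamp (ℕ.<⇒≤ i<m))) ≡m) (ℕ.<⇒≢ i<m)
  ... | no _   = cong suc (toℕ-clamp (ℕ.<⇒≤ i<m))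
  vertex≢ : ∀ {i j} → i ≤ m → j ≤ m → i ≢ j → vertex i ≢ vertex j
  vertex≢ i≤ j≤ i≢j eq = i≢j (trans (sym (number-vertex i≤)) (trans (cong number eq) (number-vertex j≤)))
  -- The label in `Δ₁ m` of the vertex numbered `i`: the apex m + 1 is numbered 0, and the path
  -- keeps its labels.
  lbl : ℕ → ℕ
  lbl zero    = suc m
  lbl (suc i) = suc i
  label-vertex : ∀ {i} → i ≤ m → label (vertex i) ≡ lbl i
  label-vertex {zero}  _   = cong suc (toℕ-clamp ℕ.≤-refl)
  label-vertex {suc i} i<m = cong suc (toℕ-clamp (ℕ.<⇒≤ i<m))
  edge⇒link : ∀ {i j} → i ≤ m → j ≤ m → TriangleEdge m (lbl i) (lbl j) → Link true i j
  edge⇒link {zero} i≤ j≤ (inj₁ (m<m , _)) = contradiction m<m (ℕ.<⇒≱ (ℕ.m≤n⇒m≤1+n (ℕ.n<1+n m)))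
  edge⇒link {zero} i≤ j≤ (inj₂ (inj₁ (refl , _))) = contradiction 2≤m λ ()
  edge⇒link {zero} i≤ j≤ (inj₂ (inj₂ (refl , _))) = contradiction 2≤m λ { (s≤s ()) }
  edge⇒link {suc i} {zero} i≤ j≤ (inj₁ (i<m , refl)) = contradiction i<m (ℕ.<-irrefl refl)
  edge⇒link {suc i} {zero} i≤ j≤ (inj₂ (inj₁ (refl , _))) = down
  edge⇒link {suc i} {zero} i≤ j≤ (inj₂ (inj₂ (refl , _))) = chord↓ _
  edge⇒link {suc i} {suc j} i≤ j≤ (inj₁ (_ , refl)) = up
  edge⇒link {suc i} {suc j} i≤ j≤ (inj₂ (inj₁ (_ , refl))) = contradiction j≤ (ℕ.<-irrefl refl)
  edge⇒link {suc i} {suc j} i≤ j≤ (inj₂ (inj₂ (_ , refl))) = contradiction j≤ (ℕ.<-irrefl refl)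
  a⇒l : ∀ {i j} → i ≤ m → j ≤ m → Adj (vertex i) (vertex j) → Link true i j
  a⇒l i≤ j≤ (_ , inj₁ e) = edge⇒link i≤ j≤ (subst₂ (TriangleEdge m) (label-vertex i≤) (label-vertex j≤) e)
  a⇒l i≤ j≤ (_ , inj₂ e) =
      link-sym (edge⇒link j≤ i≤ (subst₂ (TriangleEdge m) (label-vertex j≤) (label-vertex i≤) e))
  edge⇒adj : ∀ {i j} → i ≤ m → j ≤ m → i ≢ j → TriangleEdge m (lbl i) (lbl j) → Adj (vertex i) (vertex j)
  edge⇒adj i≤ j≤ i≢j e =
      vertex≢ i≤ j≤ i≢j , inj₁ (subst₂ (TriangleEdge m) (sym (label-vertex i≤)) (sym (label-vertex j≤)) e)
  upward : ∀ {i} → suc i ≤ m → Adj (vertex i) (vertex (suc i))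
  upward {zero}  i<m = adjSym (edge⇒adj i<m z≤n (λ ()) (inj₂ (inj₁ (refl , refl))))
  upward {suc i} i<m = edge⇒adj (ℕ.<⇒≤ i<m) i<m (ℕ.1+n≢n ∘ sym) (inj₁ (i<m , refl))
  l⇒a : ∀ {i j} → i ≤ m → j ≤ m → Link true i j → Adj (vertex i) (vertex j)
  l⇒a i≤ j≤ up         = upward j≤
  l⇒a i≤ j≤ down       = adjSym (upward i≤)
  l⇒a i≤ j≤ (chord↑ _) = adjSym (edge⇒adj j≤ i≤ (λ ()) (inj₂ (inj₂ (refl , refl))))
  l⇒a i≤ j≤ (chord↓ _) = edge⇒adj i≤ j≤ (λ ()) (inj₂ (inj₂ (refl , refl)))

theorem8p10 : (n : ℕ) (G : SimpleGraph (Fin n)) → Connected G →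
    Factored (connectedSubgraphArrangement G) ⇔
    ((∃[ m ] G ≅ path m) ⊎ (∃[ m ] 2 ≤ m × G ≅ Δ₁ m))
theorem8p10 n G connected = mk⇔ recognise factor
  where
  recognise : Factored (connectedSubgraphArrangement G) → (∃[ m ] G ≅ path m) ⊎ (∃[ m ] 2 ≤ m × G ≅ Δ₁ m)
  recognise factored with spanning-chain {G = G} factored connected
  ... | false , m , C , spanning = inj₁ (suc m , chain⇒≅ C spanning (path-layout m))
  ... | true  , m , C , spanning =
      inj₂ (m , Chain.chord-fits C _ , chain⇒≅ C spanning (triangle-layout (Chain.chord-fits C _)))

  factor : (∃[ m ] G ≅ path m) ⊎ (∃[ m ] 2 ≤ m × G ≅ Δ₁ m) → Factored (connectedSubgraphArrangement G)
  factor (inj₁ (zero , f , _)) = contradiction (Inverse.to f (proj₁ connected)) λ ()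
  factor (inj₁ (suc m , G≅)) with ≅⇒chain {G = G} (λ ()) G≅ (path-layout m)
  ... | C , spanning = chain-factored C spanning
  factor (inj₂ (m , 2≤m , G≅)) with ≅⇒chain {G = G} (λ _ → 2≤m) G≅ (triangle-layout 2≤m)
  ... | C , spanning = chain-factored C spanning
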